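{- Every affine Coxeter group of type $\widetilde A$, $\widetilde C$, or $\widetilde G_2$ is futuristic.
   Context: Let $(W,S)$ be a Coxeter system with $S=\{s_i:i\in I\}$, $I$ a finite index set; $m(i,i')$ is the order of $s_is_{i'}$. The Coxeter graph $\Gamma_W$ has vertex set $I$, with distinct $i,i'$ joined by an edge labeled $m(i,i')$ whenever $m(i,i')\ge 3$ (label $3$ is omitted in drawings). Types: $\widetilde A_1$ has two vertices joined by an edge labeled $\infty$; $\widetilde A_{n-1}$ ($n\ge 3$) has as Coxeter graph the $n$-vertex cycle with all labels $3$; $\widetilde C_{n-1}$ ($n\ge 3$) has as Coxeter graph the $n$-vertex path whose first and last edges are labeled $4$ and whose other edges are labeled $3$; $\widetilde G_2$ has as Coxeter graph the $3$-vertex path with edge labels $3$ and $6$. The root space is $V=\mathbb R^I$ with standard basis the simple roots $\{\alpha_i:i\in I\}$ and symmetric bilinear form $B(\alpha_i,\alpha_{i'})=-\cos(\pi/m(i,i'))$ (and $-1$ if $m(i,i')=\infty$). $W$ acts on $V$ by $s_i\beta=\beta-2B(\beta,\alpha_i)\alpha_i$. The root system is $\Phi=\{w\alpha_i:w\in W,i\in I\}=\Phi^+\sqcup\Phi^-$, where $\Phi^+$ are the roots that are nonnegative combinations of simple roots and $\Phi^-=-\Phi^+$. For $\beta\in\Phi$ the half-space $H_\beta^+$ is $\{w\in W:w\beta\in\Phi^+\}$. A subset of $W$ is convex if it is an intersection of half-spaces (the empty intersection being $W$). For a nonempty convex set $\mathscr L\subseteq W$ let $\mathrm R(\mathscr L)=\{\beta\in\Phi:\mathscr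 L\subseteq H_\beta^+\}$. For $i\in I$, the toggle $\tau_i\colon W\to W$ is defined by $\tau_i(u)=u$ if $u^{ -1}\alpha_i\in\mathrm R(\mathscr L)$ and $\tau_i(u)=s_iu$ otherwise. A Coxeter element is a product $c=s_{i_n}\cdots s_{i_1}$ where $i_1,\ldots,i_n$ is an ordering of $I$ (each element once); $\mathrm{Pro}_c=\tau_{i_n}\cdots\tau_{i_1}$ (composition), which depends only on $c$ and $\mathscr L$. The set $\mathscr L$ is heavy with respect to $c$ if every periodic point of $\mathrm{Pro}_c$ (i.e. every $u\in W$ with $\mathrm{Pro}_c^K(u)=u$ for some $K\ge 1$) lies in $\mathscr L$. The Coxeter group $W$ is futuristic if every nonempty convex subset of $W$ is heavy with respect to every Coxeter element of $W$. -}

module Defs where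

open import Level using (Level; 0ℓ) renaming (suc to lsuc; _⊔_ to _⊔ˡ_)
open import Algebra.Apartness.Bundles using (HeytingField)
open import Algebra.Bundles using (Group; CommutativeRing)
import Algebra.Definitions.RawMonoid as RawMonoidOps
import Algebra.Properties.CommutativeMonoid.Sum as CommutativeMonoidSum
open import Data.Bool.Base using (if_then_else_; _∧_; _∨_)
open import Data.Fin.Base using (Fin; toℕ)
open import Data.Fin.Properties using (_≟_)
open import Data.List.Base using (List; []; _∷_; _++_; foldr; reverse; replicate; concat; allFin)
import Data.List.Properties as List
open import Data.List.Relation.Binary.Permutation.Propositional using (_↭_)
open import Data.Nat.Base as ℕ using (ℕ; zero; suc; z≤n; s≤s; _≡ᵇ_)
open import Data.Nat.Properties using (⊓-comm; ⊔-comm)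
open import Data.Product.Base using (Σ; Σ-syntax; ∃; ∃-syntax; _×_; _,_; proj₁)
open import Data.Sum.Base using (_⊎_; inj₁; inj₂)
open import Function.Bundles using (_⇔_)
open import Relation.Binary.Construct.Add.Supremum.NonStrict ℕ._≤_ using (_≤⁺_; [_]; _≤⊤⁺)
open import Relation.Binary.Core using (Rel)
open import Relation.Binary.PropositionalEquality using (_≡_; _≢_; refl; sym; cong; cong₂; subst)
open import Relation.Binary.Structures using (IsStrictPartialOrder)
open import Relation.Nullary using (¬_; does; yes; no; contradiction)
open import Relation.Nullary.Construct.Add.Supremum using (_⁺; ⊤⁺; [_])
open import Relation.Unary using (Pred; _∈_; _⊆_; Satisfiable)

-- The real numbers with their trigonometric functions, given axiomatically:
-- a Cauchy-complete Archimedean ordered field, unique up to isomorphism.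
-- Order totality is expressed by apartness (cotransitive and tight in a
-- Heyting field), so the axioms hold for the classical reals and also for
-- constructive Cauchy reals.  The trigonometric axioms determine cos and sin,
-- and the last one fixes the radian as the unit of angle.
record Reals (c ℓ₁ ℓ₂ ℓ₃ : Level) : Set (lsuc (c ⊔ˡ ℓ₁ ⊔ˡ ℓ₂ ⊔ˡ ℓ₃)) where
  infix 4 _<_ _≤_
  field
    heytingField : HeytingField c ℓ₁ ℓ₂

  open HeytingField heytingField public
    hiding (refl; sym; trans; reflexive)

  commutativeRing : CommutativeRing c ℓ₁
  commutativeRing = record { isCommutativeRing = isCommutativeRing }

  open CommutativeRing commutativeRing public
    using (+-rawMonoid; +-commutativeMonoid)
  open RawMonoidOps +-rawMonoid public
    using () renaming (_×_ to _·_)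

  field
    _<_                  : Rel Carrier ℓ₃
    isStrictPartialOrder : IsStrictPartialOrder _≈_ _<_
    <⇒#                  : ∀ {x y} → x < y → x # y
    #⇒<∨>                : ∀ {x y} → x # y → x < y ⊎ y < x
    0<1                  : 0# < 1#
    +-monoˡ-<            : ∀ {x y} z → x < y → x + z < y + z
    *-pos                : ∀ {x y} → 0# < x → 0# < y → 0# < x * y

    archimedean : ∀ x → ∃[ n ] x < n · 1#
    complete    : (a : ℕ → Carrier) →
      (∀ ε → 0# < ε → ∃[ N ] ∀ k l → N ℕ.≤ k → N ℕ.≤ l → a k - a l < ε) →
      ∃[ L ] ∀ ε → 0# < ε →
        ∃[ N ] ∀ k → N ℕ.≤ k → a k - L < ε × L - a k < ε

    cos sin  : Carrier → Carrier
    π        : Carrier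
    cos-cong : ∀ {x y} → x ≈ y → cos x ≈ cos y
    sin-cong : ∀ {x y} → x ≈ y → sin x ≈ sin y
    cos-+    : ∀ x y → cos (x + y) ≈ cos x * cos y - sin x * sin y
    sin-+    : ∀ x y → sin (x + y) ≈ sin x * cos y + cos x * sin y
    cos²+sin²≈1 : ∀ x → cos x * cos x + sin x * sin x ≈ 1#
    0<π      : 0# < π
    cos-π    : cos π ≈ - 1#
    sin-π    : sin π ≈ 0#
    sin-pos  : ∀ x → 0# < x → x < π → 0# < sin x
    radian   : ∀ x → 0# < x → x < π → x * cos x < sin x × sin x < x

  open IsStrictPartialOrder isStrictPartialOrder public
    using (<-respˡ-≈; <-respʳ-≈) renaming (trans to <-trans)

  _≤_ : Rel Carrier ℓ₃
  x ≤ y = ¬ (y < x)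

  0<suc·1 : ∀ k → 0# < suc k · 1#
  0<suc·1 zero    = <-respʳ-≈ (HeytingField.sym heytingField (+-identityʳ 1#)) 0<1
  0<suc·1 (suc k) =
    <-trans (0<suc·1 k)
      (<-respʳ-≈ (+-comm _ _)
        (<-respˡ-≈ (+-identityˡ _)
          (<-respʳ-≈ (+-comm _ _) (+-monoˡ-< (suc k · 1#) 0<1))))

  _⁻¹⟨_#0⟩ : ∀ x → x # 0# → Carrier
  x ⁻¹⟨ x#0 #0⟩ = proj₁ (#⇒invertible x#0)

  -- x /suc k  is  x / (1 + k).
  _/suc_ : Carrier → ℕ → Carrier
  x /suc k = x * ((suc k · 1#) ⁻¹⟨ #-sym (<⇒# (0<suc·1 k)) #0⟩)


-- ℕ ⁺ is ℕ with a top element ⊤⁺ = ∞.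
record CoxeterMatrix (n : ℕ) : Set where
  field
    m         : Fin n → Fin n → ℕ ⁺
    m-diag    : ∀ i → m i i ≡ [ 1 ]
    m-sym     : ∀ i j → m i j ≡ m j i
    m-offDiag : ∀ i j → i ≢ j → [ 2 ] ≤⁺ m i j

-- The Coxeter matrix on the vertices 0, …, n - 1 whose entry at an unordered
-- pair {i < j} is  ℓ i j, the value 2 standing for the absence of an edge.
fromLabels : ∀ n (ℓ : ℕ → ℕ → ℕ ⁺) → (∀ i j → [ 2 ] ≤⁺ ℓ i j) → CoxeterMatrix n
fromLabels n ℓ 2≤ℓ = record
  { m = m ; m-diag = m-diag ; m-sym = m-sym ; m-offDiag = m-offDiag }
  where
  m : Fin n → Fin n → ℕ ⁺
  m i j = if does (i ≟ j) then [ 1 ]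
          else ℓ (toℕ i ℕ.⊓ toℕ j) (toℕ i ℕ.⊔ toℕ j)

  m-diag : ∀ i → m i i ≡ [ 1 ]
  m-diag i with i ≟ i
  ... | yes _   = refl
  ... | no  i≢i = contradiction refl i≢i

  m-sym : ∀ i j → m i j ≡ m j i
  m-sym i j with i ≟ j | j ≟ i
  ... | yes _   | yes _   = refl
  ... | yes i≡j | no  j≢i = contradiction (sym i≡j) j≢i
  ... | no  i≢j | yes j≡i = contradiction (sym j≡i) i≢j
  ... | no  _   | no  _   = cong₂ ℓ (⊓-comm (toℕ i) (toℕ j)) (⊔-comm (toℕ i) (toℕ j))

  m-offDiag : ∀ i j → i ≢ j → [ 2 ] ≤⁺ m i j
  m-offDiag i j i≢j with i ≟ j
  ... | yes i≡j = contradiction i≡j i≢j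
  ... | no  _   = 2≤ℓ _ _

-- Labels of the form 2 + k.
fromLabels₂ : ∀ n → (ℕ → ℕ → ℕ) → CoxeterMatrix n
fromLabels₂ n k = fromLabels n (λ i j → [ 2 ℕ.+ k i j ]) (λ _ _ → [ s≤s (s≤s z≤n) ])

-- The path 0 — 1 — ⋯ — n - 1 whose edge {i, i + 1} is labelled 3 + e i.
path : ∀ n → (ℕ → ℕ) → CoxeterMatrix n
path n e = fromLabels₂ n λ i j → if j ≡ᵇ suc i then suc (e i) else 0

-- The cycle 0 — 1 — ⋯ — n - 1 — 0 with all labels 3.
cycle : ∀ n → CoxeterMatrix n
cycle n = fromLabels₂ n λ i j →
  if (j ≡ᵇ suc i) ∨ ((i ≡ᵇ 0) ∧ (suc j ≡ᵇ n)) then 1 else 0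

-- The affine types Ã, C̃ and G̃₂, indexed by the number of vertices of the
-- Coxeter graph: A~ k and C~ k are the types usually written Ã_{2+k} and
-- C̃_{2+k}.
data Type : ℕ → Set where
  A~₁ : Type 2
  A~  : ∀ k → Type (3 ℕ.+ k)
  C~  : ∀ k → Type (3 ℕ.+ k)
  G~₂ : Type 3

coxeterMatrix : ∀ {n} → Type n → CoxeterMatrix n
coxeterMatrix A~₁    = fromLabels 2 (λ _ _ → ⊤⁺) (λ _ _ → [ 2 ] ≤⊤⁺)
coxeterMatrix (A~ k) = cycle (3 ℕ.+ k)
coxeterMatrix (C~ k) = path (3 ℕ.+ k) λ i → if (i ≡ᵇ 0) ∨ (i ≡ᵇ suc k) then 1 else 0
coxeterMatrix G~₂    = path 3 λ i → if i ≡ᵇ 0 then 0 else 3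


-- The Coxeter group  ⟨ sᵢ ∣ (sᵢ sⱼ)^m(i,j) = 1 whenever m(i,j) < ∞ ⟩, as words
-- modulo the congruence generated by the relations.  The relations with i = j
-- are sᵢ² = 1, which makes reversal the inverse.
module CoxeterGroup {n : ℕ} (M : CoxeterMatrix n) where
  open CoxeterMatrix M

  infix 4 _~_
  data _~_ : Rel (List (Fin n)) 0ℓ where
    ~-refl  : ∀ {u} → u ~ u
    ~-sym   : ∀ {u v} → u ~ v → v ~ u
    ~-trans : ∀ {u v w} → u ~ v → v ~ w → u ~ w
    ~-cong  : ∀ {u u′ v v′} → u ~ u′ → v ~ v′ → u ++ v ~ u′ ++ v′
    ~-rel   : ∀ i j {k} → m i j ≡ [ k ] → concat (replicate k (i ∷ j ∷ [])) ~ []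

  ≡⇒~ : ∀ {u v} → u ≡ v → u ~ v
  ≡⇒~ refl = ~-refl

  ~-inverseʳ : ∀ u → u ++ reverse u ~ []
  ~-inverseʳ []      = ~-refl
  ~-inverseʳ (i ∷ u) =
    ~-trans (≡⇒~ (cong (i ∷_) (cong (u ++_) (List.unfold-reverse i u))))
      (~-trans (≡⇒~ (cong (i ∷_) (sym (List.++-assoc u (reverse u) (i ∷ [])))))
        (~-trans (~-cong {i ∷ []} ~-refl (~-cong (~-inverseʳ u) ~-refl))
          (~-rel i i (m-diag i))))

  ~-inverseˡ : ∀ u → reverse u ++ u ~ []
  ~-inverseˡ u =
    subst (λ v → reverse u ++ v ~ []) (List.reverse-involutive u) (~-inverseʳ (reverse u))

  ~-reverse-cong : ∀ {u v} → u ~ v → reverse u ~ reverse v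
  ~-reverse-cong {u} {v} u~v =
    ~-trans (≡⇒~ (sym (List.++-identityʳ (reverse u))))
      (~-trans (~-cong {reverse u} ~-refl
                 (~-trans (~-sym (~-inverseʳ v)) (~-cong (~-sym u~v) ~-refl)))
        (~-trans (≡⇒~ (sym (List.++-assoc (reverse u) u (reverse v))))
          (~-cong (~-inverseˡ u) ~-refl)))

  W : Group 0ℓ 0ℓ
  W = record
    { Carrier = List (Fin n)
    ; _≈_     = _~_
    ; _∙_     = _++_
    ; ε       = []
    ; _⁻¹     = reverse
    ; isGroup = record
      { isMonoid = record
        { isSemigroup = record
          { isMagma = record
            { isEquivalence = record { refl = ~-refl ; sym = ~-sym ; trans = ~-trans }
            ; ∙-cong        = ~-cong
            }
          ; assoc = λ u v w → ≡⇒~ (List.++-assoc u v w)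
          }
        ; identity = (λ _ → ~-refl) , (λ u → ≡⇒~ (List.++-identityʳ u))
        }
      ; inverse = ~-inverseˡ , ~-inverseʳ
      ; ⁻¹-cong = ~-reverse-cong
      }
    }

  s : Fin n → Group.Carrier W
  s i = i ∷ []


module Billiards {c ℓ₁ ℓ₂ ℓ₃ : Level} (ℝ : Reals c ℓ₁ ℓ₂ ℓ₃)
                 {n : ℕ} (M : CoxeterMatrix n) where
  open Reals ℝ hiding (_⁻¹⟨_#0⟩)
  open CommutativeMonoidSum +-commutativeMonoid using (sum)
  open CoxeterMatrix M
  open CoxeterGroup M using (W; s)
  open Group W using (_∙_; _⁻¹; ε) renaming (Carrier to ∣W∣; _≈_ to _≈ʷ_)

  V : Set c
  V = Fin n → Carrier

  α : Fin n → V
  α i j = if does (i ≟ j) then 1# else 0#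

  -- -cos(π/m), or -1 for m = ∞.  A Coxeter matrix has no entry 0, so the
  -- second clause is never used.
  formEntry : ℕ ⁺ → Carrier
  formEntry ⊤⁺        = - 1#
  formEntry [ zero ]  = 0#
  formEntry [ suc k ] = - cos (π /suc k)

  B : V → V → Carrier
  B β γ = sum λ i → sum λ j → β i * γ j * formEntry (m i j)

  reflect : Fin n → V → V
  reflect i β j = β j - (1# + 1#) * B β (α i) * α i j

  -- The action of W on V: an element of ∣W∣ is a word in the generators.
  infixr 5 _▷_
  _▷_ : ∣W∣ → V → V
  w ▷ β = foldr reflect β w

  Φ : Pred V ℓ₁
  Φ β = ∃[ w ] ∃[ i ] ∀ j → β j ≈ (w ▷ α i) j

  Φ⁺ : Pred V (ℓ₁ ⊔ˡ ℓ₃)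
  Φ⁺ β = β ∈ Φ × (∀ j → 0# ≤ β j)

  H⁺ : V → Pred ∣W∣ (ℓ₁ ⊔ˡ ℓ₃)
  H⁺ β w = w ▷ β ∈ Φ⁺

  -- 𝓛 is the intersection of the half-spaces H⁺ β for β in a set A of roots.
  Convex : ∀ a {p} → Pred ∣W∣ p → Set (c ⊔ˡ ℓ₁ ⊔ˡ ℓ₃ ⊔ˡ p ⊔ˡ lsuc a)
  Convex a 𝓛 = Σ[ A ∈ Pred V a ] (A ⊆ Φ) × (∀ w → w ∈ 𝓛 ⇔ (∀ β → β ∈ A → w ∈ H⁺ β))

  R : ∀ {p} → Pred ∣W∣ p → Pred V (ℓ₁ ⊔ˡ ℓ₃ ⊔ˡ p)
  R 𝓛 β = β ∈ Φ × (𝓛 ⊆ H⁺ β)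

  -- Membership in R 𝓛 need not be decidable, so the maps τᵢ, Pro and their
  -- iterates are given by their graphs: τ 𝓛 i u v says that τᵢ(u) = v.
  τ : ∀ {p} → Pred ∣W∣ p → Fin n → Rel ∣W∣ (ℓ₁ ⊔ˡ ℓ₃ ⊔ˡ p)
  τ 𝓛 i u v = (R 𝓛 (u ⁻¹ ▷ α i)   × v ≈ʷ u)
            ⊎ (¬ R 𝓛 (u ⁻¹ ▷ α i) × v ≈ʷ s i ∙ u)

  -- An ordering i₁, …, iₙ of I, as the list i₁ ∷ ⋯ ∷ iₙ ∷ [].
  IsOrdering : Pred (List (Fin n)) 0ℓ
  IsOrdering is = is ↭ allFin n

  -- s_{iₙ} ⋯ s_{i₁}
  coxeterProduct : List (Fin n) → ∣W∣
  coxeterProduct []       = ε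
  coxeterProduct (i ∷ is) = coxeterProduct is ∙ s i

  IsCoxeterElement : Pred ∣W∣ 0ℓ
  IsCoxeterElement c = ∃[ is ] IsOrdering is × c ≈ʷ coxeterProduct is

  -- τ_{iₙ} ∘ ⋯ ∘ τ_{i₁}, so that τ_{i₁} is applied first.
  data Pro {p} (𝓛 : Pred ∣W∣ p) : List (Fin n) → Rel ∣W∣ (ℓ₁ ⊔ˡ ℓ₃ ⊔ˡ p) where
    []  : ∀ {u v} → u ≈ʷ v → Pro 𝓛 [] u v
    _∷_ : ∀ {i is u v w} → τ 𝓛 i u v → Pro 𝓛 is v w → Pro 𝓛 (i ∷ is) u w

  data Iterate {r} (F : Rel ∣W∣ r) : ℕ → Rel ∣W∣ r where
    []  : ∀ {u v} → u ≈ʷ v → Iterate F 0 u v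
    _∷_ : ∀ {k u v w} → F u v → Iterate F k v w → Iterate F (suc k) u w

  Periodic : ∀ {r} → Rel ∣W∣ r → Pred ∣W∣ r
  Periodic F u = ∃[ K ] 1 ℕ.≤ K × Iterate F K u u

  -- Pro_c is computed from any ordering with product c.
  Heavy : ∀ {p} → Pred ∣W∣ p → ∣W∣ → Set (ℓ₁ ⊔ˡ ℓ₃ ⊔ˡ p)
  Heavy 𝓛 c = ∀ is → IsOrdering is → c ≈ʷ coxeterProduct is →
              ∀ u → Periodic (Pro 𝓛 is) u → u ∈ 𝓛

  -- a and p are the universe levels of the subsets of Φ and of W considered.
  Futuristic : ∀ a p → Set (c ⊔ˡ ℓ₁ ⊔ˡ ℓ₃ ⊔ˡ lsuc a ⊔ˡ lsuc p)
  Futuristic a p = (𝓛 : Pred ∣W∣ p) → Convex a 𝓛 → Satisfiable 𝓛 →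
                   ∀ c → IsCoxeterElement c → Heavy 𝓛 c

open Billiards public using (Futuristic)

{-# OPTIONS --safe #-}

-- In the coordinates given by a Cartan matrix, roots are integer vectors.  Let u₀, u₁, … be the
-- orbit of a periodic point under the successive toggles, and let β ∈ R(𝓛).  If uₜ β is positive,
-- then so is uₜ₊₁ β, since s i makes no positive root other than α i negative and the toggle is
-- blocked if uₜ β = α i.  By periodicity the sign of uₜ β never changes, and if u₀ ∉ 𝓛, some
-- β ∈ R(𝓛) stays negative forever.
--
-- For Ã and C̃, the group permutes the gaps of a line of labelled walls, and β becomes a pair of
-- tokens x ≺ y with x to the right of y at all times.  If the wall to the left of x is toggled
-- before the wall to its right, then x moves to the left until it is blocked by a token w ≺ x, to
-- which the same argument applies; this ray travels to the left forever without meeting y, which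
-- returns to its place periodically.  Hence the wall to the right of x is always toggled first, it
-- is never blocked, and x moves to the right forever, contradicting periodicity.
--
-- For G̃₂, the queue of upcoming toggles and the root - uₜ β modulo δ = (1, 2, 3) take finitely
-- many values.  Searching through them shows that, up to neutral states, either the negative root
-- is turned positive or its height increases within five steps.  In a neutral state an auxiliary
-- root η gains δ in every six steps, while the height of its translate by a fixed element of 𝓛
-- cannot increase; this is again incompatible with periodicity.

module Submission where

open import Defs

-- Membership in R(𝓛) cannot be decided, so a toggle is only a relation and it cannot be predicted
-- whether a step is blocked; every case distinction is made on a toggle that has been given or on
-- integers. This is why the cosines are removed at the outset: rescaling the simple roots to their
-- crystallographic lengths replaces the real order by the decidable order of ℤ. A wall has exactly
-- two neighbours, so a line of walls forces every column of its Cartan matrix to sum to zero. For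
-- the matrix of G̃₂ the column sums are 1, -2 and 1, and its transpose fails as well; hence the
-- separate search. The search has to gain height. An unblocked round applies a Coxeter element c,
-- and for G̃₂ the square of c shifts every root by a multiple of δ. Where this multiple is zero, no
-- height is gained in the long run; this is the origin of the neutral states.

module RealArithmetic where

  open import Algebra.Bundles using (CommutativeRing; RawRing)
  import Algebra.Properties.AbelianGroup as AbelianGroupProperties
  import Algebra.Properties.Ring as RingProperties
  import Algebra.Properties.Semiring.Mult as SemiringMult
  import Algebra.Solver.Ring as RingSolver
  open import Algebra.Solver.Ring.AlmostCommutativeRing
    using (fromCommutativeRing; _-Raw-AlmostCommutative⟶_)
  open import Data.Integer as ℤ using (ℤ; +_; -[1+_]; _⊖_)
  import Data.Integer.Properties as ℤ
  open import Data.Maybe.Base using (Maybe; just; nothing)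
  open import Data.Nat.Base as ℕ using (zero; suc)
  open import Data.Sum.Base using (_⊎_; inj₁; inj₂)
  open import Data.Empty using (⊥)
  open import Data.Product.Base using (proj₁)
  open import Relation.Binary.PropositionalEquality as ≡ using (_≡_)
  open import Relation.Nullary using (yes; no)

  -- The integers inside the ordered field

  module Embedding {c ℓ₁ ℓ₂ ℓ₃} (ℝ : Reals c ℓ₁ ℓ₂ ℓ₃) where
    open Reals ℝ using (commutativeRing; _·_; _<_; _≤_; tight; #-irrefl; <⇒#; #⇒<∨>; 0<suc·1;
        +-monoˡ-<; *-pos; <-respˡ-≈; <-respʳ-≈; <-trans)
    open CommutativeRing commutativeRing
    open RingProperties ring using (-‿distribˡ-*; -‿distribʳ-*; -0#≈0#; -‿involutive)
    open AbelianGroupProperties +-abelianGroup using (⁻¹-∙-comm)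
    open SemiringMult semiring using (×-homo-+; ×1-homo-*)
    open import Relation.Binary.Reasoning.Setoid setoid

    ι : ℤ → Carrier
    ι (+ n)    = n · 1#
    ι -[1+ n ] = - (suc n · 1#)

    ι-neg : ∀ z → ι (ℤ.- z) ≈ - ι z
    ι-neg (+ zero)    = sym -0#≈0#
    ι-neg (+ (suc n)) = refl
    ι-neg -[1+ n ]    = sym (-‿involutive _)

    ι-⊖ : ∀ m n → ι (m ⊖ n) ≈ m · 1# - n · 1#
    ι-⊖ zero    zero    = sym (trans (+-congˡ -0#≈0#) (+-identityʳ _))
    ι-⊖ zero    (suc n) = sym (+-identityˡ _)
    ι-⊖ (suc m) zero    = sym (trans (+-congˡ -0#≈0#) (+-identityʳ _))
    ι-⊖ (suc m) (suc n) = begin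
      ι (suc m ⊖ suc n)                         ≡⟨ ≡.cong ι (ℤ.[1+m]⊖[1+n]≡m⊖n m n) ⟩
      ι (m ⊖ n)                                 ≈⟨ ι-⊖ m n ⟩
      m · 1# - n · 1#                           ≈⟨ +-congʳ (+-identityʳ _) ⟨
      m · 1# + 0# - n · 1#                      ≈⟨ +-congʳ (+-congˡ (-‿inverseʳ 1#)) ⟨
      m · 1# + (1# - 1#) - n · 1#               ≈⟨ +-congʳ (+-assoc _ _ _) ⟨
      m · 1# + 1# - 1# - n · 1#                 ≈⟨ +-assoc _ _ _ ⟩
      m · 1# + 1# + (- 1# - n · 1#)             ≈⟨ +-cong (+-comm _ _) (⁻¹-∙-comm _ _) ⟩
      suc m · 1# - suc n · 1#                   ∎

    ι-+ : ∀ y z → ι (y ℤ.+ z) ≈ ι y + ι z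
    ι-+ (+ m)    (+ n)    = ×-homo-+ 1# m n
    ι-+ (+ m)    -[1+ n ] = ι-⊖ m (suc n)
    ι-+ -[1+ m ] (+ n)    = trans (ι-⊖ n (suc m)) (+-comm _ _)
    ι-+ -[1+ m ] -[1+ n ] = begin
      - (suc (suc (m ℕ.+ n)) · 1#)      ≡⟨ ≡.cong (λ k → - (suc k · 1#)) (≡.sym (ℕ+suc m n)) ⟩
      - ((suc m ℕ.+ suc n) · 1#)        ≈⟨ -‿cong (×-homo-+ 1# (suc m) (suc n)) ⟩
      - (suc m · 1# + suc n · 1#)       ≈⟨ ⁻¹-∙-comm _ _ ⟨
      - (suc m · 1#) - suc n · 1#       ∎
      where
      open import Data.Nat.Properties using () renaming (+-suc to ℕ+suc)

    private
      ι-*ᵖ : ∀ m n → ι (+ m ℤ.* + n) ≈ ι (+ m) * ι (+ n)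
      ι-*ᵖ m n = trans (reflexive (≡.cong ι (≡.sym (ℤ.pos-* m n)))) (×1-homo-* m n)

      ι-*ⁿ : ∀ m z → ι (+ m ℤ.* z) ≈ ι (+ m) * ι z
      ι-*ⁿ m (+ n)    = ι-*ᵖ m n
      ι-*ⁿ m -[1+ n ] = begin
        ι (+ m ℤ.* ℤ.- + suc n)     ≡⟨ ≡.cong ι (≡.sym (ℤ.neg-distribʳ-* (+ m) (+ suc n))) ⟩
        ι (ℤ.- (+ m ℤ.* + suc n))   ≈⟨ ι-neg (+ m ℤ.* + suc n) ⟩
        - ι (+ m ℤ.* + suc n)       ≈⟨ -‿cong (ι-*ᵖ m (suc n)) ⟩
        - (ι (+ m) * ι (+ suc n))   ≈⟨ -‿distribʳ-* _ _ ⟩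
        ι (+ m) * - ι (+ suc n)     ∎

    ι-* : ∀ y z → ι (y ℤ.* z) ≈ ι y * ι z
    ι-* (+ m)    z = ι-*ⁿ m z
    ι-* -[1+ m ] z = begin
      ι (ℤ.- + suc m ℤ.* z)     ≡⟨ ≡.cong ι (≡.sym (ℤ.neg-distribˡ-* (+ suc m) z)) ⟩
      ι (ℤ.- (+ suc m ℤ.* z))   ≈⟨ ι-neg (+ suc m ℤ.* z) ⟩
      - ι (+ suc m ℤ.* z)       ≈⟨ -‿cong (ι-*ⁿ (suc m) z) ⟩
      - (ι (+ suc m) * ι z)     ≈⟨ -‿distribˡ-* _ _ ⟩
      - ι (+ suc m) * ι z       ∎

    ι1≈1 : ι (+ 1) ≈ 1#
    ι1≈1 = +-identityʳ 1#

    private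
      ℤ-rawRing : RawRing _ _
      ℤ-rawRing = ℤ.+-*-rawRing

      ι-morphism : ℤ-rawRing -Raw-AlmostCommutative⟶ fromCommutativeRing commutativeRing
      ι-morphism = record
        { ⟦_⟧ = ι ; +-homo = ι-+ ; *-homo = ι-* ; -‿homo = ι-neg
        ; 0-homo = refl ; 1-homo = ι1≈1 }

      _coeff≟_ : ∀ y z → Maybe (ι y ≈ ι z)
      y coeff≟ z with y ℤ.≟ z
      ... | yes y≡z = just (reflexive (≡.cong ι y≡z))
      ... | no  _   = nothing

    module Solver = RingSolver ℤ-rawRing (fromCommutativeRing commutativeRing) ι-morphism _coeff≟_

    ≤-respʳ-≈ : ∀ {x y z} → y ≈ z → x ≤ y → x ≤ z
    ≤-respʳ-≈ y≈z x≤y z<x = x≤y (<-respˡ-≈ (sym y≈z) z<x)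

    <⇒≤ : ∀ {x y} → x < y → x ≤ y
    <⇒≤ x<y y<x = #-irrefl refl (<⇒# (<-trans x<y y<x))

    ≤-refl′ : ∀ {x} → x ≤ x
    ≤-refl′ x<x = #-irrefl refl (<⇒# x<x)

    neg-pos : ∀ {x} → 0# < x → - x < 0#
    neg-pos {x} 0<x = <-respˡ-≈ (+-identityˡ _) (<-respʳ-≈ (-‿inverseʳ x) (+-monoˡ-< (- x) 0<x))

    ι-nonneg : ∀ {z} → + 0 ℤ.≤ z → ∀ {x} → 0# < x → 0# ≤ ι z * x
    ι-nonneg {+ zero}  _ {x} _   = ≤-respʳ-≈ (sym (zeroˡ x)) ≤-refl′
    ι-nonneg {+ suc n} _     0<x = <⇒≤ (*-pos (0<suc·1 n) 0<x)

    nonneg-ι : ∀ {z x} → 0# < x → 0# ≤ ι z * x → + 0 ℤ.≤ z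
    nonneg-ι {+ n}      _   _   = ℤ.+≤+ ℕ.z≤n
    nonneg-ι { -[1+ n ]} 0<x 0≤zx with () ← 0≤zx
      (<-respˡ-≈ (-‿distribˡ-* _ _) (neg-pos (*-pos (0<suc·1 n) 0<x)))

    neg-pos⁻¹ : ∀ {x} → x < 0# → 0# < - x
    neg-pos⁻¹ {x} x<0 = <-respˡ-≈ (-‿inverseʳ x) (<-respʳ-≈ (+-identityˡ _) (+-monoˡ-< (- x) x<0))

    *-neg : ∀ {x y} → 0# < x → y < 0# → x * y < 0#
    *-neg {x} {y} 0<x y<0 = <-respˡ-≈ (-‿involutive _)
      (neg-pos (<-respʳ-≈ (sym (-‿distribʳ-* x y)) (*-pos 0<x (neg-pos⁻¹ y<0))))

    *-cancel-nonneg : ∀ {x y} → 0# < x → 0# ≤ x * y → 0# ≤ y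
    *-cancel-nonneg 0<x 0≤xy y<0 = 0≤xy (*-neg 0<x y<0)

    -- Since `≤` is a negated `<`, the cases y = 0 and y > 0 cannot be separated. But a negative
    -- product excludes 0 < y, and then tightness gives y = 0.
    *-nonneg : ∀ {x y} → 0# < x → 0# ≤ y → 0# ≤ x * y
    *-nonneg {x} {y} 0<x 0≤y xy<0 = #-irrefl (trans (*-congˡ y≈0) (zeroʳ x)) (<⇒# xy<0)
      where
      y≈0 : y ≈ 0#
      y≈0 = proj₁ (tight y 0#) λ y#0 → case-⊎ (#⇒<∨> y#0)
        where
        case-⊎ : y < 0# ⊎ 0# < y → ⊥
        case-⊎ (inj₁ y<0) = 0≤y y<0
        case-⊎ (inj₂ 0<y) = <⇒≤ (*-pos 0<x 0<y) xy<0

-- Cosines of π/2, π/3, π/4 and π/6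

module Cosines where

  open RealArithmetic

  open import Algebra.Bundles using (CommutativeRing)
  open import Data.Integer using (+_)
  open import Data.Nat.Base as ℕ using (ℕ; suc)
  open import Data.Product.Base using (proj₁; proj₂)
  open import Data.Sum.Base using (_⊎_; inj₁; inj₂)
  open import Relation.Nullary using (¬_)

  module SpecialAngles {r ℓ₁ ℓ₂ ℓ₃} (ℝ : Reals r ℓ₁ ℓ₂ ℓ₃) where
    open Reals ℝ using (commutativeRing; _#_; _<_; tight; #-sym; #-irrefl; <⇒#; #⇒<∨>; 0<1; 0<suc·1;
        +-monoˡ-<; *-pos; <-respˡ-≈; <-respʳ-≈; <-trans; _/suc_; cos; sin; π; cos-cong; cos-+; sin-+;
        cos²+sin²≈1; 0<π; cos-π; sin-pos; #⇒invertible)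
    open CommutativeRing commutativeRing
    open Embedding ℝ
    open Solver
    open import Relation.Binary.Reasoning.Setoid setoid

    *-cancelˡ : ∀ {x y z} → 0# < x → x * y ≈ x * z → y ≈ z
    *-cancelˡ {x} {y} {z} 0<x xy≈xz = begin
      y                  ≈⟨ *-identityˡ y ⟨
      1# * y             ≈⟨ *-congʳ x⁻¹x≈1 ⟨
      x⁻¹ * x * y        ≈⟨ *-assoc _ _ _ ⟩
      x⁻¹ * (x * y)      ≈⟨ *-congˡ xy≈xz ⟩
      x⁻¹ * (x * z)      ≈⟨ *-assoc _ _ _ ⟨
      x⁻¹ * x * z        ≈⟨ *-congʳ x⁻¹x≈1 ⟩
      1# * z             ≈⟨ *-identityˡ z ⟩
      z                  ∎
      where
      inv = #⇒invertible (#-sym (<⇒# 0<x))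
      x⁻¹ = proj₁ inv
      x⁻¹x≈1 : x⁻¹ * x ≈ 1#
      -- A Heyting field inverts the difference x - 0, hence the inserted zero.
      x⁻¹x≈1 = trans (*-congˡ (solve 1 (λ x → x := x :- con (+ 0)) refl x)) (proj₁ (proj₂ inv))

    -- The index is one less than the denominator: π/2, π/3, π/4 and π/6 are `angle` at 1, 2, 3 and
    -- 5.
    angle : ℕ → Carrier
    angle k = π /suc k

    suc*angle : ∀ k → ι (+ suc k) * angle k ≈ π
    suc*angle k = begin
      s * (π * s⁻¹)          ≈⟨ solve 3 (λ s p i → s :* (p :* i) := p :* (i :* (s :- con (+ 0)))) refl
          s π s⁻¹ ⟩
      π * (s⁻¹ * (s - 0#))   ≈⟨ *-congˡ (proj₁ (proj₂ (#⇒invertible (#-sym (<⇒# (0<suc·1 k)))))) ⟩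
      π * 1#                 ≈⟨ *-identityʳ π ⟩
      π                      ∎
      where
      s = ι (+ suc k)
      s⁻¹ = proj₁ (#⇒invertible (#-sym (<⇒# (0<suc·1 k))))

    pos-cancel : ∀ {x y} → 0# < x → 0# < x * y → 0# < y
    pos-cancel {x} {y} 0<x 0<xy = <-respʳ-≈ x⁻¹xy≈y (*-pos 0<x⁻¹ 0<xy)
      where
      inv = #⇒invertible (#-sym (<⇒# 0<x))
      x⁻¹ = proj₁ inv
      x⁻¹x≈1 : x⁻¹ * x ≈ 1#
      x⁻¹x≈1 = trans (*-congˡ (solve 1 (λ x → x := x :- con (+ 0)) refl x)) (proj₁ (proj₂ inv))
      x⁻¹xy≈y : x⁻¹ * (x * y) ≈ y
      x⁻¹xy≈y = trans (sym (*-assoc _ _ _)) (trans (*-congʳ x⁻¹x≈1) (*-identityˡ y))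
      x⁻¹#0 : x⁻¹ # 0#
      x⁻¹#0 = Reals.invertible⇒# ℝ (x , trans (*-congˡ (solve 1 (λ x → x :- con (+ 0) := x) refl x⁻¹))
          x*x⁻¹ , trans (*-congʳ (solve 1 (λ x → x :- con (+ 0) := x) refl x⁻¹)) x⁻¹x≈1)
        where
        open import Data.Product.Base using (_,_)
        x*x⁻¹ = trans (*-comm x x⁻¹) x⁻¹x≈1
      0<x⁻¹ : 0# < x⁻¹
      0<x⁻¹ with #⇒<∨> x⁻¹#0
      ... | inj₂ 0<x⁻¹ = 0<x⁻¹
      ... | inj₁ x⁻¹<0 with () ← <⇒≤ 0<1 (<-respˡ-≈ (trans (*-comm x x⁻¹) x⁻¹x≈1) (*-neg 0<x x⁻¹<0))

    square-zero : ∀ {x} → x * x ≈ 0# → x ≈ 0#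
    square-zero {x} xx≈0 = proj₁ (tight x 0#) λ x#0 → refute (#⇒<∨> x#0)
      where
      refute : ¬ (x < 0# ⊎ 0# < x)
      refute (inj₂ 0<x) = #-irrefl (sym xx≈0) (<⇒# (*-pos 0<x 0<x))
      refute (inj₁ x<0) = #-irrefl (sym xx≈0) (<⇒#
        (<-respʳ-≈ (solve 1 (λ x → (:- x) :* (:- x) := x :* x) refl x)
            (*-pos (neg-pos⁻¹ x<0) (neg-pos⁻¹ x<0))))

    two : 1# + 1# ≈ ι (+ 2)
    two = +-congˡ (sym (+-identityʳ 1#))

    0<angle : ∀ k → 0# < angle k
    0<angle k = pos-cancel (0<suc·1 k) (<-respʳ-≈ (sym (suc*angle k)) 0<π)

    cos-double : ∀ x → cos (x + x) ≈ ι (+ 2) * (cos x * cos x) - 1#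
    cos-double x = begin
      cos (x + x)                                         ≈⟨ cos-+ x x ⟩
      c * c - s * s
          ≈⟨ solve 2 (λ c s → c :* c :- s :* s := con (+ 2) :* (c :* c) :- (c :* c :+ s :* s)) refl c s ⟩
      ι (+ 2) * (c * c) - (c * c + s * s)                 ≈⟨ +-congˡ (-‿cong (cos²+sin²≈1 x)) ⟩
      ι (+ 2) * (c * c) - 1#                              ∎
      where
      c = cos x
      s = sin x

    cos-triple : ∀ x → cos (x + (x + x)) ≈ ι (+ 4) * (cos x * (cos x * cos x)) - ι (+ 3) * cos x
    cos-triple x = begin
      cos (x + (x + x))                                    ≈⟨ cos-+ x (x + x) ⟩
      c * cos (x + x) - s * sin (x + x)
          ≈⟨ +-cong (*-congˡ (cos-double x)) (-‿cong (*-congˡ (sin-+ x x))) ⟩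
      c * (ι (+ 2) * (c * c) - 1#) - s * (s * c + c * s)
          ≈⟨ +-congʳ (*-congˡ (+-congˡ (-‿cong (sym ι1≈1)))) ⟩
      c * (ι (+ 2) * (c * c) - ι (+ 1)) - s * (s * c + c * s)
        ≈⟨ solve 2 (λ c s → c :* (con (+ 2) :* (c :* c) :- con (+ 1)) :- s :* (s :* c :+ c :* s)
             := con (+ 4) :* (c :* (c :* c)) :- c :- con (+ 2) :* c :* (c :* c :+ s :* s)) refl c s ⟩
      ι (+ 4) * (c * (c * c)) - c - ι (+ 2) * c * (c * c + s * s)
        ≈⟨ +-congˡ (-‿cong (*-congˡ (trans (cos²+sin²≈1 x) (sym ι1≈1)))) ⟩
      ι (+ 4) * (c * (c * c)) - c - ι (+ 2) * c * ι (+ 1)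
        ≈⟨ solve 1 (λ c → con (+ 4) :* (c :* (c :* c)) :- c :- con (+ 2) :* c :* con (+ 1)
             := con (+ 4) :* (c :* (c :* c)) :- con (+ 3) :* c) refl c ⟩
      ι (+ 4) * (c * (c * c)) - ι (+ 3) * c                ∎
      where
      c = cos x
      s = sin x

    angle₁+angle₁≈π : angle 1 + angle 1 ≈ π
    angle₁+angle₁≈π = trans (solve 1 (λ x → x :+ x := con (+ 2) :* x) refl (angle 1)) (suc*angle 1)

    cos[π/2]≈0 : cos (angle 1) ≈ 0#
    cos[π/2]≈0 = square-zero (*-cancelˡ (0<suc·1 1) (begin
      ι (+ 2) * (c * c)              ≈⟨ solve 1 (λ x → x := x :- con (+ 1) :+ con (+ 1)) refl
          (ι (+ 2) * (c * c)) ⟩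
      ι (+ 2) * (c * c) - ι (+ 1) + ι (+ 1) ≈⟨ +-cong (+-congˡ (-‿cong ι1≈1)) ι1≈1 ⟩
      ι (+ 2) * (c * c) - 1# + 1#    ≈⟨ +-congʳ (cos-double (angle 1)) ⟨
      cos (angle 1 + angle 1) + 1#   ≈⟨ +-congʳ (trans (cos-cong angle₁+angle₁≈π) cos-π) ⟩
      - 1# + 1#                      ≈⟨ -‿inverseˡ 1# ⟩
      0#                             ≈⟨ zeroʳ _ ⟨
      ι (+ 2) * 0#                   ∎))
      where
      c = cos (angle 1)

    -- With x = π/2 and y = π/(3 + k), both 2x and (3 + k)y equal π, so 2(x - y) = (1 + k)y, which
    -- is positive.
    angle-< : ∀ k → angle (2 ℕ.+ k) < angle 1
    angle-< k = <-respˡ-≈ (+-identityˡ y) (<-respʳ-≈ (solve 2 (λ x y → x :- y :+ y := x) refl x y)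
                  (+-monoˡ-< y (pos-cancel (0<suc·1 1) 0<2[x-y])))
      where
      x = angle 1
      y = angle (2 ℕ.+ k)
      0<2[x-y] : 0# < ι (+ 2) * (x - y)
      0<2[x-y] = <-respʳ-≈ (begin
        ι (+ suc k) * y
          ≈⟨ solve 2 (λ κ y → κ :* y := (con (+ 2) :+ κ) :* y :- con (+ 2) :* y) refl (ι (+ suc k)) y ⟩
        (ι (+ 2) + ι (+ suc k)) * y - ι (+ 2) * y
          ≈⟨ +-congʳ (*-congʳ (ι-+ (+ 2) (+ suc k))) ⟨
        ι (+ (3 ℕ.+ k)) * y - ι (+ 2) * y
          ≈⟨ +-congʳ (trans (suc*angle (2 ℕ.+ k)) (sym (suc*angle 1))) ⟩
        ι (+ 2) * x - ι (+ 2) * y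
          ≈⟨ solve 2 (λ x y → con (+ 2) :* x :- con (+ 2) :* y := con (+ 2) :* (x :- y)) refl x y ⟩
        ι (+ 2) * (x - y) ∎)
        (*-pos (0<suc·1 k) (0<angle (2 ℕ.+ k)))

    sin[π/2]≈1 : sin (angle 1) ≈ 1#
    sin[π/2]≈1 = begin
      s                 ≈⟨ solve 1 (λ s → s := s :- con (+ 1) :+ con (+ 1)) refl s ⟩
      s - ι (+ 1) + ι (+ 1)   ≈⟨ +-cong (*-cancelˡ 0<s+1 product) ι1≈1 ⟩
      0# + 1#           ≈⟨ +-identityˡ 1# ⟩
      1#                ∎
      where
      s = sin (angle 1)
      0<s : 0# < s
      0<s = sin-pos _ (0<angle 1) (<-respˡ-≈ (+-identityˡ _)
          (<-respʳ-≈ angle₁+angle₁≈π (+-monoˡ-< _ (0<angle 1))))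
      0<s+1 : 0# < s + ι (+ 1)
      0<s+1 = <-trans (0<suc·1 0) (<-respˡ-≈ (+-identityˡ _) (+-monoˡ-< _ 0<s))
      product : (s + ι (+ 1)) * (s - ι (+ 1)) ≈ (s + ι (+ 1)) * 0#
      product = begin
        (s + ι (+ 1)) * (s - ι (+ 1))
          ≈⟨ solve 1 (λ s → (s :+ con (+ 1)) :* (s :- con (+ 1)) := con (+ 0) :* con (+ 0) :+ s :* s :-
              con (+ 1)) refl s ⟩
        0# * 0# + s * s - ι (+ 1)
          ≈⟨ +-congʳ (+-congʳ (*-cong cos[π/2]≈0 cos[π/2]≈0)) ⟨
        cos (angle 1) * cos (angle 1) + s * s - ι (+ 1)
          ≈⟨ +-cong (cos²+sin²≈1 _) (-‿cong ι1≈1) ⟩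
        1# - 1#              ≈⟨ -‿inverseʳ 1# ⟩
        0#                   ≈⟨ zeroʳ _ ⟨
        (s + ι (+ 1)) * 0#   ∎

    -- The cosine of an acute angle is the sine of the obtuse angle a right angle further.
    0<cos : ∀ k → 0# < cos (angle (2 ℕ.+ k))
    0<cos k = <-respʳ-≈ sin-shift (sin-pos (x + angle 1)
        (<-trans (0<angle (2 ℕ.+ k)) (<-respˡ-≈ (+-identityˡ x)
            (<-respʳ-≈ (+-comm _ _) (+-monoˡ-< x (0<angle 1)))))
        (<-respʳ-≈ angle₁+angle₁≈π (+-monoˡ-< (angle 1) (angle-< k))))
      where
      x = angle (2 ℕ.+ k)
      sin-shift : sin (x + angle 1) ≈ cos x
      sin-shift = begin
        sin (x + angle 1)                                ≈⟨ sin-+ x (angle 1) ⟩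
        sin x * cos (angle 1) + cos x * sin (angle 1)
            ≈⟨ +-cong (*-congˡ cos[π/2]≈0) (*-congˡ sin[π/2]≈1) ⟩
        sin x * 0# + cos x * 1#                          ≈⟨ +-cong (zeroʳ _) (*-identityʳ _) ⟩
        0# + cos x                                       ≈⟨ +-identityˡ _ ⟩
        cos x                                            ∎

    2cos : ℕ → Carrier
    2cos k = (1# + 1#) * cos (angle k)

    0<2cos : ∀ k → 0# < 2cos (2 ℕ.+ k)
    0<2cos k = *-pos (<-respʳ-≈ (sym two) (0<suc·1 1)) (0<cos k)

    2cos[π/2]≈0 : 2cos 1 ≈ 0#
    2cos[π/2]≈0 = trans (*-congˡ cos[π/2]≈0) (zeroʳ _)

    -- The triple-angle formula at cos π = -1 gives 4c³ - 3c + 1 = (c + 1)(2c - 1)² = 0. The first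
    -- factor is positive, and tightness removes the square.
    2cos[π/3]≈1 : 2cos 2 ≈ 1#
    2cos[π/3]≈1 = begin
      (1# + 1#) * c                            ≈⟨ *-congʳ two ⟩
      ι (+ 2) * c
          ≈⟨ solve 1 (λ c → con (+ 2) :* c := (con (+ 2) :* c :- con (+ 1)) :+ con (+ 1)) refl c ⟩
      ι (+ 2) * c - ι (+ 1) + ι (+ 1)          ≈⟨ +-cong (square-zero (*-cancelˡ 0<c+1 cubic)) ι1≈1 ⟩
      0# + 1#                                  ≈⟨ +-identityˡ 1# ⟩
      1#                                       ∎
      where
      x = angle 2
      c = cos x
      0<c+1 : 0# < c + ι (+ 1)
      0<c+1 = <-trans (0<suc·1 0) (<-respˡ-≈ (+-identityˡ _) (+-monoˡ-< _ (0<cos 0)))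
      cubic : (c + ι (+ 1)) * ((ι (+ 2) * c - ι (+ 1)) * (ι (+ 2) * c - ι (+ 1))) ≈ (c + ι (+ 1)) * 0#
      cubic = begin
        (c + ι (+ 1)) * ((ι (+ 2) * c - ι (+ 1)) * (ι (+ 2) * c - ι (+ 1)))
          ≈⟨ solve 1 (λ c → (c :+ con (+ 1)) :*
              ((con (+ 2) :* c :- con (+ 1)) :* (con (+ 2) :* c :- con (+ 1)))
               := con (+ 4) :* (c :* (c :* c)) :- con (+ 3) :* c :+ con (+ 1)) refl c ⟩
        ι (+ 4) * (c * (c * c)) - ι (+ 3) * c + ι (+ 1)   ≈⟨ +-cong (sym (cos-triple x)) ι1≈1 ⟩
        cos (x + (x + x)) + 1#                            ≈⟨ +-congʳ (trans (cos-cong 3x≈π) cos-π) ⟩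
        - 1# + 1#                                         ≈⟨ -‿inverseˡ 1# ⟩
        0#                                                ≈⟨ zeroʳ _ ⟨
        (c + ι (+ 1)) * 0#                                ∎
        where
        3x≈π : x + (x + x) ≈ π
        3x≈π = trans (solve 1 (λ x → x :+ (x :+ x) := con (+ 3) :* x) refl x) (suc*angle 2)

    2cos-square : ∀ k l → angle k + angle k ≈ angle l → 2cos k * 2cos k ≈ 2cos l + ι (+ 2)
    2cos-square k l 2x≈y = begin
      (1# + 1#) * c * ((1# + 1#) * c)        ≈⟨ *-cong (*-congʳ two) (*-congʳ two) ⟩
      ι (+ 2) * c * (ι (+ 2) * c)            ≈⟨ solve 1 (λ c → con (+ 2) :* c :* (con (+ 2) :* c)
                                                  := con (+ 2) :* (con (+ 2) :* (c :* c) :- con (+ 1))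
                                                      :+ con (+ 2)) refl c ⟩
      ι (+ 2) * (ι (+ 2) * (c * c) - ι (+ 1)) + ι (+ 2)
                                             ≈⟨ +-congʳ (*-cong (sym two) (trans (+-congˡ (-‿cong ι1≈1))
                                                  (trans (sym (cos-double (angle k))) (cos-cong 2x≈y)))) ⟩
      2cos l + ι (+ 2)                       ∎
      where
      c = cos (angle k)

    private
      double-angle : ∀ k l → (∀ x → ι (+ suc l) * (x + x) ≈ ι (+ suc k) * x) → angle k + angle k ≈ angle l
      double-angle k l eq = *-cancelˡ (0<suc·1 l)
          (trans (eq (angle k)) (trans (suc*angle k) (sym (suc*angle l))))

    2cos[π/4]²≈2 : 2cos 3 * 2cos 3 ≈ ι (+ 2)
    2cos[π/4]²≈2 = trans (2cos-square 3 1
        (double-angle 3 1 (solve 1 (λ x → con (+ 2) :* (x :+ x) := con (+ 4) :* x) refl)))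
      (trans (+-congʳ 2cos[π/2]≈0) (+-identityˡ _))

    2cos[π/6]²≈3 : 2cos 5 * 2cos 5 ≈ ι (+ 3)
    2cos[π/6]²≈3 = trans (2cos-square 5 2
        (double-angle 5 2 (solve 1 (λ x → con (+ 3) :* (x :+ x) := con (+ 6) :* x) refl)))
      (+-congʳ 2cos[π/3]≈1)

-- Kronecker delta over a semiring

module KroneckerDelta where

  open import Algebra.Bundles using (Semiring)
  import Algebra.Properties.Semiring.Sum as SemiringSum
  open import Data.Bool.Base using (if_then_else_)
  open import Data.Fin.Base using (Fin; zero; suc)
  open import Data.Fin.Properties using (_≟_)
  open import Data.Nat.Base as ℕ using (ℕ)
  open import Function.Base using (_∘_)
  open import Relation.Nullary using (does)

  module _ {c ℓ} (R : Semiring c ℓ) where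
    open Semiring R hiding (zero)
    open SemiringSum R using (sum; sum-cong-≋; sum-replicate-zero)

    δ : ∀ {n} → Fin n → Fin n → Carrier
    δ i j = if does (i ≟ j) then 1# else 0#

    sum-δ : ∀ {n} (f : Fin n → Carrier) j → sum (λ k → f k * δ j k) ≈ f j
    sum-δ {ℕ.suc n} f zero = trans (+-cong (*-identityʳ _)
      (trans (sum-cong-≋ (λ k → zeroʳ (f (suc k)))) (sum-replicate-zero n))) (+-identityʳ _)
    sum-δ f (suc j) = trans (+-congʳ (zeroʳ _)) (trans (+-identityˡ _) (sum-δ (f ∘ suc) j))

-- Cartan matrices and the action on integer vectors

module IntegerReflections where

  open KroneckerDelta
  import Algebra.Properties.Semiring.Sum as SemiringSum
  open import Data.Bool.Base using (Bool; true; false)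
  open import Data.Fin.Base using (Fin; zero; suc)
  open import Data.Fin.Properties using (_≟_)
  open import Data.Integer.Base using (ℤ; +_; _+_; _*_; _-_; -_)
  import Data.Integer.Properties as ℤ
  open import Data.Integer.Tactic.RingSolver using (solve-∀)
  open import Data.List.Base using (List; []; _∷_; _++_; foldr; reverse; replicate; concat)
  import Data.List.Properties as List
  open import Data.Nat.Base using (ℕ; zero; suc)
  open import Data.Product.Base using (_×_; _,_)
  open import Relation.Binary.PropositionalEquality hiding ([_])
  open import Relation.Nullary using (yes; no)
  open import Relation.Nullary.Construct.Add.Supremum using (_⁺; ⊤⁺; [_])

  open SemiringSum ℤ.+-*-semiring using (sum; sum-cong-≗; ∑-distrib-+; *-distribˡ-sum)

  data Lacing : Set where
    double triple : Lacing

  label : Lacing → ℕ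
  label double = 4
  label triple = 6

  multiplicity : Lacing → ℤ
  multiplicity double = + 2
  multiplicity triple = + 3

  -- The off-diagonal Cartan integers Cᵢⱼ and Cⱼᵢ, which satisfy 4 cos²(π/m) = Cᵢⱼ Cⱼᵢ, where the
  -- Booleans tell whether αᵢ and αⱼ are long.
  data Rank2 (X : Lacing) : ℕ ⁺ → ℤ → ℤ → Bool → Bool → Set where
    commuting : ∀ {b c} → Rank2 X [ 2 ] (+ 0) (+ 0) b c
    simple    : ∀ {b} → Rank2 X [ 3 ] (- + 1) (- + 1) b b
    laced     : Rank2 X [ label X ] (- + 1) (- multiplicity X) true false
    laced′    : Rank2 X [ label X ] (- multiplicity X) (- + 1) false true
    infinite  : ∀ {b} → Rank2 X ⊤⁺ (- + 2) (- + 2) b b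

  Rank2-sym : ∀ {X m p q b c} → Rank2 X m p q b c → Rank2 X m q p c b
  Rank2-sym commuting = commuting
  Rank2-sym simple    = simple
  Rank2-sym laced     = laced′
  Rank2-sym laced′    = laced
  Rank2-sym infinite  = infinite

  module Reflections {n} (C : Fin n → Fin n → ℤ) where

    Vec : Set
    Vec = Fin n → ℤ

    infixl 6 _⊕_
    infixr 7 _⊙_

    _⊕_ : Vec → Vec → Vec
    (v ⊕ w) j = v j + w j

    _⊙_ : ℤ → Vec → Vec
    (k ⊙ v) j = k * v j

    e : Fin n → Vec
    e = δ ℤ.+-*-semiring

    dot : Fin n → Vec → ℤ
    dot i v = sum λ k → C i k * v k

    refl-at : Fin n → Vec → Vec
    refl-at i v j = v j - dot i v * e i j

    act : List (Fin n) → Vec → Vec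
    act w v = foldr refl-at v w

    dot-cong : ∀ i {v w} → v ≗ w → dot i v ≡ dot i w
    dot-cong i v≗w = sum-cong-≗ λ k → cong (C i k *_) (v≗w k)

    refl-at-cong : ∀ i {v w} → v ≗ w → refl-at i v ≗ refl-at i w
    refl-at-cong i v≗w j = cong₂ (λ x y → x - y * e i j) (v≗w j) (dot-cong i v≗w)

    act-cong : ∀ u {v w} → v ≗ w → act u v ≗ act u w
    act-cong []      v≗w = v≗w
    act-cong (i ∷ u) v≗w = refl-at-cong i (act-cong u v≗w)

    act-++ : ∀ u w v → act (u ++ w) v ≡ act u (act w v)
    act-++ u w v = List.foldr-++ refl-at v u w

    dot-e : ∀ i j → dot i (e j) ≡ C i j
    dot-e i j = sum-δ ℤ.+-*-semiring (C i) j

    dot-⊕ : ∀ i v w → dot i (v ⊕ w) ≡ dot i v + dot i w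
    dot-⊕ i v w = trans (sum-cong-≗ λ k → ℤ.*-distribˡ-+ (C i k) (v k) (w k))
      (∑-distrib-+ (λ k → C i k * v k) (λ k → C i k * w k))

    dot-⊙ : ∀ i k v → dot i (k ⊙ v) ≡ k * dot i v
    dot-⊙ i k v = trans (sum-cong-≗ λ l → swap (C i l) k (v l)) (sym (*-distribˡ-sum k λ l → C i l * v l))
      where
      swap : ∀ x y z → x * (y * z) ≡ y * (x * z)
      swap = solve-∀

    refl-at-⊕ : ∀ i v w → refl-at i (v ⊕ w) ≗ refl-at i v ⊕ refl-at i w
    refl-at-⊕ i v w j rewrite dot-⊕ i v w = lemma (v j) (w j) (dot i v) (dot i w) (e i j)
      where
      lemma : ∀ x y a b ε → x + y - (a + b) * ε ≡ x - a * ε + (y - b * ε)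
      lemma = solve-∀

    refl-at-⊙ : ∀ i k v → refl-at i (k ⊙ v) ≗ k ⊙ refl-at i v
    refl-at-⊙ i k v j rewrite dot-⊙ i k v = lemma k (v j) (dot i v) (e i j)
      where
      lemma : ∀ k x a ε → k * x - k * a * ε ≡ k * (x - a * ε)
      lemma = solve-∀

    act-⊕ : ∀ u v w → act u (v ⊕ w) ≗ act u v ⊕ act u w
    act-⊕ []      v w j = refl
    act-⊕ (i ∷ u) v w j = trans (refl-at-cong i (act-⊕ u v w) j) (refl-at-⊕ i (act u v) (act u w) j)

    act-⊙ : ∀ u k v → act u (k ⊙ v) ≗ k ⊙ act u v
    act-⊙ []      k v j = refl
    act-⊙ (i ∷ u) k v j = trans (refl-at-cong i (act-⊙ u k v) j) (refl-at-⊙ i k (act u v) j)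

    module _ (C-diag : ∀ i → C i i ≡ + 2) where

      refl-at-involutive : ∀ i v → refl-at i (refl-at i v) ≗ v
      refl-at-involutive i v j = trans
        (cong (λ d → refl-at i v j - d * e i j) (trans (dot-cong i reflected) (trans (dot-⊕ i v _)
          (cong (_+_ (dot i v)) (trans (dot-⊙ i (- dot i v) (e i))
              (cong (- dot i v *_) (trans (dot-e i i) (C-diag i))))))))
        (lemma (v j) (dot i v) (e i j))
        where
        reflected : refl-at i v ≗ v ⊕ (- dot i v) ⊙ e i
        reflected k = cong (_+_ (v k)) (ℤ.neg-distribˡ-* (dot i v) (e i k))
        lemma : ∀ x a ε → x - a * ε - (a + - a * + 2) * ε ≡ x
        lemma = solve-∀

      -- (xa , xb , ya , yb) stands for v + (xa a + xb b) eᵢ + (ya a + yb b) eⱼ, where a and b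
      -- are the pairings of v with the coroots i and j.
      private
        Coefficients : Set
        Coefficients = (ℤ × ℤ) × (ℤ × ℤ)

        stepˡ stepʳ : ℤ → Coefficients → Coefficients
        stepˡ p ((xa , xb) , (ya , yb)) = (- + 1 - xa - p * ya , - xb - p * yb) , (ya , yb)
        stepʳ q ((xa , xb) , (ya , yb)) = (xa , xb) , (- ya - q * xa , - + 1 - yb - q * xb)

        steps : ℕ → ℤ → ℤ → Coefficients
        steps zero    p q = (+ 0 , + 0) , (+ 0 , + 0)
        steps (suc k) p q = stepˡ p (stepʳ q (steps k p q))

        -- The coefficients depend only on the two Cartan integers, so the braid relations in any
        -- rank reduce to six closed computations; the label ∞ imposes none.
        rank2-closes : ∀ {X m p q b c} → Rank2 X m p q b c → ∀ {k} → m ≡ [ k ] →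
                       steps k p q ≡ ((+ 0 , + 0) , (+ 0 , + 0))
        rank2-closes commuting         refl = refl
        rank2-closes simple            refl = refl
        rank2-closes {double} laced    refl = refl
        rank2-closes {triple} laced    refl = refl
        rank2-closes {double} laced′   refl = refl
        rank2-closes {triple} laced′   refl = refl

        module _ (i j : Fin n) (v : Vec) where
          ⟦_⟧ : Coefficients → Vec
          ⟦ (xa , xb) , (ya , yb) ⟧ =
            v ⊕ ((xa * dot i v + xb * dot j v) ⊙ e i ⊕ (ya * dot i v + yb * dot j v) ⊙ e j)

          dot-⟦⟧ : ∀ k xa xb ya yb → dot k ⟦ (xa , xb) , (ya , yb) ⟧ ≡
            dot k v + ((xa * dot i v + xb * dot j v) * C k i + (ya * dot i v + yb * dot j v) * C k j)
          dot-⟦⟧ k xa xb ya yb = trans (dot-⊕ k v _) (cong (_+_ (dot k v))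
            (trans (dot-⊕ k _ _) (cong₂ _+_
              (trans (dot-⊙ k (xa * dot i v + xb * dot j v) (e i))
                  (cong (_*_ (xa * dot i v + xb * dot j v)) (dot-e k i)))
              (trans (dot-⊙ k (ya * dot i v + yb * dot j v) (e j))
                  (cong (_*_ (ya * dot i v + yb * dot j v)) (dot-e k j))))))

          refl-at-ˡ : ∀ S → refl-at i ⟦ S ⟧ ≗ ⟦ stepˡ (C i j) S ⟧
          refl-at-ˡ S@((xa , xb) , (ya , yb)) l =
            trans (cong (λ d → ⟦ S ⟧ l - d * e i l) (trans (dot-⟦⟧ i xa xb ya yb)
                (cong (λ c → dot i v + ((xa * dot i v + xb * dot j v) * c +
                    (ya * dot i v + yb * dot j v) * C i j)) (C-diag i))))
              (lemma (v l) (dot i v) (dot j v) (C i j) xa xb ya yb (e i l) (e j l))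
            where
            lemma : ∀ z a b p xa xb ya yb ε η →
              z + ((xa * a + xb * b) * ε + (ya * a + yb * b) * η)
                - (a + ((xa * a + xb * b) * + 2 + (ya * a + yb * b) * p)) * ε
              ≡ z + (((- + 1 - xa - p * ya) * a + (- xb - p * yb) * b) * ε + (ya * a + yb * b) * η)
            lemma = solve-∀

          refl-at-ʳ : ∀ S → refl-at j ⟦ S ⟧ ≗ ⟦ stepʳ (C j i) S ⟧
          refl-at-ʳ S@((xa , xb) , (ya , yb)) l =
            trans (cong (λ d → ⟦ S ⟧ l - d * e j l) (trans (dot-⟦⟧ j xa xb ya yb)
                (cong (λ c → dot j v + ((xa * dot i v + xb * dot j v) * C j i +
                    (ya * dot i v + yb * dot j v) * c)) (C-diag j))))
              (lemma (v l) (dot i v) (dot j v) (C j i) xa xb ya yb (e i l) (e j l))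
            where
            lemma : ∀ z a b q xa xb ya yb ε η →
              z + ((xa * a + xb * b) * ε + (ya * a + yb * b) * η)
                - (b + ((xa * a + xb * b) * q + (ya * a + yb * b) * + 2)) * η
              ≡ z + ((xa * a + xb * b) * ε + ((- ya - q * xa) * a + (- + 1 - yb - q * xb) * b) * η)
            lemma = solve-∀

          ⟦0⟧ : ⟦ (+ 0 , + 0) , (+ 0 , + 0) ⟧ ≗ v
          ⟦0⟧ l = ℤ.+-identityʳ (v l)

          act-power : ∀ k → act (concat (replicate k (i ∷ j ∷ []))) v ≗ ⟦ steps k (C i j) (C j i) ⟧
          act-power zero    l = sym (⟦0⟧ l)
          act-power (suc k) l = trans
            (refl-at-cong i (λ l → trans (refl-at-cong j (act-power k) l)
                (refl-at-ʳ (steps k (C i j) (C j i)) l)) l)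
            (refl-at-ˡ (stepʳ (C j i) (steps k (C i j) (C j i))) l)

      act-braid : ∀ i j {X m b c k} → Rank2 X m (C i j) (C j i) b c → m ≡ [ k ] →
                  ∀ v → act (concat (replicate k (i ∷ j ∷ []))) v ≗ v
      act-braid i j {k = k} r m≡k v l = trans (act-power i j v k l)
        (trans (cong (λ S → ⟦_⟧ i j v S l) (rank2-closes r m≡k)) (⟦0⟧ i j v l))

  record CartanMatrix {n} (M : CoxeterMatrix n) : Set where
    open CoxeterMatrix M
    field
      C       : Fin n → Fin n → ℤ
      long    : Fin n → Bool
      lacing  : Lacing
      C-diag  : ∀ i → C i i ≡ + 2
      C-rank2 : ∀ i j → i ≢ j → Rank2 lacing (m i j) (C i j) (C j i) (long i) (long j)

    open Reflections C public
    open CoxeterGroup M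

    act-~ : ∀ {u w} → u ~ w → ∀ v → act u v ≗ act w v
    act-~ ~-refl          v j = refl
    act-~ (~-sym r)       v j = sym (act-~ r v j)
    act-~ (~-trans r r′)  v j = trans (act-~ r v j) (act-~ r′ v j)
    act-~ (~-cong {u} {u′} {w} {w′} r r′) v j
      rewrite act-++ u w v | act-++ u′ w′ v = trans (act-cong u (act-~ r′ v) j) (act-~ r (act w′ v) j)
    act-~ (~-rel i j {k} mij≡k) v l with i ≟ j
    ... | no  i≢j  = act-braid C-diag i j (C-rank2 i j i≢j) mij≡k v l
    ... | yes refl with refl ← trans (sym mij≡k) (m-diag i) = refl-at-involutive C-diag i v l

-- Real roots as rescaled integer vectors

module RealRootSpace where

  open RealArithmetic
  open Cosines
  open KroneckerDelta
  open IntegerReflections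

  open import Algebra.Bundles using (CommutativeRing)
  import Algebra.Properties.Semiring.Sum as SemiringSum
  open import Data.Bool.Base using (Bool; true; false; if_then_else_)
  open import Data.Fin.Base using (Fin; zero; suc)
  open import Data.Fin.Properties using (_≟_)
  open import Data.Integer as ℤ using (ℤ; +_)
  import Data.Integer.Properties as ℤ
  open import Data.List.Base using (List; []; _∷_; _++_)
  import Data.List.Properties as List
  open import Data.Nat.Base as ℕ using (ℕ)
  open import Data.Product.Base using (_,_)
  open import Function.Base using (_∘_)
  open import Relation.Binary.PropositionalEquality as ≡ using (_≡_)
  open import Relation.Nullary using (yes; no)
  open import Relation.Nullary.Construct.Add.Supremum using ([_])

  NonNeg : ∀ {n} → (Fin n → ℤ) → Set
  NonNeg v = ∀ j → + 0 ℤ.≤ v j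

  module ScaledRoots {c ℓ₁ ℓ₂ ℓ₃} (ℝ : Reals c ℓ₁ ℓ₂ ℓ₃) {n} {M : CoxeterMatrix n} (K : CartanMatrix M)
      where
    open Reals ℝ using (commutativeRing; _<_; _≤_; 0<1; _/suc_; cos; cos-cong; cos-π; π)
    open CommutativeRing commutativeRing hiding (zero)
    open SemiringSum semiring using (sum; sum-cong-≋; *-distribˡ-sum; *-distribʳ-sum)
    open SemiringSum ℤ.+-*-semiring using () renaming (sum to sumℤ)
    open Embedding ℝ
    open Solver using (solve; _:*_; _:-_; :-_; _:=_; con)
    open Billiards ℝ M
    open CoxeterMatrix M
    open CartanMatrix K
    open import Relation.Binary.Reasoning.Setoid setoid

    ι-sum : ∀ {k} (f : Fin k → ℤ) → ι (sumℤ f) ≈ sum (ι ∘ f)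
    ι-sum {ℕ.zero}  f = refl
    ι-sum {ℕ.suc k} f = trans (ι-+ (f zero) _) (+-congˡ (ι-sum (f ∘ suc)))

    B-α : ∀ β i → B β (α i) ≈ sum λ k → β k * formEntry (m k i)
    B-α β i = sum-cong-≋ λ k → trans
      (sum-cong-≋ λ j → solve 3 (λ x y z → x :* y :* z := x :* z :* y) refl (β k) (α i j)
          (formEntry (m k j)))
      (sum-δ semiring (λ j → β k * formEntry (m k j)) i)

    reflect-cong : ∀ i {β γ} → (∀ j → β j ≈ γ j) → ∀ j → reflect i β j ≈ reflect i γ j
    reflect-cong i {β} {γ} β≈γ j = +-cong (β≈γ j) (-‿cong (*-congʳ (*-congˡ (sum-cong-≋ {n} λ k →
      sum-cong-≋ {n} λ l → *-congʳ {formEntry (m k (l))} (*-congʳ {α i l} (β≈γ k))))))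

    ▷-cong : ∀ w {β γ} → (∀ j → β j ≈ γ j) → ∀ j → (w ▷ β) j ≈ (w ▷ γ) j
    ▷-cong []      β≈γ = β≈γ
    ▷-cong (i ∷ w) β≈γ = reflect-cong i (▷-cong w β≈γ)

    ▷-root : ∀ w x k {β} → (∀ j → β j ≈ (x ▷ α k) j) → ∀ j → (w ▷ β) j ≈ ((w ++ x) ▷ α k) j
    ▷-root w x k β≈ j =
      trans (▷-cong w β≈ j) (reflexive (≡.cong-app (≡.sym (List.foldr-++ reflect (α k) w x)) j))

    open SpecialAngles ℝ

    -- The length of the long simple roots when the short ones have length 1.
    ratio : Carrier
    ratio = 2cos (ℕ.pred (label lacing))

    r : Fin n → Carrier
    r i = if long i then ratio else 1#

    0<r : ∀ i → 0# < r i
    0<r i with long i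
    ... | false = 0<1
    ... | true with lacing
    ...   | double = 0<2cos 1
    ...   | triple = 0<2cos 3

    private
      ratio² : ratio * ratio ≈ ι (multiplicity lacing)
      ratio² with lacing
      ... | double = 2cos[π/4]²≈2
      ... | triple = 2cos[π/6]²≈3

      -2cos : ∀ k → (1# + 1#) * formEntry [ ℕ.suc k ] ≈ - 2cos k
      -2cos k = solve 2 (λ t c → t :* (:- c) := :- (t :* c)) refl (1# + 1#) (cos (π /suc k))

      -2cos-label : (1# + 1#) * formEntry [ label lacing ] ≈ - ratio
      -2cos-label with lacing
      ... | double = -2cos 3
      ... | triple = -2cos 5

      root-length : Bool → Carrier
      root-length b = if b then ratio else 1#

      rank2-scales : ∀ {m p q b c} → Rank2 lacing m p q b c →
                     (1# + 1#) * formEntry m * root-length c ≈ ι p * root-length b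
      rank2-scales {b = b} {c} commuting = trans (*-congʳ (trans (-2cos 1) (-‿cong 2cos[π/2]≈0)))
        (solve 2 (λ x y → (:- con (+ 0)) :* x := con (+ 0) :* y) refl (root-length c) (root-length b))
      rank2-scales {b = b} simple = *-congʳ (trans (-2cos 2) (-‿cong (trans 2cos[π/3]≈1 (sym ι1≈1))))
      rank2-scales laced = trans (*-congʳ -2cos-label)
        (trans (*-congˡ (sym ι1≈1)) (solve 1 (λ q → (:- q) :* con (+ 1) := con (ℤ.- + 1) :* q) refl ratio))
      rank2-scales laced′ = trans (*-congʳ -2cos-label)
          (trans (solve 1 (λ q → (:- q) :* q := :- (q :* q)) refl ratio)
        (trans (-‿cong ratio²) (trans (sym (ι-neg (multiplicity lacing))) (sym (*-identityʳ _)))))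
      rank2-scales {b = b} infinite = *-congʳ (trans (*-cong two (-‿cong (sym ι1≈1)))
        (solve 0 (con (+ 2) :* (:- con (+ 1)) := con (ℤ.- + 2)) refl))

      diagonal-scales : (1# + 1#) * formEntry [ 1 ] ≈ ι (+ 2)
      diagonal-scales = trans (-2cos 0)
          (trans (-‿cong (trans (*-cong two (trans (cos-cong angle₀) cos-π)) (*-congˡ (-‿cong (sym ι1≈1)))))
        (solve 0 (:- (con (+ 2) :* (:- con (+ 1))) := con (+ 2)) refl))
        where
        angle₀ : angle 0 ≈ π
        angle₀ = trans (solve 1 (λ x → x := con (+ 1) :* x) refl (angle 0)) (suc*angle 0)

    -- Divided by `r i`, this is the Cartan integer of the rescaled simple roots `r l` αₗ and `r i`
    -- αᵢ: it identifies `C` as the Cartan matrix of the rescaled system.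
    r-scales : ∀ i l → (1# + 1#) * formEntry (m l i) * r l ≈ ι (C i l) * r i
    r-scales i l with i ≟ l
    ... | no i≢l rewrite m-sym l i = rank2-scales (C-rank2 i l i≢l)
    ... | yes ≡.refl rewrite m-diag i | C-diag i = *-congʳ diagonal-scales

    private
      δ-transfer : ∀ k j → r k * α k j ≈ ι (e k j) * r j
      δ-transfer k j with k ≟ j
      ... | yes ≡.refl = trans (*-comm _ _) (*-congʳ (sym ι1≈1))
      ... | no  _      = trans (zeroʳ _) (sym (zeroˡ _))

    scaled-reflect : ∀ k i {β v} → (∀ j → r k * β j ≈ ι (v j) * r j) →
                     ∀ j → r k * reflect i β j ≈ ι (refl-at i v j) * r j
    scaled-reflect k i {β} {v} β~v j = begin
      r k * (β j - 2B * α i j)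
        ≈⟨ solve 4 (λ r b B a → r :* (b :- B :* a) := r :* b :- r :* B :* a) refl (r k) (β j) 2B (α i j) ⟩
      r k * β j - r k * 2B * α i j
        ≈⟨ +-cong (β~v j) (-‿cong (*-congʳ pairing)) ⟩
      ι (v j) * r j - ι (dot i v) * r i * α i j
        ≈⟨ +-congˡ (-‿cong (trans (*-assoc _ _ _)
            (trans (*-congˡ (δ-transfer i j)) (sym (*-assoc _ _ _))))) ⟩
      ι (v j) * r j - ι (dot i v) * ι (e i j) * r j
        ≈⟨ solve 4 (λ v r d ε → v :* r :- d :* ε :* r := (v :- d :* ε) :* r) refl (ι (v j)) (r j)
            (ι (dot i v)) (ι (e i j)) ⟩
      (ι (v j) - ι (dot i v) * ι (e i j)) * r j
        ≈⟨ *-congʳ (trans (ι-+ (v j) (ℤ.- (dot i v ℤ.* e i j)))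
            (+-congˡ (trans (ι-neg (dot i v ℤ.* e i j)) (-‿cong (ι-* (dot i v) (e i j)))))) ⟨
      ι (refl-at i v j) * r j ∎
      where
      2B = (1# + 1#) * B β (α i)
      term : ∀ l → r k * ((1# + 1#) * (β l * formEntry (m l i))) ≈ ι (C i l ℤ.* v l) * r i
      term l = begin
        r k * ((1# + 1#) * (β l * formEntry (m l i)))
          ≈⟨ solve 4 (λ r t b f → r :* (t :* (b :* f)) := r :* b :* (t :* f)) refl (r k) (1# + 1#)
              (β l) (formEntry (m l i)) ⟩
        r k * β l * ((1# + 1#) * formEntry (m l i))
          ≈⟨ *-congʳ (β~v l) ⟩
        ι (v l) * r l * ((1# + 1#) * formEntry (m l i))
          ≈⟨ solve 3 (λ v r t → v :* r :* t := v :* (t :* r)) refl (ι (v l)) (r l)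
              ((1# + 1#) * formEntry (m l i)) ⟩
        ι (v l) * ((1# + 1#) * formEntry (m l i) * r l)
          ≈⟨ *-congˡ (r-scales i l) ⟩
        ι (v l) * (ι (C i l) * r i)
          ≈⟨ solve 3 (λ v c r → v :* (c :* r) := c :* v :* r) refl (ι (v l)) (ι (C i l)) (r i) ⟩
        ι (C i l) * ι (v l) * r i
          ≈⟨ *-congʳ (ι-* (C i l) (v l)) ⟨
        ι (C i l ℤ.* v l) * r i ∎
      pairing : r k * 2B ≈ ι (dot i v) * r i
      pairing = begin
        r k * 2B
          ≈⟨ *-congˡ (*-congˡ (B-α β i)) ⟩
        r k * ((1# + 1#) * sum (λ l → β l * formEntry (m l i)))
          ≈⟨ *-congˡ (*-distribˡ-sum (1# + 1#) (λ l → β l * formEntry (m l i))) ⟩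
        r k * sum (λ l → (1# + 1#) * (β l * formEntry (m l i)))
          ≈⟨ *-distribˡ-sum (r k) (λ l → (1# + 1#) * (β l * formEntry (m l i))) ⟩
        sum (λ l → r k * ((1# + 1#) * (β l * formEntry (m l i))))
          ≈⟨ sum-cong-≋ term ⟩
        sum (λ l → ι (C i l ℤ.* v l) * r i)
          ≈⟨ *-distribʳ-sum (r i) (λ l → ι (C i l ℤ.* v l)) ⟨
        sum (λ l → ι (C i l ℤ.* v l)) * r i
          ≈⟨ *-congʳ (ι-sum (λ l → C i l ℤ.* v l)) ⟨
        ι (dot i v) * r i ∎

    -- In the basis of rescaled simple roots, the multiple of wαₖ by `r k` has integer coordinates.
    -- All scalars are positive, so signs and therefore half-spaces can be read off in ℤ.
    scaled-root : ∀ w k j → r k * (w ▷ α k) j ≈ ι (act w (e k) j) * r j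
    scaled-root []      k j = δ-transfer k j
    scaled-root (i ∷ w) k j = scaled-reflect k i {v = act w (e k)} (scaled-root w k) j

    module _ {β : V} {x : List (Fin n)} {k : Fin n} (β≈ : ∀ j → β j ≈ (x ▷ α k) j) where
      H⁺⇒NonNeg : ∀ {w} → H⁺ β w → NonNeg (act w (act x (e k)))
      H⁺⇒NonNeg {w} (_ , 0≤wβ) j = ≡.subst (λ v → + 0 ℤ.≤ v j) (act-++ w x (e k))
        (nonneg-ι (0<r j) (≤-respʳ-≈ (scaled-root (w ++ x) k j)
          (*-nonneg (0<r k) (≤-respʳ-≈ (▷-root w x k β≈ j) (0≤wβ j)))))

      NonNeg⇒H⁺ : ∀ {w} → NonNeg (act w (act x (e k))) → H⁺ β w
      NonNeg⇒H⁺ {w} 0≤v = (w ++ x , k , ▷-root w x k β≈) , λ j →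
        ≤-respʳ-≈ (sym (▷-root w x k β≈ j)) (*-cancel-nonneg (0<r k)
          (≤-respʳ-≈ (sym (scaled-root (w ++ x) k j))
            (ι-nonneg (≡.subst (λ v → + 0 ℤ.≤ v j) (≡.sym (act-++ w x (e k))) (0≤v j)) (0<r j))))

-- Orbits of toggles and their periodicity

module Orbits where

  open IntegerReflections
  open RealRootSpace

  open import Level using () renaming (suc to lsuc)
  open import Data.Fin.Base using (Fin)
  open import Data.Integer.Base as ℤ using (+_)
  open import Data.List.Base using (List; []; _∷_; _++_; reverse; length; allFin)
  open import Data.List.Relation.Binary.Permutation.Propositional using (_↭_)
  import Data.List.Properties as List
  open import Data.Nat.Base using (ℕ; zero; suc; _+_; _≤_)
  import Data.Nat.Properties as ℕ
  open import Data.Product.Base using (_×_; _,_; ∃-syntax)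
  open import Data.Sum.Base using (_⊎_; inj₁; inj₂)
  open import Relation.Binary.PropositionalEquality hiding ([_])
  open import Relation.Nullary using (¬_)
  open import Relation.Unary using (Pred; Satisfiable)

  module _ {a} {A : Set a} where

    rotate : List A → List A
    rotate []       = []
    rotate (x ∷ xs) = xs ++ x ∷ []

    rotateBy : ℕ → List A → List A
    rotateBy zero    xs = xs
    rotateBy (suc t) xs = rotate (rotateBy t xs)

    rotateBy-rotate : ∀ t xs → rotateBy t (rotate xs) ≡ rotate (rotateBy t xs)
    rotateBy-rotate zero    xs = refl
    rotateBy-rotate (suc t) xs = cong rotate (rotateBy-rotate t xs)

    rotateBy-+ : ∀ s t xs → rotateBy (s + t) xs ≡ rotateBy s (rotateBy t xs)
    rotateBy-+ zero    t xs = refl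
    rotateBy-+ (suc s) t xs = cong rotate (rotateBy-+ s t xs)

    rotateBy-++ : ∀ xs ys → rotateBy (length xs) (xs ++ ys) ≡ ys ++ xs
    rotateBy-++ []       ys = sym (List.++-identityʳ ys)
    rotateBy-++ (x ∷ xs) ys = begin
      rotate (rotateBy (length xs) (x ∷ xs ++ ys))    ≡⟨ rotateBy-rotate (length xs) (x ∷ xs ++ ys) ⟨
      rotateBy (length xs) ((xs ++ ys) ++ x ∷ [])
          ≡⟨ cong (rotateBy (length xs)) (List.++-assoc xs ys (x ∷ [])) ⟩
      rotateBy (length xs) (xs ++ ys ++ x ∷ [])       ≡⟨ rotateBy-++ xs (ys ++ x ∷ []) ⟩
      (ys ++ x ∷ []) ++ xs                            ≡⟨ List.++-assoc ys (x ∷ []) xs ⟩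
      ys ++ x ∷ xs                                    ∎
      where open ≡-Reasoning

    rotateBy-length : ∀ xs → rotateBy (length xs) xs ≡ xs
    rotateBy-length xs = trans (cong (rotateBy (length xs)) (sym (List.++-identityʳ xs)))
        (rotateBy-++ xs [])

    rotateBy-∷ : ∀ t {x} xs → ∃[ y ] ∃[ ys ] rotateBy t (x ∷ xs) ≡ y ∷ ys
    rotateBy-∷ zero    xs = _ , _ , refl
    rotateBy-∷ (suc t) {x} xs with rotateBy t (x ∷ xs) | rotateBy-∷ t {x} xs
    ... | _ | y , []     , refl = _ , _ , refl
    ... | _ | y , z ∷ zs , refl = _ , _ , refl

  module Toggling {n} {M : CoxeterMatrix n} (K : CartanMatrix M) {p} (𝓛 : Pred (List (Fin n)) p) where
    open CartanMatrix K
    open CoxeterGroup M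

    -- For a root v of the form act x (e k), this says v ∈ R(𝓛).
    InR : Vec → Set p
    InR v = ∀ {w} → 𝓛 w → NonNeg (act w v)

    InR-resp : ∀ {v v′} → v ≗ v′ → InR v → InR v′
    InR-resp v≗v′ inR {w} w∈𝓛 j = subst (+ 0 ℤ.≤_) (act-cong w v≗v′ j) (inR w∈𝓛 j)

    Blocked : Fin n → List (Fin n) → Set p
    Blocked i u = InR (act (reverse u) (e i))

    Toggle : Fin n → List (Fin n) → List (Fin n) → Set p
    Toggle i u v = Blocked i u × v ~ u ⊎ ¬ Blocked i u × v ~ i ∷ u

    Blocked-resp : ∀ {i u u′} → u ~ u′ → Blocked i u → Blocked i u′
    Blocked-resp {i} u~u′ = InR-resp (act-~ (~-reverse-cong u~u′) (e i))

    Toggle-resp : ∀ {i u u′ v v′} → u ~ u′ → v ~ v′ → Toggle i u v → Toggle i u′ v′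
    Toggle-resp {i} u~u′ v~v′ (inj₁ (b , v~u)) =
      inj₁ (Blocked-resp {i} u~u′ b , ~-trans (~-sym v~v′) (~-trans v~u u~u′))
    Toggle-resp {i} u~u′ v~v′ (inj₂ (¬b , v~iu)) =
      inj₂ ((λ b → ¬b (Blocked-resp {i} (~-sym u~u′) b)) ,
            ~-trans (~-sym v~v′) (~-trans v~iu (~-cong {i ∷ []} ~-refl u~u′)))

    record Orbit (is : List (Fin n)) (u : List (Fin n)) : Set p where
      queue : ℕ → List (Fin n)
      queue t = rotateBy t is

      field
        state    : ℕ → List (Fin n)
        state-0  : state 0 ≡ u
        toggle   : ∀ t {i q} → queue t ≡ i ∷ q → Toggle i (state t) (state (suc t))
        T        : ℕ
        periodic : ∀ t → state (t + suc T) ~ state t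

    -- A path from (q , u) to (q′ , v), where a pair consists of the queue of upcoming toggles
    -- and the current group element; the list records the elements passed, without v.
    data Path : (q u : List (Fin n)) → List (List (Fin n)) → (q′ v : List (Fin n)) → Set p where
      []  : ∀ {q u} → Path q u [] q u
      _∷_ : ∀ {i q u v ws q′ w} → Toggle i u v → Path (q ++ i ∷ []) v ws q′ w →
            Path (i ∷ q) u (u ∷ ws) q′ w

    _∷ʳ_ : ∀ {i q u ws q′ v w} → Path q u ws (i ∷ q′) v → Toggle i v w →
           Path q u (ws ++ v ∷ []) (q′ ++ i ∷ []) w
    []      ∷ʳ b = b ∷ []
    (a ∷ p) ∷ʳ b = a ∷ (p ∷ʳ b)

    _++ᵖ_ : ∀ {q u ws q′ v ws′ q″ w} → Path q u ws q′ v → Path q′ v ws′ q″ w →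
            Path q u (ws ++ ws′) q″ w
    []      ++ᵖ p′ = p′
    (a ∷ p) ++ᵖ p′ = a ∷ (p ++ᵖ p′)

    -- A periodic point is reached again only up to `~`. The last toggle absorbs the discrepancy, so
    -- the path must be nonempty; afterwards the loop closes on the same word.
    retarget : ∀ {q u w ws q′ v v′} → v ~ v′ → Path q u (w ∷ ws) q′ v → Path q u (w ∷ ws) q′ v′
    retarget {q′ = q′} {v} {v′} v~v′ (a ∷ p) = go p refl a
      where
      go : ∀ {i q r u u′ ws} → Path r u′ ws q′ v → r ≡ q ++ i ∷ [] → Toggle i u u′ →
           Path (i ∷ q) u (u ∷ ws) q′ v′
      go []      refl a = Toggle-resp ~-refl v~v′ a ∷ []
      go (b ∷ p) eq   a = a ∷ subst (λ r → Path r _ _ _ _) eq (go p refl b)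

    head : List (List (Fin n)) → List (Fin n)
    head []      = []
    head (w ∷ _) = w

    module _ {is u w₀ ws₀} (closed : Path is u (w₀ ∷ ws₀) is u) where
      private
        ws = w₀ ∷ ws₀

        Loop : ℕ → Set p
        Loop t = ∃[ v ] Path (rotateBy t is) v (rotateBy t ws) (rotateBy t is) v

        advance : ∀ {q v w vs} → Path q v (w ∷ vs) q v → ∃[ v′ ] Path (rotate q) v′ (rotate (w ∷ vs))
            (rotate q) v′
        advance (a ∷ p) = _ , p ∷ʳ a

        loop : ∀ t → Loop t
        loop zero    = _ , closed
        loop (suc t) with rotateBy t ws | rotateBy-∷ t {w₀} ws₀ | loop t
        ... | _ | _ , _ , refl | _ , p = advance p

        head-end : ∀ {q v vs q′ v′} → Path q v vs q′ v′ → head (vs ++ v′ ∷ []) ≡ v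
        head-end []      = refl
        head-end (_ ∷ _) = refl

        toggle-head : ∀ {i q v w vs} → Path (i ∷ q) v (w ∷ vs) (i ∷ q) v →
                      Toggle i w (head (rotate (w ∷ vs)))
        toggle-head {i} {v = v} (a ∷ p) = subst (Toggle i v) (sym (head-end p)) a

        head-path : ∀ {q v w vs q′ v′} → Path q v (w ∷ vs) q′ v′ → w ≡ v
        head-path (_ ∷ _) = refl

      -- Toggling is not a function, so later states cannot be computed from the present one. All of
      -- them are read off one finite closed path, which is rotated together with the queue.
      closedPath⇒orbit : Orbit is u
      closedPath⇒orbit = record
        { state    = λ t → head (rotateBy t ws)
        ; state-0  = head-path closed
        ; toggle   = λ t eq → toggleAt t eq
        ; T        = length ws₀
        ; periodic = λ t → ≡⇒~ (cong head (trans (rotateBy-+ t (length ws) ws)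
                                                 (cong (rotateBy t) (rotateBy-length ws))))
        }
        where
        toggleAt : ∀ t {i q} → rotateBy t is ≡ i ∷ q →
                   Toggle i (head (rotateBy t ws)) (head (rotateBy (suc t) ws))
        toggleAt t eq with rotateBy t is | rotateBy t ws | rotateBy-∷ t {w₀} ws₀ | loop t
        toggleAt t refl | _ | _ | _ , _ , refl | _ , p = toggle-head p

  IntegrallyFuturistic : ∀ {n} {M : CoxeterMatrix n} → CartanMatrix M → ∀ p → Set (lsuc p)
  IntegrallyFuturistic {n} K p = ∀ (𝓛 : Pred (List (Fin n)) p) → Satisfiable 𝓛 →
    let open CartanMatrix K; open Toggling K 𝓛 in
    ∀ is → is ↭ allFin n → ∀ u → Orbit is u →
    ∀ x k → InR (act x (e k)) → NonNeg (act u (act x (e k)))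

-- From half-spaces over the reals to integer roots

module Reduction where

  open RealArithmetic
  open IntegerReflections
  open RealRootSpace
  open Orbits

  open import Algebra.Bundles using (module CommutativeRing)
  open import Data.Fin.Base using (Fin)
  open import Data.List.Base using (List; []; _∷_; _++_; reverse)
  import Data.List.Properties as List
  open import Data.List.Relation.Binary.Permutation.Propositional.Properties using (↭-length)
  open import Data.Nat.Base using (suc)
  open import Data.Product.Base using (_×_; _,_; ∃-syntax)
  open import Data.Sum.Base using (inj₁; inj₂)
  open import Function.Base using (_∘_)
  open import Function.Bundles using (module Equivalence)
  open import Relation.Binary.PropositionalEquality using (_≡_; refl; sym)
  open import Relation.Unary using (Pred)

  module FromReals {c ℓ₁ ℓ₂ ℓ₃} (ℝ : Reals c ℓ₁ ℓ₂ ℓ₃) {n} {M : CoxeterMatrix (suc n)}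
      (K : CartanMatrix M) where
    open Reals ℝ using (_≈_)
    open Reals ℝ using () renaming (commutativeRing to ℝ-ring)
    open Billiards ℝ M hiding (Futuristic)
    open CoxeterMatrix M
    open CoxeterGroup M
    open CartanMatrix K
    open ScaledRoots ℝ K using (H⁺⇒NonNeg; NonNeg⇒H⁺)

    module _ {p} (𝓛 : Pred (List (Fin (suc n))) p) where
      open Toggling K 𝓛

      private
        root-refl : ∀ x k j → (x ▷ α k) j ≈ (x ▷ α k) j
        root-refl x k j = CommutativeRing.refl ℝ-ring

      R⇒InR : ∀ {β} x k → (∀ j → β j ≈ (x ▷ α k) j) → (∀ {w} → 𝓛 w → H⁺ β w) → InR (act x (e k))
      R⇒InR x k β≈ sub {w} w∈𝓛 = H⁺⇒NonNeg {x = x} {k} β≈ {w} (sub w∈𝓛)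

      InR⇒R : ∀ x k → InR (act x (e k)) → R 𝓛 (x ▷ α k)
      InR⇒R x k inR = (x , k , root-refl x k) , λ {w} w∈𝓛 → NonNeg⇒H⁺ {x = x} {k} (root-refl x k) {w}
          (inR w∈𝓛)

      τ⇒Toggle : ∀ {i u v} → τ 𝓛 i u v → Toggle i u v
      τ⇒Toggle {i} {u} (inj₁ ((_ , sub) , v~u)) = inj₁
          (R⇒InR (reverse u) i (root-refl (reverse u) i) sub , v~u)
      τ⇒Toggle {i} {u} (inj₂ (¬R , v~iu))       = inj₂ (¬R ∘ InR⇒R (reverse u) i , v~iu)

      recast : ∀ {q r q′ r′ u ws v} → q ≡ r → q′ ≡ r′ → Path q u ws q′ v → Path r u ws r′ v
      recast refl refl path = path

      -- The induction needs `q`, the labels queued behind the rest of the round. With `q` empty, a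
      -- full round brings the queue back to `is`.
      pro-path : ∀ {is q u u₀ v} → Pro 𝓛 is u v → u ~ u₀ →
                 ∃[ ws ] ∃[ v₀ ] v ~ v₀ × Path (is ++ q) u₀ ws (q ++ is) v₀
      pro-path {q = q} ([] u~v) u~u₀ = [] , _ , ~-trans (~-sym u~v) u~u₀ ,
        recast refl (sym (List.++-identityʳ q)) []
      pro-path {i ∷ is} {q} (_∷_ {v = v} t pro) u~u₀ with pro-path {q = q ++ i ∷ []} pro ~-refl
      ... | ws , v₀ , v~v₀ , path = _ , v₀ , v~v₀ , (Toggle-resp u~u₀ ~-refl (τ⇒Toggle t) ∷
        recast (sym (List.++-assoc is q (i ∷ []))) (List.++-assoc q (i ∷ []) is) path)

      iterate-path : ∀ {is K u u₀ v} → Iterate (Pro 𝓛 is) K u v → u ~ u₀ →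
                     ∃[ ws ] ∃[ v₀ ] v ~ v₀ × Path is u₀ ws is v₀
      iterate-path ([] u~v) u~u₀ = [] , _ , ~-trans (~-sym u~v) u~u₀ , []
      iterate-path {is} (pro ∷ it) u~u₀ with pro-path {q = []} pro u~u₀
      ... | ws , v₀ , v~v₀ , path with iterate-path it v~v₀
      ... | ws′ , w₀ , w~w₀ , path′ = _ , w₀ , w~w₀ ,
        recast (List.++-identityʳ is) refl path ++ᵖ path′

      periodic⇒orbit : ∀ {i is u} → Periodic (Pro 𝓛 (i ∷ is)) u → Orbit (i ∷ is) u
      periodic⇒orbit {i} (_ , _ , (t ∷ pro) ∷ it) with pro-path {q = i ∷ []} pro ~-refl
      ... | _ , _ , v~v₀ , path with iterate-path it v~v₀
      ... | _ , _ , w~w₀ , path′ =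
        closedPath⇒orbit (retarget (~-sym w~w₀) (τ⇒Toggle t ∷ (path ++ᵖ path′)))

    integral : ∀ {a p} → IntegrallyFuturistic K p → Futuristic ℝ M a p
    integral _ _ _ _ _ _ [] ordering with () ← ↭-length ordering
    integral futuristic 𝓛 (A , A⊆Φ , 𝓛⇔) nonempty _ _ is@(_ ∷ _) ordering _ u periodic =
      Equivalence.from (𝓛⇔ u) λ β β∈A →
        let (x , k , β≈) = A⊆Φ β∈A in
        NonNeg⇒H⁺ {x = x} {k} β≈ {u}
          (futuristic 𝓛 nonempty is ordering u (periodic⇒orbit 𝓛 periodic) x k
            (R⇒InR 𝓛 x k β≈ λ w∈𝓛 → Equivalence.to (𝓛⇔ _) w∈𝓛 β β∈A))

-- Waiting times in the rotating queue

module Schedules where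

  open Orbits

  open import Data.Fin.Base using (Fin)
  open import Data.Fin.Properties using (_≟_)
  open import Data.List.Base using (List; []; _∷_; _++_; length; allFin)
  open import Data.List.Membership.Propositional using (_∈_)
  open import Data.List.Membership.Propositional.Properties using (∈-allFin)
  open import Data.List.Relation.Binary.Permutation.Propositional using (_↭_; ↭-sym; ↭-trans; ↭-refl; ↭⇒↭ₛ)
  open import Data.List.Relation.Binary.Permutation.Propositional.Properties using
      (∷↭∷ʳ; ∈-resp-↭; ↭-length)
  open import Data.List.Relation.Unary.All using (All; []; _∷_)
  import Data.List.Relation.Unary.All as All
  open import Data.List.Relation.Unary.Any using (here; there)
  open import Data.List.Relation.Unary.AllPairs using ([]; _∷_)
  open import Data.List.Relation.Unary.Unique.Propositional using (Unique)
  open import Data.List.Relation.Unary.Unique.Propositional.Properties using (allFin⁺)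
  import Data.List.Relation.Binary.Permutation.Setoid.Properties as Perm
  open import Data.Nat.Base using (ℕ; zero; suc; _≤_; z≤n; s≤s)
  import Data.Nat.Properties as ℕ
  open import Data.Product.Base using (_,_; proj₁; proj₂; ∃-syntax; Σ-syntax)
  open import Relation.Binary.PropositionalEquality hiding ([_])
  open import Relation.Nullary using (yes; no; contradiction)

  module _ {n : ℕ} where

    index : List (Fin n) → Fin n → ℕ
    index []      j = 0
    index (i ∷ q) j with i ≟ j
    ... | yes _ = 0
    ... | no  _ = suc (index q j)

    index-head : ∀ i q → index (i ∷ q) i ≡ 0
    index-head i q with i ≟ i
    ... | yes _  = refl
    ... | no i≢i = contradiction refl i≢i

    index-tail : ∀ {i j} q → i ≢ j → index (i ∷ q) j ≡ suc (index q j)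
    index-tail {i} {j} q i≢j with i ≟ j
    ... | yes i≡j = contradiction i≡j i≢j
    ... | no _    = refl

    index-++ : ∀ {q j} r → j ∈ q → index (q ++ r) j ≡ index q j
    index-++ {i ∷ q} {j} r j∈ with i ≟ j | j∈
    ... | yes _  | _         = refl
    ... | no i≢j | here refl = contradiction refl i≢j
    ... | no _   | there j∈q = cong suc (index-++ r j∈q)

    index-last : ∀ {q i} → All (i ≢_) q → index (q ++ i ∷ []) i ≡ length q
    index-last {[]}    {i} []          = index-head i []
    index-last {k ∷ q} {i} (i≢k ∷ all) with k ≟ i
    ... | yes k≡i = contradiction (sym k≡i) i≢k
    ... | no _    = cong suc (index-last all)

    index-≤ : ∀ {q j} → j ∈ q → suc (index q j) ≤ length q
    index-≤ {i ∷ q} {j} j∈ with i ≟ j | j∈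
    ... | yes _  | _         = s≤s z≤n
    ... | no i≢j | here refl = contradiction refl i≢j
    ... | no _   | there j∈q = s≤s (index-≤ j∈q)

  -- The number of steps until each label is toggled.
  record Schedule (n N : ℕ) : Set where
    field
      next      : ℕ → Fin n
      wait      : ℕ → Fin n → ℕ
      wait-next : ∀ t → wait t (next t) ≡ 0
      wait-step : ∀ t {j} → next t ≢ j → wait t j ≡ suc (wait (suc t) j)
      wait-last : ∀ t → wait (suc t) (next t) ≡ N
      wait-≤    : ∀ t j → wait t j ≤ N

  queueSchedule : ∀ {n i is} → i ∷ is ↭ allFin n →
    Σ[ S ∈ Schedule n (length is) ] ∀ t → ∃[ q ] rotateBy t (i ∷ is) ≡ Schedule.next S t ∷ q
  queueSchedule {n} {i} {is} ordering = record
    { next      = λ t → proj₁ (split t)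
    ; wait      = λ t → index (queue t)
    ; wait-next = λ t → trans (cong (λ q → index q (proj₁ (split t))) (proj₂ (proj₂ (split t))))
        (index-head _ _)
    ; wait-step = λ t → step t (proj₂ (proj₂ (split t))) (permuted t)
    ; wait-last = λ t → last t (proj₂ (proj₂ (split t))) (permuted t)
    ; wait-≤    = λ t j → bound t j
    } , λ t → proj₂ (split t)
    where
    queue : ℕ → List (Fin n)
    queue t = rotateBy t (i ∷ is)

    split : ∀ t → ∃[ j ] ∃[ q ] queue t ≡ j ∷ q
    split t = rotateBy-∷ t is

    rotate-↭ : ∀ (q : List (Fin n)) → rotate q ↭ q
    rotate-↭ []      = ↭-refl
    rotate-↭ (j ∷ q) = ↭-sym (∷↭∷ʳ j q)

    permuted : ∀ t → queue t ↭ allFin n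
    permuted zero    = ordering
    permuted (suc t) = ↭-trans (rotate-↭ (queue t)) (permuted t)

    contains : ∀ {q} → q ↭ allFin n → ∀ j → j ∈ q
    contains q↭ j = ∈-resp-↭ (↭-sym q↭) (∈-allFin j)

    unique : ∀ {q} → q ↭ allFin n → Unique q
    unique q↭ = Perm.Unique-resp-↭ (setoid (Fin n)) (↭⇒↭ₛ (↭-sym q↭)) (allFin⁺ n)

    step : ∀ t {k q j} → queue t ≡ k ∷ q → queue t ↭ allFin n → k ≢ j →
           index (queue t) j ≡ suc (index (rotate (queue t)) j)
    step t {k} {q} {j} eq perm k≢j rewrite eq with contains perm j
    ... | here refl = contradiction refl k≢j
    ... | there j∈q = trans (index-tail q k≢j) (cong suc (sym (index-++ (k ∷ []) j∈q)))

    length-queue : ∀ {q} → q ↭ allFin n → length q ≡ suc (length is)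
    length-queue q↭ = trans (↭-length q↭) (sym (↭-length ordering))

    last : ∀ t {k q} → queue t ≡ k ∷ q → queue t ↭ allFin n → index (rotate (queue t)) k ≡ length is
    last t {k} {q} eq perm rewrite eq with unique perm
    ... | k∉q ∷ _ = trans (index-last k∉q) (ℕ.suc-injective (length-queue perm))

    bound : ∀ t j → index (queue t) j ≤ length is
    bound t j = ℕ.≤-pred (ℕ.≤-trans (index-≤ (contains (permuted t) j))
        (ℕ.≤-reflexive (length-queue (permuted t))))

-- Coxeter groups permuting the gaps of a line of walls

module Lines where

  open KroneckerDelta
  open IntegerReflections
  open RealRootSpace

  import Algebra.Properties.Semiring.Sum as SemiringSum
  open import Data.Empty using (⊥-elim)
  open import Data.Fin.Base using (Fin; zero; suc)
  open import Data.Fin.Properties using (_≟_)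
  open import Data.Integer.Base as ℤ using (ℤ; +_; -[1+_]; _+_; _*_; _-_; -_; _≤_; _<_; pred) renaming
      (suc to sucℤ)
  import Data.Integer.Properties as ℤ
  open import Data.Integer.Tactic.RingSolver using (solve-∀)
  open import Data.List.Base using (List; []; _∷_; _++_; foldr; reverse; replicate; concat)
  import Data.List.Properties as List
  open import Data.Nat.Base as ℕ using (ℕ; zero; suc)
  open import Data.Product.Base using (_×_; _,_; ∃-syntax)
  open import Relation.Binary.PropositionalEquality hiding ([_])
  open import Relation.Nullary using (Dec; yes; no; contradiction)
  open import Relation.Nullary.Construct.Add.Supremum using ([_])

  open SemiringSum ℤ.+-*-semiring using (sum; sum-cong-≗; ∑-distrib-+)

  ℤ-constant : ∀ {a} {A : Set a} (f : ℤ → A) → (∀ z → f (sucℤ z) ≡ f z) → ∀ y z → f y ≡ f z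
  ℤ-constant f step y z = trans (from-0 y) (sym (from-0 z))
    where
    from-0 : ∀ z → f z ≡ f (+ 0)
    from-0 (+ zero)      = refl
    from-0 (+ suc n)     = trans (step (+ n)) (from-0 (+ n))
    from-0 -[1+ zero ]   = sym (step -[1+ 0 ])
    from-0 -[1+ suc n ]  = trans (sym (step -[1+ suc n ])) (from-0 -[1+ n ])

  -- The integers are the gaps of a line of walls, wall z separating the gaps z and z + 1.  The
  -- generator i exchanges the two gaps at every wall labelled i, and a root corresponds to a pair
  -- of gaps, its coordinates being the numbers of walls with each label between them.
  record Line {n} {M : CoxeterMatrix n} (K : CartanMatrix M) : Set where
    open CoxeterMatrix M
    open CartanMatrix K
    open CoxeterGroup M
    field
      wall       : ℤ → Fin n
      wall-≢     : ∀ z → wall z ≢ wall (sucℤ z)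
      -- If `i` labels neighbours of the wall z, then `swap i` carries the two gaps at z apart
      -- across them, so the reflection has to add αᵢ once for each such neighbour.
      neighbours : ∀ i z → i ≢ wall z → C i (wall z) ≡ - (e (wall (pred z)) i + e (wall (sucℤ z)) i)
      wall-onto  : ∀ i → ∃[ z ] wall z ≡ i
      -- This keeps a relator from translating the line: words in `i` and `j` never carry a gap
      -- across a wall with a third label.
      third-wall : ∀ i j {k} → i ≢ j → m i j ≡ [ k ] → ∃[ z ] (i ≢ wall z × j ≢ wall z)

    swap : Fin n → ℤ → ℤ
    swap i z with wall z ≟ i | wall (pred z) ≟ i
    ... | yes _ | _     = sucℤ z
    ... | no  _ | yes _ = pred z
    ... | no  _ | no  _ = z

    move : List (Fin n) → ℤ → ℤ
    move w z = foldr swap z w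

    move-++ : ∀ u w z → move (u ++ w) z ≡ move u (move w z)
    move-++ u w z = List.foldr-++ swap z u w

    swap-right : ∀ {i z} → wall z ≡ i → swap i z ≡ sucℤ z
    swap-right {i} {z} eq with wall z ≟ i | wall (pred z) ≟ i
    ... | yes _  | _ = refl
    ... | no ≢i  | _ = contradiction eq ≢i

    swap-left : ∀ {i z} → wall (pred z) ≡ i → swap i z ≡ pred z
    swap-left {i} {z} eq with wall z ≟ i | wall (pred z) ≟ i
    ... | yes ≡i | _     = ⊥-elim (wall-≢ (pred z)
        (trans eq (trans (sym ≡i) (cong wall (sym (ℤ.suc-pred z))))))
    ... | no _   | yes _ = refl
    ... | no _   | no ≢i = contradiction eq ≢i

    swap-fix : ∀ {i z} → wall z ≢ i → wall (pred z) ≢ i → swap i z ≡ z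
    swap-fix {i} {z} ≢i ≢i′ with wall z ≟ i | wall (pred z) ≟ i
    ... | yes ≡i | _      = contradiction ≡i ≢i
    ... | no _   | yes ≡i = contradiction ≡i ≢i′
    ... | no _   | no _   = refl

    swap-≤ : ∀ {i y z} → i ≢ wall z → y ≤ z → swap i y ≤ z
    swap-≤ {i} {y} {z} i≢ y≤z with wall y ≟ i | wall (pred y) ≟ i
    ... | yes ≡i | _     = ℤ.i<j⇒suc[i]≤j (ℤ.≤∧≢⇒< y≤z λ { refl → i≢ (sym ≡i) })
    ... | no _   | yes _ = ℤ.i≤j⇒pred[i]≤j y≤z
    ... | no _   | no _  = y≤z

    swap-> : ∀ {i y z} → i ≢ wall z → z < y → z < swap i y
    swap-> {i} {y} {z} i≢ z<y with wall y ≟ i | wall (pred y) ≟ i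
    ... | yes _ | _      = ℤ.<-≤-trans z<y (ℤ.i≤suc[i] y)
    ... | no _  | yes ≡i = ℤ.≤∧≢⇒< (ℤ.i<j⇒i≤pred[j] z<y) λ { refl → i≢ (sym ≡i) }
    ... | no _  | no _   = z<y

    swap-involutive : ∀ i z → swap i (swap i z) ≡ z
    swap-involutive i z with wall z ≟ i | wall (pred z) ≟ i
    ... | yes ≡i | _      = trans (swap-left (trans (cong wall (ℤ.pred-suc z)) ≡i)) (ℤ.pred-suc z)
    ... | no _   | yes ≡i = trans (swap-right ≡i) (ℤ.suc-pred z)
    ... | no ≢i  | no ≢i′ = swap-fix ≢i ≢i′

    H : ℤ → Vec
    H (+ zero)     j = + 0
    H (+ suc k)    j = H (+ k) j + e (wall (+ k)) j
    H -[1+ zero ]  j = - e (wall -[1+ 0 ]) j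
    H -[1+ suc k ] j = H -[1+ k ] j - e (wall -[1+ suc k ]) j

    H-suc : ∀ z j → H (sucℤ z) j ≡ H z j + e (wall z) j
    H-suc (+ k)        j = refl
    H-suc -[1+ zero ]  j = sym (ℤ.+-inverseˡ (e (wall -[1+ 0 ]) j))
    H-suc -[1+ suc k ] j = lemma (H -[1+ k ] j) (e (wall -[1+ suc k ]) j)
      where
      lemma : ∀ x y → x ≡ x - y + y
      lemma = solve-∀

    H-pred : ∀ z j → H (pred z) j ≡ H z j - e (wall (pred z)) j
    H-pred z j = trans (lemma (H (pred z) j) (e (wall (pred z)) j))
      (cong (_- e (wall (pred z)) j) (trans (sym (H-suc (pred z) j)) (cong (λ z → H z j) (ℤ.suc-pred z))))
      where
      lemma : ∀ x y → x ≡ x + y - y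
      lemma = solve-∀

    root : ℤ → ℤ → Vec
    root x y = H y ⊕ (- + 1) ⊙ H x

    root-suc : ∀ z → root z (sucℤ z) ≗ e (wall z)
    root-suc z j rewrite H-suc z j = lemma (H z j) (e (wall z) j)
      where
      lemma : ∀ x y → x + y + - + 1 * x ≡ y
      lemma = solve-∀

    private
      e-diag : ∀ i → e i i ≡ + 1
      e-diag i with i ≟ i
      ... | yes _  = refl
      ... | no i≢i = contradiction refl i≢i

      e-off : ∀ {i j} → i ≢ j → e i j ≡ + 0
      e-off {i} {j} i≢j with i ≟ j
      ... | yes i≡j = contradiction i≡j i≢j
      ... | no _    = refl

      H-swap-far : ∀ {i z} j → wall z ≢ i → H (swap i z) j ≡ H z j - e (wall (pred z)) i * e i j
      H-swap-far {i} {z} j ≢i = go (wall (pred z) ≟ i)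
        where
        go : Dec (wall (pred z) ≡ i) → H (swap i z) j ≡ H z j - e (wall (pred z)) i * e i j
        go (yes refl) rewrite swap-left {i} {z} refl | e-diag i =
          trans (H-pred z j) (cong (_-_ (H z j)) (sym (ℤ.*-identityˡ (e i j))))
        go (no ≢i′) rewrite swap-fix ≢i ≢i′ | e-off ≢i′ = sym (ℤ.+-identityʳ (H z j))

      H-swap-near : ∀ {i z} j → wall (pred z) ≢ i → H (swap i z) j ≡ H z j + e (wall z) i * e i j
      H-swap-near {i} {z} j ≢i = go (wall z ≟ i)
        where
        go : Dec (wall z ≡ i) → H (swap i z) j ≡ H z j + e (wall z) i * e i j
        go (yes refl) rewrite swap-right {i} {z} refl | e-diag i =
          trans (H-suc z j) (cong (_+_ (H z j)) (sym (ℤ.*-identityˡ (e i j))))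
        go (no ≢i′) rewrite swap-fix ≢i′ ≢i | e-off ≢i′ = sym (ℤ.+-identityʳ (H z j))

      refl-at-step : ∀ i z j → refl-at i (e (wall z)) j + H (swap i z) j ≡ H (swap i (sucℤ z)) j
      refl-at-step i z j = go (wall z ≟ i)
        where
        lemma : ∀ x y → y - + 2 * y + (x + y) ≡ x
        lemma = solve-∀
        lemma′ : ∀ x y ε l r → y - - (l + r) * ε + (x - l * ε) ≡ x + y + r * ε
        lemma′ = solve-∀
        go : Dec (wall z ≡ i) → refl-at i (e (wall z)) j + H (swap i z) j ≡ H (swap i (sucℤ z)) j
        go (yes refl) rewrite swap-right {i} {z} refl | swap-left {i} {sucℤ z} (cong wall (ℤ.pred-suc z))
                           | dot-e i i | C-diag i | ℤ.pred-suc z | H-suc z j = lemma (H z j) (e i j)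
        go (no ≢i) rewrite H-swap-far {i} {z} j ≢i
                        | H-swap-near {i} {sucℤ z} j (subst (λ y → wall y ≢ i) (sym (ℤ.pred-suc z)) ≢i)
                        | dot-e i (wall z) | neighbours i z (≢-sym ≢i) | H-suc z j =
          lemma′ (H z j) (e (wall z) j) (e i j) (e (wall (pred z)) i) (e (wall (sucℤ z)) i)

      -- The difference is constant but not always zero: reflections fix the origin, whereas a swap
      -- may move gap 0. Only differences of values of `H` are roots, so the constant cancels.
      refl-at-H : ∀ i j y z → refl-at i (H y) j - H (swap i y) j ≡ refl-at i (H z) j - H (swap i z) j
      refl-at-H i j = ℤ-constant (λ z → refl-at i (H z) j - H (swap i z) j) λ z → begin
        refl-at i (H (sucℤ z)) j - H (swap i (sucℤ z)) j
          ≡⟨ cong₂ _-_ (trans (refl-at-cong i (H-suc z) j) (refl-at-⊕ i (H z) (e (wall z)) j))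
              (sym (refl-at-step i z j)) ⟩
        refl-at i (H z) j + refl-at i (e (wall z)) j - (refl-at i (e (wall z)) j + H (swap i z) j)
          ≡⟨ lemma (refl-at i (H z) j) (refl-at i (e (wall z)) j) (H (swap i z) j) ⟩
        refl-at i (H z) j - H (swap i z) j ∎
        where
        open ≡-Reasoning
        lemma : ∀ a b c → a + b - (b + c) ≡ a - c
        lemma = solve-∀

    refl-at-root : ∀ i x y → refl-at i (root x y) ≗ root (swap i x) (swap i y)
    refl-at-root i x y j = begin
      refl-at i (root x y) j
        ≡⟨ refl-at-⊕ i (H y) (- + 1 ⊙ H x) j ⟩
      refl-at i (H y) j + refl-at i (- + 1 ⊙ H x) j
        ≡⟨ cong (_+_ (refl-at i (H y) j)) (refl-at-⊙ i (- + 1) (H x) j) ⟩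
      refl-at i (H y) j + - + 1 * refl-at i (H x) j
        ≡⟨ lemma (refl-at i (H y) j) (refl-at i (H x) j) (H (swap i y) j) (H (swap i x) j) ⟩
      (refl-at i (H y) j - H (swap i y) j) - (refl-at i (H x) j - H (swap i x) j) + root (swap i x)
          (swap i y) j
        ≡⟨ cong (λ d → d - (refl-at i (H x) j - H (swap i x) j) + root (swap i x) (swap i y) j)
            (refl-at-H i j y x) ⟩
      (refl-at i (H x) j - H (swap i x) j) - (refl-at i (H x) j - H (swap i x) j) + root (swap i x)
          (swap i y) j
        ≡⟨ cancel (refl-at i (H x) j - H (swap i x) j) (root (swap i x) (swap i y) j) ⟩
      root (swap i x) (swap i y) j ∎
      where
      open ≡-Reasoning
      lemma : ∀ a b c d → a + - + 1 * b ≡ (a - c) - (b - d) + (c + - + 1 * d)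
      lemma = solve-∀
      cancel : ∀ a b → a - a + b ≡ b
      cancel = solve-∀

    act-root : ∀ w x y → act w (root x y) ≗ root (move w x) (move w y)
    act-root []      x y j = refl
    act-root (i ∷ w) x y j = trans (refl-at-cong i (act-root w x y) j)
        (refl-at-root i (move w x) (move w y) j)

    sum-H : ∀ z → sum (H z) ≡ z
    sum-H z = begin
      sum (H z)               ≡⟨ lemma (sum (H z)) z ⟩
      sum (H z) - z + z       ≡⟨ cong (_+ z) (ℤ-constant (λ z → sum (H z) - z) step z (+ 0)) ⟩
      sum (H (+ 0)) - + 0 + z ≡⟨ cong (λ s → s - + 0 + z)
          (SemiringSum.sum-replicate-zero ℤ.+-*-semiring n) ⟩
      + 0 + z                 ≡⟨ ℤ.+-identityˡ z ⟩
      z                       ∎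
      where
      open ≡-Reasoning
      lemma : ∀ x y → x ≡ x - y + y
      lemma = solve-∀
      sum-e : ∀ k → sum (e k) ≡ + 1
      sum-e k = trans (sum-cong-≗ λ j → sym (ℤ.*-identityˡ (e k j))) (sum-δ ℤ.+-*-semiring (λ _ → + 1) k)
      lemma′ : ∀ x z → x + + 1 - (+ 1 + z) ≡ x - z
      lemma′ = solve-∀
      step : ∀ z → sum (H (sucℤ z)) - sucℤ z ≡ sum (H z) - z
      step z rewrite trans (sum-cong-≗ (H-suc z)) (∑-distrib-+ (H z) (e (wall z))) | sum-e (wall z) =
          lemma′ (sum (H z)) z

    sum-root : ∀ x y → sum (root x y) ≡ y - x
    sum-root x y = begin
      sum (root x y)                          ≡⟨ ∑-distrib-+ (H y) (- + 1 ⊙ H x) ⟩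
      sum (H y) + sum (- + 1 ⊙ H x)
          ≡⟨ cong (_+_ (sum (H y))) (sym (SemiringSum.*-distribˡ-sum ℤ.+-*-semiring (- + 1) (H x))) ⟩
      sum (H y) + - + 1 * sum (H x)           ≡⟨ cong₂ (λ a b → a + - + 1 * b) (sum-H y) (sum-H x) ⟩
      y + - + 1 * x                           ≡⟨ cong (_+_ y) (ℤ.-1*i≡-i x) ⟩
      y - x                                   ∎
      where open ≡-Reasoning

    sum-nonneg : ∀ {k} (v : Fin k → ℤ) → NonNeg v → + 0 ≤ sum v
    sum-nonneg {zero}  v 0≤v = ℤ.≤-refl
    sum-nonneg {suc k} v 0≤v = ℤ.+-mono-≤ (0≤v zero) (sum-nonneg (λ j → v (suc j)) (λ j → 0≤v (suc j)))

    NonNeg-root⇒≤ : ∀ {x y} → NonNeg (root x y) → x ≤ y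
    NonNeg-root⇒≤ {x} {y} 0≤ = ℤ.0≤i-j⇒j≤i (subst (+ 0 ≤_) (sum-root x y) (sum-nonneg (root x y) 0≤))

    H-mono : ∀ k x j → H x j ≤ H (+ k + x) j
    H-mono zero    x j = ℤ.≤-reflexive (cong (λ z → H z j) (sym (ℤ.+-identityˡ x)))
    H-mono (suc k) x j = ℤ.≤-trans (H-mono k x j) (subst (H (+ k + x) j ≤_)
      (trans (sym (H-suc (+ k + x) j)) (cong (λ z → H z j) (sym (ℤ.+-assoc (+ 1) (+ k) x))))
      (subst (_≤ H (+ k + x) j + e (wall (+ k + x)) j) (ℤ.+-identityʳ _)
          (ℤ.+-monoʳ-≤ (H (+ k + x) j) (0≤e (wall (+ k + x)) j))))
      where
      0≤e : ∀ i j → + 0 ≤ e i j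
      0≤e i j with i ≟ j
      ... | yes _ = ℤ.+≤+ ℕ.z≤n
      ... | no _  = ℤ.≤-refl

    ≤⇒NonNeg-root : ∀ {x y} → x ≤ y → NonNeg (root x y)
    ≤⇒NonNeg-root {x} {y} x≤y j = subst (+ 0 ≤_) (cong (_+_ (H y j)) (sym (ℤ.-1*i≡-i (H x j))))
      (ℤ.i≤j⇒0≤j-i (subst (λ z → H x j ≤ H z j) eq (H-mono (ℤ.∣ y - x ∣) x j)))
      where
      lemma : ∀ x y → y - x + x ≡ y
      lemma = solve-∀
      eq : + ℤ.∣ y - x ∣ + x ≡ y
      eq = trans (cong (_+ x) (ℤ.0≤i⇒+∣i∣≡i (ℤ.i≤j⇒0≤j-i x≤y))) (lemma x y)

    private
      -- A word acting trivially on the roots translates the line; it cannot do so if it respects some wall.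
      trivial-move : ∀ w → (∀ v → act w v ≗ v) → ∀ z → move w z ≤ z → z < move w (sucℤ z) → ∀ y → move
          w y ≡ y
      trivial-move w trivial z ≤z z< y = trans (difference y)
          (trans (cong (λ x → x + (y - z)) fixed) (lemma z y))
        where
        lemma : ∀ z y → z + (y - z) ≡ y
        lemma = solve-∀
        lemma₁ : ∀ a b → b ≡ a + (b - a)
        lemma₁ = solve-∀
        lemma₂ : ∀ a z → a + (+ 1 + z - z) ≡ + 1 + a
        lemma₂ = solve-∀
        difference : ∀ y → move w y ≡ move w z + (y - z)
        difference y = trans (lemma₁ (move w z) (move w y)) (cong (_+_ (move w z))
          (trans (sym (sum-root (move w z) (move w y)))
            (trans (sum-cong-≗ λ j → trans (sym (act-root w z y j)) (trivial (root z y) j))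
                (sum-root z y))))
        fixed : move w z ≡ z
        fixed = ℤ.≤-antisym ≤z (ℤ.≤-trans (ℤ.i<j⇒i≤pred[j] z<)
          (ℤ.≤-reflexive (trans (cong pred (trans (difference (sucℤ z)) (lemma₂ (move w z) z)))
              (ℤ.pred-suc (move w z)))))

      power-≤ : ∀ i j k {y z} → i ≢ wall z → j ≢ wall z → y ≤ z → move
          (concat (replicate k (i ∷ j ∷ []))) y ≤ z
      power-≤ i j zero    i≢ j≢ y≤z = y≤z
      power-≤ i j (suc k) i≢ j≢ y≤z = swap-≤ i≢ (swap-≤ j≢ (power-≤ i j k i≢ j≢ y≤z))

      power-> : ∀ i j k {y z} → i ≢ wall z → j ≢ wall z → z < y → z < move
          (concat (replicate k (i ∷ j ∷ []))) y
      power-> i j zero    i≢ j≢ z<y = z<y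
      power-> i j (suc k) i≢ j≢ z<y = swap-> i≢ (swap-> j≢ (power-> i j k i≢ j≢ z<y))

    move-~ : ∀ {u w} → u ~ w → ∀ z → move u z ≡ move w z
    move-~ ~-refl         z = refl
    move-~ (~-sym r)      z = sym (move-~ r z)
    move-~ (~-trans r r′) z = trans (move-~ r z) (move-~ r′ z)
    move-~ (~-cong {u} {u′} {w} {w′} r r′) z
      rewrite move-++ u w z | move-++ u′ w′ z = trans (cong (move u) (move-~ r′ z)) (move-~ r (move w′ z))
    move-~ (~-rel i j {k} mij≡k) z with i ≟ j
    ... | yes refl with refl ← trans (sym mij≡k) (m-diag i) = swap-involutive i z
    ... | no i≢j with y , i≢ , j≢ ← third-wall i j i≢j mij≡k =
      trivial-move (concat (replicate k (i ∷ j ∷ []))) (act-~ (~-rel i j mij≡k)) y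
        (power-≤ i j k i≢ j≢ ℤ.≤-refl) (power-> i j k i≢ j≢ (ℤ.suc[i]≤j⇒i<j ℤ.≤-refl)) z

    move-inverseˡ : ∀ u z → move (reverse u) (move u z) ≡ z
    move-inverseˡ u z = trans (sym (move-++ (reverse u) u z)) (move-~ (~-inverseˡ u) z)

    move-inverseʳ : ∀ u z → move u (move (reverse u) z) ≡ z
    move-inverseʳ u z = trans (sym (move-++ u (reverse u) z)) (move-~ (~-inverseʳ u) z)

    move-injective : ∀ u {y z} → move u y ≡ move u z → y ≡ z
    move-injective u {y} {z} eq = trans (sym (move-inverseˡ u y))
        (trans (cong (move (reverse u)) eq) (move-inverseˡ u z))

-- Tokens moving on the line

module LineBilliards where

  open IntegerReflections
  open RealRootSpace
  open Orbits
  open Lines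
  open Schedules

  open import Data.Empty using (⊥; ⊥-elim)
  open import Data.Fin.Base using (Fin)
  open import Data.Fin.Properties using (_≟_)
  open import Data.Integer.Base as ℤ using (ℤ; +_; _+_; _*_; _-_; -_; _≤_; _<_; pred; +<+) renaming
      (suc to sucℤ)
  import Data.Integer.Properties as ℤ
  open import Data.Integer.Tactic.RingSolver using (solve-∀)
  open import Data.List.Base using (List; []; _∷_; reverse)
  open import Data.List.Relation.Binary.Permutation.Propositional.Properties using (↭-length)
  open import Data.Nat.Base as ℕ using (ℕ; zero; suc)
  import Data.Nat.Properties as ℕ
  open import Data.Product.Base using (_×_; _,_; proj₂; ∃-syntax)
  open import Data.Sum.Base using (_⊎_; inj₁; inj₂)
  open import Relation.Binary.Definitions using (Tri; tri<; tri≈; tri>)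
  open import Relation.Binary.PropositionalEquality hiding ([_])
  open import Relation.Nullary using (¬_; Dec; yes; no; contradiction)
  open import Relation.Unary using (Pred)

  <-by : ∀ k {x y} → x + + suc k ≡ y → x < y
  <-by k {x} refl = ℤ.≤-<-trans (ℤ.≤-reflexive (sym (ℤ.+-identityʳ x))) (ℤ.+-monoʳ-< x (+<+ (ℕ.s≤s ℕ.z≤n)))

  -- After a full period the bound is the same but the value has dropped by at least one, so
  -- induction on its distance above the bound ends in a contradiction. `P` is a relation and not a
  -- sequence of values because a left ray may change its token on the way.
  no-periodic-descent : ∀ {a} (P : ℕ → ℤ → Set a) (b : ℕ → ℤ) T →
    (∀ t → b (t ℕ.+ suc T) ≡ b t) →
    (∀ {t x} → P t x → b t ≤ x) →
    (∀ {t x} → P t x → ∃[ y ] P (suc t) y × y < x) →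
    ∀ {t x} → ¬ P t x
  no-periodic-descent P b T b-periodic bounded step {t} {x} p =
    within ℤ.∣ x - b t ∣ p (ℤ.≤-reflexive (trans (lemma x (b t))
      (cong (_+_ (b t)) (sym (ℤ.0≤i⇒+∣i∣≡i (ℤ.i≤j⇒0≤j-i (bounded p)))))))
    where
    lemma : ∀ x y → x ≡ y + (x - y)
    lemma = solve-∀

    steps : ∀ k {t x} → P t x → ∃[ y ] P (t ℕ.+ suc k) y × y < x
    steps zero {t} p with step p
    ... | y , p′ , y<x rewrite ℕ.+-comm t 1 = y , p′ , y<x
    steps (suc k) {t} p with step p
    ... | y , p′ , y<x with steps k p′
    ... | z , p″ , z<y rewrite ℕ.+-suc t (suc k) = z , p″ , ℤ.<-trans z<y y<x

    within : ∀ k {t x} → P t x → x ≤ b t + + k → ⊥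
    within zero    {t} p x≤ with step p
    ... | _ with steps T p
    ... | y , p′ , y<x = ℤ.<-irrefl refl (ℤ.<-≤-trans y<x
      (ℤ.≤-trans x≤ (ℤ.≤-trans (ℤ.≤-reflexive (trans (ℤ.+-identityʳ (b t)) (sym (b-periodic t))))
          (bounded p′))))
    within (suc k) {t} {x} p x≤ with steps T p
    ... | y , p′ , y<x = within k p′ (ℤ.≤-trans (ℤ.i<j⇒i≤pred[j] (ℤ.<-≤-trans y<x x≤))
      (ℤ.≤-reflexive (trans (lemma′ (b t) (+ k)) (cong (_+ + k) (sym (b-periodic t))))))
      where
      lemma′ : ∀ x k → - + 1 + (x + (+ 1 + k)) ≡ x + k
      lemma′ = solve-∀

  module _ {n} {M : CoxeterMatrix n} {K : CartanMatrix M} (ℓ : Line K) where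
    open CartanMatrix K
    open Line ℓ

    -- If the wall to the right of y is not labelled `i`, no gap is carried across it and it keeps y
    -- and z apart. Otherwise the next wall has another label and takes this role, unless z lies
    -- directly beyond the first wall.
    swap-< : ∀ {i y z} → y < z → swap i y < swap i z ⊎ z ≡ sucℤ y × wall y ≡ i
    swap-< {i} {y} {z} y<z = go (wall y ≟ i) (ℤ.<-cmp (sucℤ y) z)
      where
      go : Dec (wall y ≡ i) → Tri (sucℤ y < z) (sucℤ y ≡ z) (z < sucℤ y) → swap i y < swap i z ⊎ z ≡
          sucℤ y × wall y ≡ i
      go (no ≢i)  _             = inj₁ (ℤ.≤-<-trans (swap-≤ (≢-sym ≢i) ℤ.≤-refl) (swap-> (≢-sym ≢i) y<z))
      go (yes ≡i) (tri≈ _ eq _) = inj₂ (sym eq , ≡i)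
      go (yes ≡i) (tri< lt _ _) = inj₁ (ℤ.≤-<-trans (swap-≤ i≢ (ℤ.i≤suc[i] y)) (swap-> i≢ lt))
        where
        i≢ : i ≢ wall (sucℤ y)
        i≢ eq = wall-≢ y (trans ≡i eq)
      go (yes _)  (tri> _ _ gt) = contradiction (ℤ.i<j⇒suc[i]≤j y<z) (ℤ.<⇒≱ gt)

    module _ {p} (𝓛 : Pred (List (Fin n)) p) where
      open Toggling K 𝓛

      -- The tokens are numbered by their gaps at the identity element; x ≺ y says that the root
      -- corresponding to x and y lies in R(𝓛).
      infix 4 _≺_
      _≺_ : ℤ → ℤ → Set p
      x ≺ y = ∀ {w} → 𝓛 w → move w x < move w y

      InR-root⇒≺ : ∀ {x y} → x ≢ y → InR (root x y) → x ≺ y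
      InR-root⇒≺ {x} {y} x≢y inR {w} w∈𝓛 = ℤ.≤∧≢⇒<
        (NonNeg-root⇒≤ λ j → subst (+ 0 ≤_) (act-root w x y j) (inR w∈𝓛 j))
        (λ eq → x≢y (move-injective w eq))

      ≺⇒InR-root : ∀ {x y} → x ≺ y → InR (root x y)
      ≺⇒InR-root {x} {y} x≺y {w} w∈𝓛 j = subst (+ 0 ≤_) (sym (act-root w x y j))
          (≤⇒NonNeg-root (ℤ.<⇒≤ (x≺y w∈𝓛)) j)

      private
        inverse-e : ∀ u {z i} → wall z ≡ i → act (reverse u) (e i) ≗ root (move (reverse u) z)
            (move (reverse u) (sucℤ z))
        inverse-e u {z} refl j = trans (act-cong (reverse u) (λ k → sym (root-suc z k)) j)
            (act-root (reverse u) z (sucℤ z) j)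

      -- Pulling αᵢ back by `u` gives the pair of tokens at any one of the walls labelled `i`, so a
      -- blocked label orders the pairs at all these walls at once.
      blocked⇒≺ : ∀ {i u x y} → Blocked i u → wall (move u x) ≡ i → move u y ≡ sucℤ (move u x) → x ≺ y
      blocked⇒≺ {i} {u} {x} {y} blocked ≡i y-next = InR-root⇒≺
        (λ { refl → ℤ.i≢suc[i] {move u x} y-next })
        (InR-resp (λ j → trans (inverse-e u ≡i j) (cong₂ (λ a b → root a b j) (move-inverseˡ u x)
          (trans (cong (move (reverse u)) (sym y-next)) (move-inverseˡ u y)))) blocked)

      ≺⇒blocked : ∀ {i u x y} → x ≺ y → wall (move u x) ≡ i → move u y ≡ sucℤ (move u x) → Blocked i u
      ≺⇒blocked {i} {u} {x} {y} x≺y ≡i y-next =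
        InR-resp (λ j → sym (trans (inverse-e u ≡i j) (cong₂ (λ a b → root a b j) (move-inverseˡ u x)
          (trans (cong (move (reverse u)) (sym y-next)) (move-inverseˡ u y))))) (≺⇒InR-root x≺y)

      module _ {w₀} (w₀∈𝓛 : 𝓛 w₀) {i₀ is u} (orbit : Orbit (i₀ ∷ is) u)
               {N} (S : Schedule n N) (scheduled : ∀ t → ∃[ q ] rotateBy t (i₀ ∷ is) ≡ Schedule.next S
                   t ∷ q) where
        open Orbit orbit
        open Schedule S

        ≺-irrefl : ∀ {x} → ¬ x ≺ x
        ≺-irrefl x≺x = ℤ.<-irrefl refl (x≺x w₀∈𝓛)

        ≺-trans : ∀ {x y z} → x ≺ y → y ≺ z → x ≺ z
        ≺-trans x≺y y≺z w∈𝓛 = ℤ.<-trans (x≺y w∈𝓛) (y≺z w∈𝓛)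

        pos : ℕ → ℤ → ℤ
        pos t = move (state t)

        pos-periodic : ∀ t x → pos (t ℕ.+ suc T) x ≡ pos t x
        pos-periodic t = move-~ (periodic t)

        pos-injective : ∀ t {x y} → pos t x ≡ pos t y → x ≡ y
        pos-injective t = move-injective (state t)

        data Step t : Set p where
          blocked : Blocked (next t) (state t) → (∀ x → pos (suc t) x ≡ pos t x) → Step t
          moved   : ¬ Blocked (next t) (state t) → (∀ x → pos (suc t) x ≡ swap (next t) (pos t x)) → Step t

        step : ∀ t → Step t
        step t with toggle t (proj₂ (scheduled t))
        ... | inj₁ (b , ~u)   = blocked b (move-~ ~u)
        ... | inj₂ (¬b , ~iu) = moved ¬b (move-~ ~iu)

        sorted-step : ∀ t {x y} → x ≺ y → pos t x < pos t y → pos (suc t) x < pos (suc t) y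
        sorted-step t {x} {y} x≺y x<y with step t
        ... | blocked _ eq rewrite eq x | eq y = x<y
        ... | moved ¬b eq rewrite eq x | eq y with swap-< {next t} x<y
        ...   | inj₁ lt          = lt
        ...   | inj₂ (y-next , ≡i) = ⊥-elim (¬b (≺⇒blocked {u = state t} {x} {y} x≺y ≡i y-next))

        sorted-steps : ∀ k t {x y} → x ≺ y → pos t x < pos t y → pos (k ℕ.+ t) x < pos (k ℕ.+ t) y
        sorted-steps zero    t x≺y x<y = x<y
        sorted-steps (suc k) t x≺y x<y = sorted-step (k ℕ.+ t) x≺y (sorted-steps k t x≺y x<y)

        Inverted : ℕ → ℤ → ℤ → Set p
        Inverted t x y = x ≺ y × pos t y < pos t x

        inverted-step : ∀ t {x y} → Inverted t x y → Inverted (suc t) x y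
        inverted-step t {x} {y} (x≺y , y<x) with ℤ.<-cmp (pos (suc t) y) (pos (suc t) x)
        ... | tri< lt _ _ = x≺y , lt
        ... | tri≈ _ eq _ with refl ← pos-injective (suc t) eq = ⊥-elim (≺-irrefl x≺y)
        ... | tri> _ _ gt = ⊥-elim (ℤ.<-asym y<x
            (subst₂ _<_ (back x) (back y) (sorted-steps T (suc t) x≺y gt)))
          where
          back : ∀ x → pos (T ℕ.+ suc t) x ≡ pos t x
          back x = trans (cong (λ s → pos s x) (trans (ℕ.+-suc T t) (ℕ.+-comm (suc T) t)))
              (pos-periodic t x)

        left right : ℕ → ℤ → Fin n
        left  t x = wall (pred (pos t x))
        right t x = wall (pos t x)

        left≢right : ∀ t x → left t x ≢ right t x
        left≢right t x eq = wall-≢ (pred (pos t x)) (trans eq (cong wall (sym (ℤ.suc-pred (pos t x)))))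

        pos-fixed : ∀ t x → next t ≢ left t x → next t ≢ right t x → pos (suc t) x ≡ pos t x
        pos-fixed t x ≢l ≢r with step t
        ... | blocked _ eq = eq x
        ... | moved _ eq   = trans (eq x) (swap-fix (≢-sym ≢r) (≢-sym ≢l))

        N₁ : ℤ
        N₁ = + suc N

        -- A token whose left wall comes before its right wall is pushed to the left: it passes its left
        -- wall or, if this is blocked, hands over to the token on the other side, which is even
        -- smaller in the order ≺.
        data LeftRay (y : ℤ) (t : ℕ) : ℤ → Set p where
          ray : ∀ {x} → Inverted t x y → wait t (left t x) ℕ.< wait t (right t x) →
                LeftRay y t (N₁ * pos t x + + wait t (left t x))

        private
          wait< : ∀ t {j} → next t ≢ j → wait (suc t) j ℕ.< N
          wait< t {j} ≢j = subst (ℕ._≤ N) (wait-step t ≢j) (wait-≤ t j)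

          slack : ∀ t j → ∃[ d ] wait t j ℕ.+ d ≡ N
          slack t j = N ℕ.∸ wait t j , ℕ.m+[n∸m]≡n (wait-≤ t j)

          -- Crossing a wall costs more than any waiting time.
          jump : ∀ t j x c → N₁ * (x - + 1) + + wait t j < N₁ * x + + c
          jump t j x c with slack t j
          ... | d , eq = <-by (d ℕ.+ c) (begin
              N₁ * (x - + 1) + + wait t j + + suc (d ℕ.+ c)
                ≡⟨ lemma N₁ x (+ wait t j) (+ d) (+ c) ⟩
              N₁ * x - N₁ + (+ 1 + (+ wait t j + + d)) + + c
                ≡⟨ cong (λ s → N₁ * x - N₁ + (+ suc s) + + c) eq ⟩
              N₁ * x - N₁ + N₁ + + c
                ≡⟨ lemma′ (N₁ * x) N₁ (+ c) ⟩
              N₁ * x + + c ∎)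
            where
            open ≡-Reasoning
            lemma : ∀ m x w d c → m * (x - + 1) + w + (+ 1 + (d + c)) ≡ m * x - m + (+ 1 + (w + d)) + c
            lemma = solve-∀
            lemma′ : ∀ a m c → a - m + m + c ≡ a + c
            lemma′ = solve-∀

          pred-minus : ∀ x → pred x ≡ x - + 1
          pred-minus x = ℤ.+-comm (- + 1) x

          LeftRay-bound : ∀ {y t μ} → LeftRay y t μ → N₁ * pos t y ≤ μ
          LeftRay-bound {y} {t} (ray {x} (_ , y<x) _) = ℤ.≤-trans (ℤ.*-monoˡ-≤-nonNeg N₁ (ℤ.<⇒≤ y<x))
            (ℤ.i≤i+j (N₁ * pos t x) (+ wait t (left t x)))

          -- The wall just toggled is now the right wall and stands at the back of the queue, with
          -- the maximal wait `N`. The left wall has a different label and waits less, so the ray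
          -- goes on, whether the token moved or was replaced.
          LeftRay-cross : ∀ {y t x x′} → next t ≡ left t x → Inverted (suc t) x′ y → pos (suc t) x′ ≡
              pred (pos t x) →
                          ∃[ μ ] LeftRay y (suc t) μ × μ < N₁ * pos t x + + wait t (left t x)
          LeftRay-cross {y} {t} {x} {x′} i≡l inv eq = _ , ray inv waits ,
            subst (λ z → N₁ * z + + wait (suc t) (left (suc t) x′) < N₁ * pos t x + + wait t (left t x))
              (sym (trans eq (pred-minus (pos t x))))
                  (jump (suc t) (left (suc t) x′) (pos t x) (wait t (left t x)))
            where
            right≡ : right (suc t) x′ ≡ next t
            right≡ = trans (cong wall eq) (sym i≡l)
            waits : wait (suc t) (left (suc t) x′) ℕ.< wait (suc t) (right (suc t) x′)
            waits = subst (wait (suc t) (left (suc t) x′) ℕ.<_)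
                (sym (trans (cong (wait (suc t)) right≡) (wait-last t)))
              (wait< t λ i≡ → left≢right (suc t) x′ (trans (sym i≡) (sym right≡)))

          LeftRay-step : ∀ {y t μ} → LeftRay y t μ → ∃[ ν ] LeftRay y (suc t) ν × ν < μ
          LeftRay-step {y} {t} (ray {x} inv@(x≺y , y<x) l<r) with next t ≟ left t x
          ... | yes i≡l = cross (step t)
            where
            x₁ : ℤ
            x₁ = move (reverse (state t)) (pred (pos t x))
            pos-x₁ : pos t x₁ ≡ pred (pos t x)
            pos-x₁ = move-inverseʳ (state t) (pred (pos t x))
            cross : Step t → _
            cross (blocked b eq) = LeftRay-cross i≡l (x₁≺y , y<x₁) (trans (eq x₁) pos-x₁)
              where
              x₁≺y : x₁ ≺ y
              x₁≺y = ≺-trans (blocked⇒≺ {u = state t} b (trans (cong wall pos-x₁) (sym i≡l))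
                (trans (sym (ℤ.suc-pred (pos t x))) (cong sucℤ (sym pos-x₁)))) x≺y
              y<x₁ : pos (suc t) y < pos (suc t) x₁
              -- If the gap beyond the wall were occupied by y, then x₁ would be y, against
              -- irreflexivity of `≺`.
              y<x₁ rewrite eq y | eq x₁ = ℤ.≤∧≢⇒< (subst (pos t y ≤_) (sym pos-x₁) (ℤ.i<j⇒i≤pred[j] y<x))
                λ same → ≺-irrefl (subst (_≺ y) (sym (pos-injective t same)) x₁≺y)
            cross (moved _ eq) = LeftRay-cross i≡l (inverted-step t inv)
                (trans (eq x) (swap-left (sym i≡l)))
          ... | no i≢l = _ , ray (inverted-step t inv) waits , drop
            where
            i≢r : next t ≢ right t x
            i≢r i≡r = ℕ.n≮0 (subst (wait t (left t x) ℕ.<_)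
                (trans (cong (wait t) (sym i≡r)) (wait-next t)) l<r)
            fixed : pos (suc t) x ≡ pos t x
            fixed = pos-fixed t x i≢l i≢r
            waits : wait (suc t) (left (suc t) x) ℕ.< wait (suc t) (right (suc t) x)
            waits rewrite fixed = ℕ.≤-pred (subst₂ ℕ._<_ (wait-step t i≢l) (wait-step t i≢r) l<r)
            drop : N₁ * pos (suc t) x + + wait (suc t) (left (suc t) x) < N₁ * pos t x + + wait t (left t x)
            drop rewrite fixed | wait-step t i≢l =
              <-by 0 (lemma (N₁ * pos t x) (+ wait (suc t) (left t x)))
              where
              lemma : ∀ a w → a + w + + 1 ≡ a + (+ 1 + w)
              lemma = solve-∀

        no-LeftRay : ∀ {y t μ} → ¬ LeftRay y t μ
        no-LeftRay {y} = no-periodic-descent (LeftRay y) (λ t → N₁ * pos t y) T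
          (λ t → cong (_*_ N₁) (pos-periodic t y)) LeftRay-bound LeftRay-step

        -- An inverted token is therefore never pushed to the left; it moves to the right forever.
        data RightRay (x y : ℤ) (t : ℕ) : ℤ → Set p where
          ray : Inverted t x y → RightRay x y t (- (N₁ * pos t x) + + wait t (right t x))

        private
          RightRay-bound : ∀ {x y t μ} → RightRay x y t μ → - (N₁ * pos t x) ≤ μ
          RightRay-bound {x} {y} {t} (ray _) = ℤ.i≤i+j (- (N₁ * pos t x)) (+ wait t (right t x))

          RightRay-step : ∀ {x y t μ} → RightRay x y t μ → ∃[ ν ] RightRay x y (suc t) ν × ν < μ
          RightRay-step {x} {y} {t} (ray inv) with next t ≟ right t x
          ... | yes i≡r = cross (step t)
            where
            cross : Step t → _
            -- A blocked toggle still sends the right label to the back of the queue, so the left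
            -- wall is now due first and a left ray starts.
            cross (blocked _ eq) = ⊥-elim (no-LeftRay (ray (inverted-step t inv) waits))
              where
              waits : wait (suc t) (left (suc t) x) ℕ.< wait (suc t) (right (suc t) x)
              waits rewrite eq x = subst (wait (suc t) (left t x) ℕ.<_)
                  (sym (trans (cong (wait (suc t)) (sym i≡r)) (wait-last t)))
                (wait< t λ i≡l → left≢right t x (trans (sym i≡l) i≡r))
            cross (moved _ eq) = _ , ray (inverted-step t inv) ,
              subst₂ _<_ (cong (_+ + wait (suc t) (right (suc t) x)) (trans (lemma N₁ (pos t x))
                  (cong (λ z → - (N₁ * z)) (sym (trans (eq x) (swap-right (sym i≡r)))))))
                (cong (_+ + wait t (right t x)) (lemma′ N₁ (pos t x)))
                (jump (suc t) (right (suc t) x) (- pos t x) (wait t (right t x)))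
              where
              lemma : ∀ m z → m * (- z - + 1) ≡ - (m * (+ 1 + z))
              lemma = solve-∀
              lemma′ : ∀ m z → m * (- z) ≡ - (m * z)
              lemma′ = solve-∀
          ... | no i≢r = _ , ray (inverted-step t inv) , drop
            where
            i≢l : next t ≢ left t x
            -- If the left wall were due now, its wait would be zero and the right one positive:
            -- again a left ray.
            i≢l i≡l = no-LeftRay (ray inv (subst₂ ℕ._<_
                (sym (trans (cong (wait t) (sym i≡l)) (wait-next t)))
              (sym (wait-step t i≢r)) (ℕ.s≤s ℕ.z≤n)))
            drop : - (N₁ * pos (suc t) x) + + wait (suc t) (right (suc t) x) < - (N₁ * pos t x) + +
                wait t (right t x)
            drop rewrite pos-fixed t x i≢l i≢r | wait-step t i≢r =
              <-by 0 (lemma (- (N₁ * pos t x)) (+ wait (suc t) (right t x)))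
              where
              lemma : ∀ a w → a + w + + 1 ≡ a + (+ 1 + w)
              lemma = solve-∀

        no-inversion : ∀ {t x y} → ¬ Inverted t x y
        no-inversion {t} {x} {y} inv = no-periodic-descent (RightRay x y) (λ t → - (N₁ * pos t x)) T
          (λ t → cong (λ z → - (N₁ * z)) (pos-periodic t x)) RightRay-bound RightRay-step (ray {t = t} inv)

  line-futuristic : ∀ {n} {M : CoxeterMatrix (suc n)} {K : CartanMatrix M} → Line K → ∀ p →
      IntegrallyFuturistic K p
  line-futuristic ℓ p 𝓛 _ [] ordering with () ← ↭-length ordering
  line-futuristic {K = K} ℓ p 𝓛 (_ , w₀∈𝓛) (i ∷ is) ordering u orbit x k inR j
    with S , scheduled ← queueSchedule ordering
       | z , refl ← Line.wall-onto ℓ k =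
    subst (+ 0 ≤_) (sym (trans (act-cong u root-at j) (act-root u a b j))) (≤⇒NonNeg-root (ℤ.≮⇒≥ sorted) j)
    where
    open CartanMatrix K
    open Line ℓ
    open Toggling K 𝓛 using (InR-resp; module Orbit)
    a b : ℤ
    a = move x z
    b = move x (sucℤ z)
    root-at : act x (e (wall z)) ≗ root a b
    root-at j = trans (act-cong x (λ k → sym (root-suc z k)) j) (act-root x z (sucℤ z) j)
    a≢b : a ≢ b
    a≢b eq = ℤ.i≢suc[i] {z} (move-injective x eq)
    sorted : ¬ move u b < move u a
    sorted b<a = no-inversion ℓ 𝓛 w₀∈𝓛 orbit S scheduled {t = 0}
      (InR-root⇒≺ ℓ 𝓛 a≢b (InR-resp root-at inR) ,
       subst (λ v → move v b < move v a) (sym (Orbit.state-0 orbit)) b<a)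

-- Lines of walls for types Ã and C̃

module AffineLines where

  open IntegerReflections
  open Lines

  open import Data.Bool.Base using (Bool; true; false; if_then_else_; _∧_; _∨_)
  open import Data.Fin.Base using (Fin; zero; suc; toℕ; fromℕ<)
  open import Data.Fin.Properties using (_≟_; toℕ-injective; toℕ<n; toℕ-fromℕ<)
  open import Data.Integer.Base as ℤ using (ℤ; +_; -[1+_]; -_; pred) renaming (suc to sucℤ)
  import Data.Integer.Properties as ℤ
  open import Data.Nat.Base as ℕ using (ℕ; zero; suc; _≡ᵇ_; z≤n; s≤s)
  import Data.Nat.Properties as ℕ
  open import Data.Product.Base using (_×_; _,_; ∃-syntax)
  open import Data.Sum.Base using (_⊎_; inj₁; inj₂)
  open import Relation.Binary.Construct.Add.Supremum.NonStrict ℕ._≤_ using (_≤⁺_)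
  open import Relation.Binary.Definitions using (tri<; tri≈; tri>)
  open import Relation.Binary.PropositionalEquality hiding ([_])
  open import Relation.Nullary using (does; yes; no; contradiction)
  open import Relation.Nullary.Construct.Add.Supremum using (_⁺; ⊤⁺; [_])

  ≡ᵇ-refl : ∀ a → (a ≡ᵇ a) ≡ true
  ≡ᵇ-refl zero    = refl
  ≡ᵇ-refl (suc a) = ≡ᵇ-refl a

  ≢⇒≡ᵇ-false : ∀ {a b} → a ≢ b → (a ≡ᵇ b) ≡ false
  ≢⇒≡ᵇ-false {zero}  {zero}  a≢b = contradiction refl a≢b
  ≢⇒≡ᵇ-false {zero}  {suc b} a≢b = refl
  ≢⇒≡ᵇ-false {suc a} {zero}  a≢b = refl
  ≢⇒≡ᵇ-false {suc a} {suc b} a≢b = ≢⇒≡ᵇ-false {a} {b} λ { refl → a≢b refl }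

  𝟙 : Bool → ℤ
  𝟙 b = if b then + 1 else + 0

  does-≟ : ∀ {n} (i j : Fin n) → does (i ≟ j) ≡ (toℕ i ≡ᵇ toℕ j)
  does-≟ zero    zero    = refl
  does-≟ zero    (suc j) = refl
  does-≟ (suc i) zero    = refl
  does-≟ (suc i) (suc j) = does-≟ i j

  -- Walls are generated by a reversible machine instead of by division with remainder. A state can
  -- hold what the label does not show, such as the direction of travel.
  module Iteration {State : Set} (next prev : State → State) (start : State) where
    iterate : ℤ → State
    iterate (+ zero)     = start
    iterate (+ suc k)    = next (iterate (+ k))
    iterate -[1+ zero ]  = prev start
    iterate -[1+ suc k ] = prev (iterate -[1+ k ])

  -- A sequence of walls with labels 0, …, N in which both neighbours of a wall depend on its
  -- label only, up to exchanging the two.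
  module Neighbours (left right : ℕ → ℕ) where

    cartan : ℕ → ℕ → ℤ
    cartan a b = if a ≡ᵇ b then + 2 else - (𝟙 (left b ≡ᵇ a) ℤ.+ 𝟙 (right b ≡ᵇ a))

    cartan-≢ : ∀ {a b} → a ≢ b → cartan a b ≡ - (𝟙 (left b ≡ᵇ a) ℤ.+ 𝟙 (right b ≡ᵇ a))
    cartan-≢ a≢b rewrite ≢⇒≡ᵇ-false a≢b = refl

    module _ {N} {ℓ : ℕ → ℕ → ℕ ⁺} {2≤ℓ : ∀ i j → [ 2 ] ≤⁺ ℓ i j} {X} (isLong : ℕ → Bool)
             (rank2 : ∀ {a b} → a ℕ.< b → b ℕ.≤ N → Rank2 X (ℓ a b) (cartan a b) (cartan b a)
                 (isLong a) (isLong b)) where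
      private
        M : CoxeterMatrix (suc N)
        M = fromLabels (suc N) ℓ 2≤ℓ
        open CoxeterMatrix M

        m-< : ∀ {i j} → toℕ i ℕ.< toℕ j → m i j ≡ ℓ (toℕ i) (toℕ j)
        m-< {i} {j} i<j with i ≟ j
        ... | yes refl = contradiction i<j (ℕ.n≮n _)
        ... | no  _    = cong₂ ℓ (ℕ.m≤n⇒m⊓n≡m (ℕ.<⇒≤ i<j)) (ℕ.m≤n⇒m⊔n≡n (ℕ.<⇒≤ i<j))

        rank2-< : ∀ {i j} → toℕ i ℕ.< toℕ j →
          Rank2 X (m i j) (cartan (toℕ i) (toℕ j)) (cartan (toℕ j) (toℕ i)) (isLong (toℕ i))
              (isLong (toℕ j))
        rank2-< {i} {j} i<j rewrite m-< {i} {j} i<j = rank2 i<j (ℕ.≤-pred (toℕ<n j))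

        rank2-≢ : ∀ i j → i ≢ j →
          Rank2 X (m i j) (cartan (toℕ i) (toℕ j)) (cartan (toℕ j) (toℕ i)) (isLong (toℕ i))
              (isLong (toℕ j))
        rank2-≢ i j i≢j with ℕ.<-cmp (toℕ i) (toℕ j)
        ... | tri< lt _ _ = rank2-< lt
        ... | tri≈ _ eq _ = contradiction (toℕ-injective eq) i≢j
        ... | tri> _ _ gt rewrite m-sym i j = Rank2-sym (rank2-< gt)

      cartanMatrix : CartanMatrix M
      cartanMatrix = record
        { C       = λ i j → cartan (toℕ i) (toℕ j)
        ; long    = λ i → isLong (toℕ i)
        ; lacing  = X
        ; C-diag  = λ i → cong (λ b → if b then + 2 else -
            (𝟙 (left (toℕ i) ≡ᵇ toℕ i) ℤ.+ 𝟙 (right (toℕ i) ≡ᵇ toℕ i))) (≡ᵇ-refl (toℕ i))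
        ; C-rank2 = rank2-≢
        }

      module _ (State : Set) (next prev : State → State) (next-prev : ∀ s → next (prev s) ≡ s)
               (prev-next : ∀ s → prev (next s) ≡ s) (start : State) (at : State → ℕ)
                   (at< : ∀ s → at s ℕ.< suc N)
               (sides : ∀ s → (at (prev s) ≡ left (at s) × at (next s) ≡ right (at s)) ⊎
                              (at (prev s) ≡ right (at s) × at (next s) ≡ left (at s)))
               (next-≢ : ∀ s → at s ≢ at (next s)) where

        open Iteration next prev start

        private
          iterate-suc : ∀ z → iterate (sucℤ z) ≡ next (iterate z)
          iterate-suc (+ k)        = refl
          iterate-suc -[1+ zero ]  = sym (next-prev start)
          iterate-suc -[1+ suc k ] = sym (next-prev (iterate -[1+ k ]))

          iterate-pred : ∀ z → iterate (pred z) ≡ prev (iterate z)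
          iterate-pred z = trans (sym (prev-next (iterate (pred z))))
            (cong prev (trans (sym (iterate-suc (pred z))) (cong iterate (ℤ.suc-pred z))))

          wall : ℤ → Fin (suc N)
          wall z = fromℕ< (at< (iterate z))

          toℕ-wall : ∀ z → toℕ (wall z) ≡ at (iterate z)
          toℕ-wall z = toℕ-fromℕ< (at< (iterate z))

        module _ (onto : ∀ l → l ℕ.≤ N → at (iterate (+ l)) ≡ l)
                 (third : ∀ i j {k} → i ≢ j → m i j ≡ [ k ] → ∃[ l ] (i ≢ l × j ≢ l)) where
          private
            open CartanMatrix cartanMatrix using (e)

            onto′ : ∀ i → wall (+ toℕ i) ≡ i
            onto′ i = toℕ-injective (trans (toℕ-wall (+ toℕ i)) (onto (toℕ i) (ℕ.≤-pred (toℕ<n i))))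

            e-wall : ∀ z i → e (wall z) i ≡ 𝟙 (at (iterate z) ≡ᵇ toℕ i)
            e-wall z i = cong 𝟙 (trans (does-≟ (wall z) i) (cong (_≡ᵇ toℕ i) (toℕ-wall z)))

            neighbours : ∀ i z → i ≢ wall z →
              cartan (toℕ i) (toℕ (wall z)) ≡ - (e (wall (pred z)) i ℤ.+ e (wall (sucℤ z)) i)
            neighbours i z i≢
              rewrite e-wall (pred z) i | e-wall (sucℤ z) i | iterate-suc z | iterate-pred z
                    | cartan-≢ {toℕ i} {toℕ (wall z)} (λ eq → i≢ (toℕ-injective eq)) | toℕ-wall z
              with sides (iterate z)
            ... | inj₁ (p , q) rewrite p | q = refl
            ... | inj₂ (p , q) rewrite p | q =
              cong -_ (ℤ.+-comm (𝟙 (left (at (iterate z)) ≡ᵇ toℕ i)) (𝟙 (right (at (iterate z)) ≡ᵇ toℕ i)))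

          line : Line cartanMatrix
          line = record
            { wall       = wall
            ; wall-≢     = λ z eq → next-≢ (iterate z) (trans (sym (toℕ-wall z)) (trans (cong toℕ eq)
                             (trans (toℕ-wall (sucℤ z)) (cong at (iterate-suc z)))))
            ; neighbours = neighbours
            ; wall-onto  = λ i → + toℕ i , onto′ i
            ; third-wall = λ i j i≢j eq → let (l , i≢l , j≢l) = third i j i≢j eq in
                             + toℕ l , (λ i≡ → i≢l (trans i≡ (onto′ l))) , (λ j≡ → j≢l (trans j≡ (onto′ l)))
            }

  third-label : ∀ {k} (i j : Fin (3 ℕ.+ k)) → ∃[ l ] (i ≢ l × j ≢ l)
  third-label zero          zero          = suc zero , (λ ()) , (λ ())
  third-label zero          (suc zero)    = suc (suc zero) , (λ ()) , (λ ())
  third-label zero          (suc (suc j)) = suc zero , (λ ()) , (λ ())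
  third-label (suc zero)    zero          = suc (suc zero) , (λ ()) , (λ ())
  third-label (suc (suc i)) zero          = suc zero , (λ ()) , (λ ())
  third-label (suc i)       (suc j)       = zero , (λ ()) , (λ ())

  private
    𝟙-≢ : ∀ {a b} → a ≢ b → 𝟙 (a ≡ᵇ b) ≡ + 0
    𝟙-≢ a≢b = cong 𝟙 (≢⇒≡ᵇ-false a≢b)

  -- Labels are read modulo the number of vertices, which gives the classical affine permutations:
  -- generator i exchanges z and z + 1 for all z congruent to i.
  module Cyclic (k : ℕ) where
    private
      N : ℕ
      N = 2 ℕ.+ k

      left right : ℕ → ℕ
      left zero    = N
      left (suc b) = b
      right b = if b ≡ᵇ N then 0 else suc b

      open Neighbours left right

      ℓ : ℕ → ℕ → ℕ ⁺
      ℓ i j = [ 2 ℕ.+ (if (j ≡ᵇ suc i) ∨ ((i ≡ᵇ 0) ∧ (suc j ≡ᵇ suc N)) then 1 else 0) ]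

      right-< : ∀ {a} → a ≢ N → right a ≡ suc a
      right-< a≢N rewrite ≢⇒≡ᵇ-false a≢N = refl

      right-N : right N ≡ 0
      right-N rewrite ≡ᵇ-refl N = refl

      right-≢ : ∀ {a b} → a ℕ.< b → a ≢ 0 → right b ≢ a
      right-≢ {a} {b} a<b a≢0 eq with b ℕ.≟ N
      ... | yes refl = a≢0 (trans (sym eq) right-N)
      ... | no b≢N   = ℕ.<⇒≢ (ℕ.m<n⇒m<1+n a<b) (sym (trans (sym (right-< b≢N)) eq))

      bond : ∀ a b → a ℕ.< suc b → Rank2 double (ℓ a (suc b))
        (- (𝟙 (b ≡ᵇ a) ℤ.+ 𝟙 (right (suc b) ≡ᵇ a))) (- (𝟙 (left a ≡ᵇ suc b) ℤ.+ 𝟙 (a ≡ᵇ b))) true true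
      bond a b a<1+b with a ℕ.≟ b
      bond zero    zero    _     | yes refl = simple
      bond (suc c) (suc c) a<1+b | yes refl
        rewrite ≡ᵇ-refl c | 𝟙-≢ (right-≢ {suc c} {2 ℕ.+ c} ℕ.≤-refl λ ())
              | 𝟙-≢ {c} {2 ℕ.+ c} (ℕ.<⇒≢ (ℕ.m≤n⇒m≤1+n ℕ.≤-refl)) = simple
      bond zero    b       _     | no a≢b with b ℕ.≟ suc k
      -- The closing edge of the cycle, between the labels 0 and `N`.
      ... | yes refl rewrite ≡ᵇ-refl k = simple
      ... | no b≢ rewrite ≢⇒≡ᵇ-false b≢ | ≢⇒≡ᵇ-false (≢-sym a≢b) | 𝟙-≢ {suc k} {b} (≢-sym b≢) | 𝟙-≢ {0}
          {b} a≢b = commuting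
      bond (suc c) b       a<1+b | no a≢b
        rewrite ≢⇒≡ᵇ-false (≢-sym a≢b) | 𝟙-≢ a≢b | 𝟙-≢ (right-≢ {suc c} {suc b} a<1+b λ ())
              | 𝟙-≢ {c} {suc b} (ℕ.<⇒≢ (ℕ.<-trans (ℕ.n<1+n c) a<1+b)) = commuting

      rank2 : ∀ {a b} → a ℕ.< b → b ℕ.≤ N → Rank2 double (ℓ a b) (cartan a b) (cartan b a) true true
      rank2 {a} {suc b} a<1+b 1+b≤N
        rewrite cartan-≢ {a} {suc b} (ℕ.<⇒≢ a<1+b) | cartan-≢ {suc b} {a} (≢-sym (ℕ.<⇒≢ a<1+b))
              | right-< {a} (ℕ.<⇒≢ (ℕ.<-≤-trans a<1+b 1+b≤N)) = bond a b a<1+b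

    cycleCartan : CartanMatrix (cycle (3 ℕ.+ k))
    cycleCartan = cartanMatrix (λ _ → true) rank2

    private
      record State : Set where
        constructor state
        field
          at rest : ℕ
          at+rest : at ℕ.+ rest ≡ N

      state-≡ : ∀ {a b p q} → state a b p ≡ state a b q
      state-≡ {a} {b} {p} {q} = cong (state a b) (ℕ.≡-irrelevant p q)

      next prev : State → State
      next (state a zero    p) = state 0 a (trans (sym (ℕ.+-identityʳ a)) p)
      next (state a (suc b) p) = state (suc a) b (trans (sym (ℕ.+-suc a b)) p)
      prev (state zero    b p) = state b 0 (trans (ℕ.+-identityʳ b) p)
      prev (state (suc a) b p) = state a (suc b) (trans (ℕ.+-suc a b) p)

      next-prev : ∀ s → next (prev s) ≡ s
      next-prev (state zero    b p) = state-≡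
      next-prev (state (suc a) b p) = state-≡

      prev-next : ∀ s → prev (next s) ≡ s
      prev-next (state a zero    p) = state-≡
      prev-next (state a (suc b) p) = state-≡

      sides : ∀ s → State.at (prev s) ≡ left (State.at s) × State.at (next s) ≡ right (State.at s)
      sides s = sideˡ s , sideʳ s
        where
        sideˡ : ∀ s → State.at (prev s) ≡ left (State.at s)
        sideˡ (state zero    b p) = p
        sideˡ (state (suc a) b p) = refl
        sideʳ : ∀ s → State.at (next s) ≡ right (State.at s)
        sideʳ (state a zero    p) = sym (trans (cong right (trans (sym (ℕ.+-identityʳ a)) p)) right-N)
        sideʳ (state a (suc b) p) = sym
            (right-< (ℕ.<⇒≢ (ℕ.≤-trans (ℕ.m≤m+n (suc a) b) (ℕ.≤-reflexive (trans (sym (ℕ.+-suc a b)) p)))))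

      next-≢ : ∀ s → State.at s ≢ State.at (next s)
      next-≢ (state zero    zero    ())
      next-≢ (state (suc a) zero    p) ()
      next-≢ (state a       (suc b) p) eq = ℕ.1+n≢n (sym eq)

      at< : ∀ s → State.at s ℕ.< suc N
      at< (state a b p) = s≤s (ℕ.≤-trans (ℕ.m≤m+n a b) (ℕ.≤-reflexive p))

    cycleLine : Line cycleCartan
    cycleLine = line (λ _ → true) rank2 State next prev next-prev prev-next start State.at at<
      (λ s → inj₁ (sides s)) next-≢ (λ l l≤N → cong State.at (onto l (N ℕ.∸ l) (ℕ.m+[n∸m]≡n l≤N)))
      (λ i j _ _ → third-label i j)
      where
      start : State
      start = state 0 N refl
      onto : ∀ l b (p : l ℕ.+ b ≡ N) → Iteration.iterate next prev start (+ l) ≡ state l b p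
      onto zero    b refl = refl
      onto (suc l) b p    = trans (cong next (onto l (suc b) (trans (ℕ.+-suc l b) p))) state-≡

  -- The labels along the line read …, 2, 1, 0, 1, 2, …, N - 1, N, N - 1, ….
  module Zigzag (K : ℕ) where
    N : ℕ
    N = suc K

    left right : ℕ → ℕ
    left zero    = 1
    left (suc b) = b
    right b = if b ≡ᵇ N then K else suc b

    open Neighbours left right public

    right-< : ∀ {a} → a ≢ N → right a ≡ suc a
    right-< a≢N rewrite ≢⇒≡ᵇ-false a≢N = refl

    right-N : right N ≡ K
    right-N rewrite ≡ᵇ-refl K = refl

    -- A wall together with the direction in which its label has just changed.
    data State : Set where
      up   : ∀ a b → suc a ℕ.+ b ≡ N → State
      down : ∀ a b → a ℕ.+ suc b ≡ N → State

    at : State → ℕ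
    at (up a b p)   = suc a
    at (down a b p) = a

    private
      up-≡ : ∀ {a b p q} → up a b p ≡ up a b q
      up-≡ {a} {b} {p} {q} = cong (up a b) (ℕ.≡-irrelevant p q)

      down-≡ : ∀ {a b p q} → down a b p ≡ down a b q
      down-≡ {a} {b} {p} {q} = cong (down a b) (ℕ.≡-irrelevant p q)

    next prev : State → State
    next (up a zero    p)    = down a 0 (trans (ℕ.+-suc a 0) p)
    next (up a (suc b) p)    = up (suc a) b (trans (cong suc (sym (ℕ.+-suc a b))) p)
    next (down zero b p)     = up 0 b p
    next (down (suc a) b p)  = down a (suc b) (trans (ℕ.+-suc a (suc b)) p)
    prev (up zero b p)       = down 0 b p
    prev (up (suc a) b p)    = up a (suc b) (trans (cong suc (ℕ.+-suc a b)) p)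
    prev (down a zero p)     = up a 0 (trans (sym (ℕ.+-suc a 0)) p)
    prev (down a (suc b) p)  = down (suc a) b (trans (sym (ℕ.+-suc a (suc b))) p)

    next-prev : ∀ s → next (prev s) ≡ s
    next-prev (up zero b p)      = up-≡
    next-prev (up (suc a) b p)   = up-≡
    next-prev (down a zero p)    = down-≡
    next-prev (down a (suc b) p) = down-≡

    prev-next : ∀ s → prev (next s) ≡ s
    prev-next (up a zero    p)   = up-≡
    prev-next (up a (suc b) p)   = up-≡
    prev-next (down zero b p)    = down-≡
    prev-next (down (suc a) b p) = down-≡

    private
      rest : ∀ {a b} → a ℕ.+ suc b ≡ N → a ≢ N
      rest {a} {b} p = ℕ.<⇒≢ (ℕ.≤-trans (ℕ.m≤m+n (suc a) b) (ℕ.≤-reflexive (trans (sym (ℕ.+-suc a b)) p)))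

      top : ∀ {a} → suc a ℕ.+ 0 ≡ N → right (suc a) ≡ a
      top {a} p = trans (cong right p′) (trans right-N (sym (ℕ.suc-injective p′)))
        where
        p′ : suc a ≡ N
        p′ = trans (sym (ℕ.+-identityʳ (suc a))) p

    sides : ∀ s → (at (prev s) ≡ left (at s) × at (next s) ≡ right (at s)) ⊎
                  (at (prev s) ≡ right (at s) × at (next s) ≡ left (at s))
    sides (up zero    zero    p) = inj₁ (refl , sym (top p))
    sides (up (suc a) zero    p) = inj₁ (refl , sym (top p))
    sides (up zero    (suc b) p) = inj₁ (refl , sym (right-< (rest p)))
    sides (up (suc a) (suc b) p) = inj₁ (refl , sym (right-< (rest p)))
    sides (down zero    zero    p) = inj₂ (sym (right-< (rest p)) , refl)
    sides (down (suc a) zero    p) = inj₂ (sym (right-< (rest p)) , refl)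
    sides (down zero    (suc b) p) = inj₂ (sym (right-< (rest p)) , refl)
    sides (down (suc a) (suc b) p) = inj₂ (sym (right-< (rest p)) , refl)

    next-≢ : ∀ s → at s ≢ at (next s)
    next-≢ (up a zero    p)   eq = ℕ.1+n≢n eq
    next-≢ (up a (suc b) p)   eq = ℕ.1+n≢n (sym eq)
    next-≢ (down zero b p)    ()
    next-≢ (down (suc a) b p) eq = ℕ.1+n≢n eq

    at< : ∀ s → at s ℕ.< suc N
    at< (up a b p)   = s≤s (ℕ.≤-trans (ℕ.m≤m+n (suc a) b) (ℕ.≤-reflexive p))
    at< (down a b p) = s≤s (ℕ.≤-trans (ℕ.m≤m+n a (suc b)) (ℕ.≤-reflexive p))

    start : State
    start = down 0 K refl

    module _ {ℓ : ℕ → ℕ → ℕ ⁺} {2≤ℓ : ∀ i j → [ 2 ] ≤⁺ ℓ i j} {X} (isLong : ℕ → Bool)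
             (rank2 : ∀ {a b} → a ℕ.< b → b ℕ.≤ N → Rank2 X (ℓ a b) (cartan a b) (cartan b a)
                 (isLong a) (isLong b)) where
      private
        M : CoxeterMatrix (suc N)
        M = fromLabels (suc N) ℓ 2≤ℓ

        open Iteration next prev start

        climb : ∀ a b (p : suc a ℕ.+ b ≡ N) → iterate (+ suc a) ≡ up a b p
        climb zero    b refl = refl
        climb (suc a) b p    = trans (cong next (climb a (suc b) (trans (cong suc (ℕ.+-suc a b)) p))) up-≡

        onto : ∀ l → l ℕ.≤ N → at (iterate (+ l)) ≡ l
        onto zero    _   = refl
        onto (suc a) l≤N = cong at (climb a (N ℕ.∸ suc a) (ℕ.m+[n∸m]≡n l≤N))

      zigzagLine : (∀ i j {k} → i ≢ j → CoxeterMatrix.m M i j ≡ [ k ] → ∃[ l ] (i ≢ l × j ≢ l)) →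
                   Line (cartanMatrix {N} {ℓ} {2≤ℓ} isLong rank2)
      zigzagLine = line isLong rank2 State next prev next-prev prev-next start at at< sides next-≢ onto

  -- The zigzag with two labels alternates. Both neighbours of a wall carry the other label, whence
  -- the Cartan integers -2 of the infinite dihedral group.
  module Segment where
    open Zigzag 0

    private
      rank2 : ∀ {a b} → a ℕ.< b → b ℕ.≤ 1 → Rank2 double ⊤⁺ (cartan a b) (cartan b a) true true
      rank2 {zero} {suc zero} (s≤s z≤n) (s≤s z≤n) = infinite

    segmentCartan : CartanMatrix (coxeterMatrix A~₁)
    segmentCartan = cartanMatrix (λ _ → true) rank2

    segmentLine : Line segmentCartan
    segmentLine = zigzagLine (λ _ → true) rank2 third
      where
      -- Distinct labels have m = ∞, which is never `[ k ]`, so only the pairs of equal labels need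
      -- a clause.
      third : ∀ (i j : Fin 2) {k} → i ≢ j → CoxeterMatrix.m (coxeterMatrix A~₁) i j ≡ [ k ] → ∃[ l ]
          (i ≢ l × j ≢ l)
      third zero       zero       i≢j _ = contradiction refl i≢j
      third (suc zero) (suc zero) i≢j _ = contradiction refl i≢j

  -- The zigzag is symmetric about every wall labelled 0 or `N`; it is a folded cycle of 2`N` walls.
  -- The two neighbours of an end wall carry the same label, which makes the end roots long.
  module Path (k : ℕ) where
    open Zigzag (suc k)

    private
      edge : ℕ → ℕ
      edge i = if (i ≡ᵇ 0) ∨ (i ≡ᵇ suc k) then 1 else 0

      ℓ : ℕ → ℕ → ℕ ⁺
      ℓ i j = [ 2 ℕ.+ (if j ≡ᵇ suc i then suc (edge i) else 0) ]

      isLong : ℕ → Bool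
      isLong a = (a ≡ᵇ 0) ∨ (a ≡ᵇ N)

      bond : ∀ a b → a ℕ.< suc b → b ℕ.≤ suc k → Rank2 double (ℓ a (suc b))
        (- (𝟙 (b ≡ᵇ a) ℤ.+ 𝟙 (right (suc b) ≡ᵇ a))) (- (𝟙 (left a ≡ᵇ suc b) ℤ.+ 𝟙 (a ≡ᵇ b))) (isLong a)
            (isLong (suc b))
      bond a b a<1+b b≤ with a ℕ.≟ b | b ℕ.≟ suc k
      bond zero    zero _ _ | yes refl | no _ = laced
      bond (suc c) (suc c) _ _ | yes refl | yes refl rewrite ≡ᵇ-refl k | ≡ᵇ-refl c | ≢⇒≡ᵇ-false {k}
          {suc k} (λ ()) | 𝟙-≢ {k} {2 ℕ.+ k} (λ ()) = laced′
      bond (suc c) (suc c) _ b≤ | yes refl | no c≢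
        rewrite ≡ᵇ-refl c | ≢⇒≡ᵇ-false {c} {k} (λ eq → c≢ (cong suc eq)) | 𝟙-≢ {2 ℕ.+ c} {c} (λ ()) |
            𝟙-≢ {c} {2 ℕ.+ c} (λ ())
              | ≢⇒≡ᵇ-false {c} {suc k} (ℕ.<⇒≢ b≤) = simple
      bond zero    b _ _ | no a≢b | yes refl rewrite ≡ᵇ-refl k = commuting
      bond zero    b _ _ | no a≢b | no b≢
        rewrite ≢⇒≡ᵇ-false (≢-sym a≢b) | ≢⇒≡ᵇ-false b≢ | ≢⇒≡ᵇ-false a≢b = commuting
      bond (suc c) b a<1+b _ | no a≢b | yes refl
        rewrite ≡ᵇ-refl k | ≢⇒≡ᵇ-false {k} {c} (λ { refl → a≢b refl }) | ≢⇒≡ᵇ-false {c} {k}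
            (λ { refl → a≢b refl })
              | 𝟙-≢ {c} {2 ℕ.+ k} (ℕ.<⇒≢ (ℕ.m<n⇒m<1+n (ℕ.≤-pred a<1+b))) = commuting
      bond (suc c) b a<1+b _ | no a≢b | no b≢
        rewrite ≢⇒≡ᵇ-false (≢-sym a≢b) | ≢⇒≡ᵇ-false b≢ | ≢⇒≡ᵇ-false a≢b | 𝟙-≢ {suc b} {c}
            (≢-sym (ℕ.<⇒≢ (ℕ.<-trans (ℕ.n<1+n c) a<1+b)))
              | 𝟙-≢ {c} {suc b} (ℕ.<⇒≢ (ℕ.<-trans (ℕ.n<1+n c) a<1+b)) = commuting

      rank2 : ∀ {a b} → a ℕ.< b → b ℕ.≤ N → Rank2 double (ℓ a b) (cartan a b) (cartan b a) (isLong a)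
          (isLong b)
      rank2 {a} {suc b} a<1+b 1+b≤N
        rewrite cartan-≢ {a} {suc b} (ℕ.<⇒≢ a<1+b) | cartan-≢ {suc b} {a} (≢-sym (ℕ.<⇒≢ a<1+b))
              | right-< {a} (ℕ.<⇒≢ (ℕ.<-≤-trans a<1+b 1+b≤N)) = bond a b a<1+b (ℕ.≤-pred 1+b≤N)

    pathCartan : CartanMatrix (coxeterMatrix (C~ k))
    pathCartan = cartanMatrix isLong rank2

    pathLine : Line pathCartan
    pathLine = zigzagLine isLong rank2 λ i j _ _ → third-label i j

-- The root lattice of G̃₂

module G2Vectors where

  open IntegerReflections
  open RealRootSpace

  open import Data.Bool.Base using (Bool; true; false)
  open import Data.Fin.Base using (Fin)
  open import Data.Fin.Patterns using (0F; 1F; 2F)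
  open import Data.Integer.Base using (ℤ; +_; _+_; _*_; _-_; -_; _≤_)
  import Data.Integer.Properties as ℤ
  open import Data.Integer.Tactic.RingSolver using (solve-∀)
  open import Data.List.Base using (List; []; _∷_; _++_; foldr; reverse)
  import Data.List.Properties as List
  open import Data.Product.Base using (_×_; _,_)
  open import Relation.Binary.PropositionalEquality hiding ([_])
  open import Relation.Nullary using (contradiction)

  g₂Cartan : CartanMatrix (coxeterMatrix G~₂)
  g₂Cartan = record { C = C ; long = long ; lacing = triple ; C-diag = C-diag ; C-rank2 = C-rank2 }
    where
    C : Fin 3 → Fin 3 → ℤ
    C 0F 0F = + 2
    C 0F 1F = - + 1
    C 0F 2F = + 0
    C 1F 0F = - + 1
    C 1F 1F = + 2
    C 1F 2F = - + 1
    C 2F 0F = + 0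
    C 2F 1F = - + 3
    C 2F 2F = + 2

    long : Fin 3 → Bool
    long 0F = true
    long 1F = true
    long 2F = false

    C-diag : ∀ i → C i i ≡ + 2
    C-diag 0F = refl
    C-diag 1F = refl
    C-diag 2F = refl

    C-rank2 : ∀ i j → i ≢ j → Rank2 triple (CoxeterMatrix.m (coxeterMatrix G~₂) i j) (C i j) (C j i)
        (long i) (long j)
    C-rank2 0F 0F i≢j = contradiction refl i≢j
    C-rank2 0F 1F _   = simple
    C-rank2 0F 2F _   = commuting
    C-rank2 1F 0F _   = simple
    C-rank2 1F 1F i≢j = contradiction refl i≢j
    C-rank2 1F 2F _   = laced
    C-rank2 2F 0F _   = commuting
    C-rank2 2F 1F _   = laced′
    C-rank2 2F 2F i≢j = contradiction refl i≢j

  open CartanMatrix g₂Cartan using (act; refl-at; refl-at-cong; dot; act-~) renaming (e to eᵥ)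
  open CoxeterGroup (coxeterMatrix G~₂) using (_~_; ~-inverseˡ; ~-inverseʳ)

  -- Triples have decidable propositional equality, which the search needs, and pointwise equations
  -- become equations.
  V₃ : Set
  V₃ = ℤ × ℤ × ℤ

  ⟦_⟧ : V₃ → Fin 3 → ℤ
  ⟦ a , b , c ⟧ 0F = a
  ⟦ a , b , c ⟧ 1F = b
  ⟦ a , b , c ⟧ 2F = c

  vec-≡ : ∀ {a b c a′ b′ c′ : ℤ} → a ≡ a′ → b ≡ b′ → c ≡ c′ → (a , b , c) ≡ (a′ , b′ , c′)
  vec-≡ refl refl refl = refl

  ⟦⟧-injective : ∀ {v w} → ⟦ v ⟧ ≗ ⟦ w ⟧ → v ≡ w
  ⟦⟧-injective v≗w = vec-≡ (v≗w 0F) (v≗w 1F) (v≗w 2F)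

  infixl 6 _∔_
  infixr 7 _·_

  _∔_ : V₃ → V₃ → V₃
  (a , b , c) ∔ (a′ , b′ , c′) = a + a′ , b + b′ , c + c′

  _·_ : ℤ → V₃ → V₃
  k · (a , b , c) = k * a , k * b , k * c

  neg : V₃ → V₃
  neg (a , b , c) = - a , - b , - c

  e : Fin 3 → V₃
  e 0F = + 1 , + 0 , + 0
  e 1F = + 0 , + 1 , + 0
  e 2F = + 0 , + 0 , + 1

  -- The null root: α₀ plus the highest root (0, 2, 3) of the finite system. It pairs to zero with
  -- every simple coroot and is fixed by the group.
  δ₃ : V₃
  δ₃ = + 1 , + 2 , + 3

  pair : Fin 3 → V₃ → ℤ
  pair 0F (a , b , c) = + 2 * a - b
  pair 1F (a , b , c) = + 2 * b - a - c
  pair 2F (a , b , c) = + 2 * c - + 3 * b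

  s : Fin 3 → V₃ → V₃
  s i v = v ∔ (- pair i v) · e i

  act₃ : List (Fin 3) → V₃ → V₃
  act₃ w v = foldr s v w

  e≗ : ∀ i → ⟦ e i ⟧ ≗ eᵥ i
  e≗ 0F 0F = refl
  e≗ 0F 1F = refl
  e≗ 0F 2F = refl
  e≗ 1F 0F = refl
  e≗ 1F 1F = refl
  e≗ 1F 2F = refl
  e≗ 2F 0F = refl
  e≗ 2F 1F = refl
  e≗ 2F 2F = refl

  pair≡dot : ∀ i v → pair i v ≡ dot i ⟦ v ⟧
  pair≡dot 0F (a , b , c) = lemma a b c
    where
    lemma : ∀ a b c → + 2 * a - b ≡ + 2 * a + (- + 1 * b + (+ 0 * c + + 0))
    lemma = solve-∀
  pair≡dot 1F (a , b , c) = lemma a b c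
    where
    lemma : ∀ a b c → + 2 * b - a - c ≡ - + 1 * a + (+ 2 * b + (- + 1 * c + + 0))
    lemma = solve-∀
  pair≡dot 2F (a , b , c) = lemma a b c
    where
    lemma : ∀ a b c → + 2 * c - + 3 * b ≡ + 0 * a + (- + 3 * b + (+ 2 * c + + 0))
    lemma = solve-∀

  s≗ : ∀ i v → ⟦ s i v ⟧ ≗ refl-at i ⟦ v ⟧
  s≗ i v j = trans (⟦∔·⟧ (pair i v) v (e i) j) (cong₂ (λ d ε → ⟦ v ⟧ j - d * ε) (pair≡dot i v) (e≗ i j))
    where
    ⟦∔·⟧ : ∀ k v w j → ⟦ v ∔ (- k) · w ⟧ j ≡ ⟦ v ⟧ j - k * ⟦ w ⟧ j
    ⟦∔·⟧ k (a , b , c) (a′ , b′ , c′) 0F = cong (_+_ a) (sym (ℤ.neg-distribˡ-* k a′))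
    ⟦∔·⟧ k (a , b , c) (a′ , b′ , c′) 1F = cong (_+_ b) (sym (ℤ.neg-distribˡ-* k b′))
    ⟦∔·⟧ k (a , b , c) (a′ , b′ , c′) 2F = cong (_+_ c) (sym (ℤ.neg-distribˡ-* k c′))

  act₃≗ : ∀ w v → ⟦ act₃ w v ⟧ ≗ act w ⟦ v ⟧
  act₃≗ []      v j = refl
  act₃≗ (i ∷ w) v j = trans (s≗ i (act₃ w v) j) (refl-at-cong i (act₃≗ w v) j)

  act₃-++ : ∀ u w v → act₃ (u ++ w) v ≡ act₃ u (act₃ w v)
  act₃-++ u w v = List.foldr-++ s v u w

  act₃-~ : ∀ {u w} → u ~ w → ∀ v → act₃ u v ≡ act₃ w v
  act₃-~ {u} {w} r v = ⟦⟧-injective λ j → trans (act₃≗ u v j) (trans (act-~ r ⟦ v ⟧ j) (sym (act₃≗ w v j)))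

  act₃-inverseˡ : ∀ u v → act₃ (reverse u) (act₃ u v) ≡ v
  act₃-inverseˡ u v = trans (sym (act₃-++ (reverse u) u v)) (act₃-~ (~-inverseˡ u) v)

  act₃-inverseʳ : ∀ u v → act₃ u (act₃ (reverse u) v) ≡ v
  act₃-inverseʳ u v = trans (sym (act₃-++ u (reverse u) v)) (act₃-~ (~-inverseʳ u) v)

  pair-∔ : ∀ i v w → pair i (v ∔ w) ≡ pair i v + pair i w
  pair-∔ 0F (a , b , c) (a′ , b′ , c′) = lemma a b a′ b′
    where
    lemma : ∀ a b a′ b′ → + 2 * (a + a′) - (b + b′) ≡ + 2 * a - b + (+ 2 * a′ - b′)
    lemma = solve-∀
  pair-∔ 1F (a , b , c) (a′ , b′ , c′) = lemma a b c a′ b′ c′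
    where
    lemma : ∀ a b c a′ b′ c′ → + 2 * (b + b′) - (a + a′) - (c + c′) ≡ + 2 * b - a - c + (+ 2 * b′ - a′ - c′)
    lemma = solve-∀
  pair-∔ 2F (a , b , c) (a′ , b′ , c′) = lemma b c b′ c′
    where
    lemma : ∀ b c b′ c′ → + 2 * (c + c′) - + 3 * (b + b′) ≡ + 2 * c - + 3 * b + (+ 2 * c′ - + 3 * b′)
    lemma = solve-∀

  pair-· : ∀ i k v → pair i (k · v) ≡ k * pair i v
  pair-· 0F k (a , b , c) = lemma k a b
    where
    lemma : ∀ k a b → + 2 * (k * a) - k * b ≡ k * (+ 2 * a - b)
    lemma = solve-∀
  pair-· 1F k (a , b , c) = lemma k a b c
    where
    lemma : ∀ k a b c → + 2 * (k * b) - k * a - k * c ≡ k * (+ 2 * b - a - c)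
    lemma = solve-∀
  pair-· 2F k (a , b , c) = lemma k b c
    where
    lemma : ∀ k b c → + 2 * (k * c) - + 3 * (k * b) ≡ k * (+ 2 * c - + 3 * b)
    lemma = solve-∀

  s-∔ : ∀ i v w → s i (v ∔ w) ≡ s i v ∔ s i w
  s-∔ i v w = trans (cong (λ p → v ∔ w ∔ (- p) · e i) (pair-∔ i v w)) (go (pair i v) (pair i w) v w (e i))
    where
    lemma : ∀ k l x y z → x + y + - (k + l) * z ≡ x + - k * z + (y + - l * z)
    lemma = solve-∀
    go : ∀ k l v w z → v ∔ w ∔ (- (k + l)) · z ≡ (v ∔ (- k) · z) ∔ (w ∔ (- l) · z)
    go k l (a , b , c) (a′ , b′ , c′) (x , y , z) = vec-≡ (lemma k l a a′ x) (lemma k l b b′ y)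
        (lemma k l c c′ z)

  s-· : ∀ i k v → s i (k · v) ≡ k · s i v
  s-· i k v = trans (cong (λ p → k · v ∔ (- p) · e i) (pair-· i k v)) (go (pair i v) v (e i))
    where
    lemma : ∀ k p x z → k * x + - (k * p) * z ≡ k * (x + - p * z)
    lemma = solve-∀
    go : ∀ p v z → k · v ∔ (- (k * p)) · z ≡ k · (v ∔ (- p) · z)
    go p (a , b , c) (x , y , z) = vec-≡ (lemma k p a x) (lemma k p b y) (lemma k p c z)

  neg≡ : ∀ v → neg v ≡ (- + 1) · v
  neg≡ (a , b , c) = vec-≡ (sym (ℤ.-1*i≡-i a)) (sym (ℤ.-1*i≡-i b)) (sym (ℤ.-1*i≡-i c))

  neg-involutive : ∀ v → neg (neg v) ≡ v
  neg-involutive (a , b , c) = vec-≡ (ℤ.neg-involutive a) (ℤ.neg-involutive b) (ℤ.neg-involutive c)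

  neg-∔ : ∀ v w → neg (v ∔ w) ≡ neg v ∔ neg w
  neg-∔ (a , b , c) (a′ , b′ , c′) = vec-≡ (ℤ.neg-distrib-+ a a′) (ℤ.neg-distrib-+ b b′)
      (ℤ.neg-distrib-+ c c′)

  s-neg : ∀ i v → s i (neg v) ≡ neg (s i v)
  s-neg i v = trans (cong (s i) (neg≡ v)) (trans (s-· i (- + 1) v) (sym (neg≡ (s i v))))

  s-δ : ∀ i → s i δ₃ ≡ δ₃
  s-δ 0F = refl
  s-δ 1F = refl
  s-δ 2F = refl

  s-shift : ∀ i v k → s i (v ∔ k · δ₃) ≡ s i v ∔ k · δ₃
  s-shift i v k = trans (s-∔ i v (k · δ₃)) (cong (s i v ∔_) (trans (s-· i k δ₃) (cong (k ·_) (s-δ i))))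

  s-e : ∀ i → s i (e i) ≡ neg (e i)
  s-e 0F = refl
  s-e 1F = refl
  s-e 2F = refl

  s-involutive : ∀ i v → s i (s i v) ≡ v
  s-involutive i v = trans (s-∔ i v ((- pair i v) · e i))
      (trans (cong (s i v ∔_) (trans (s-· i (- pair i v) (e i))
    (cong ((- pair i v) ·_) (s-e i)))) (go (pair i v) v (e i)))
    where
    lemma : ∀ p x z → x + - p * z + - p * - z ≡ x
    lemma = solve-∀
    go : ∀ p v z → v ∔ (- p) · z ∔ (- p) · neg z ≡ v
    go p (a , b , c) (x , y , z) = vec-≡ (lemma p a x) (lemma p b y) (lemma p c z)

  act₃-∔ : ∀ u v w → act₃ u (v ∔ w) ≡ act₃ u v ∔ act₃ u w
  act₃-∔ []      v w = refl
  act₃-∔ (i ∷ u) v w = trans (cong (s i) (act₃-∔ u v w)) (s-∔ i (act₃ u v) (act₃ u w))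

  act₃-· : ∀ u k v → act₃ u (k · v) ≡ k · act₃ u v
  act₃-· []      k v = refl
  act₃-· (i ∷ u) k v = trans (cong (s i) (act₃-· u k v)) (s-· i k (act₃ u v))

  act₃-δ : ∀ u → act₃ u δ₃ ≡ δ₃
  act₃-δ []      = refl
  act₃-δ (i ∷ u) = trans (cong (s i) (act₃-δ u)) (s-δ i)

  height : V₃ → ℤ
  height (a , b , c) = a + b + c

  height-∔ : ∀ v w → height (v ∔ w) ≡ height v + height w
  height-∔ (a , b , c) (a′ , b′ , c′) = lemma a b c a′ b′ c′
    where
    lemma : ∀ a b c a′ b′ c′ → a + a′ + (b + b′) + (c + c′) ≡ a + b + c + (a′ + b′ + c′)
    lemma = solve-∀

  height-· : ∀ k v → height (k · v) ≡ k * height v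
  height-· k (a , b , c) = lemma k a b c
    where
    lemma : ∀ k a b c → k * a + k * b + k * c ≡ k * (a + b + c)
    lemma = solve-∀

  height-nonneg : ∀ {v} → NonNeg ⟦ v ⟧ → + 0 ≤ height v
  height-nonneg 0≤v = ℤ.+-mono-≤ (ℤ.+-mono-≤ (0≤v 0F) (0≤v 1F)) (0≤v 2F)

-- Finite search for G̃₂

module G2Search where

  open Orbits using (rotate)
  open G2Vectors

  open import Data.Bool.Base using (Bool; false; _∧_; _∨_; if_then_else_; T)
  open import Data.Bool.Properties using (T?)
  open import Data.Fin.Base using (Fin; zero; suc)
  open import Data.Fin.Patterns using (0F; 1F; 2F)
  import Data.Fin.Properties as Fin
  open import Data.Integer.Base using (ℤ; +_; _+_; _≤_)
  import Data.Integer.Properties as ℤ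
  open import Data.List.Base using (List; []; _∷_; _++_; map)
  import Data.List.Properties as List
  import Data.List.Membership.DecPropositional as Membership
  open import Data.List.Relation.Unary.All using (All; all?)
  open import Data.List.Relation.Unary.Any using (here; there)
  open import Data.Nat.Base as ℕ using (ℕ; zero; suc)
  open import Data.Product.Base using (_×_; _,_; ∃-syntax)
  open import Data.Product.Properties using (≡-dec)
  open import Data.Sum.Base using (_⊎_)
  open import Relation.Binary.Definitions using (DecidableEquality)
  open import Relation.Binary.PropositionalEquality hiding ([_])
  open import Relation.Nullary.Decidable using (⌊_⌋; from-yes; _⊎-dec_)

  Queue : Set
  Queue = List (Fin 3)

  _≟₃_ : DecidableEquality V₃
  _≟₃_ = ≡-dec ℤ._≟_ (≡-dec ℤ._≟_ ℤ._≟_)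

  _≟ᵠ_ : DecidableEquality Queue
  _≟ᵠ_ = List.≡-dec Fin._≟_

  open Membership _≟₃_ public using () renaming (_∈_ to _∈₃_; _∈?_ to _∈₃?_)
  open Membership _≟ᵠ_ public using () renaming (_∈_ to _∈ᵠ_; _∈?_ to _∈ᵠ?_)
  open Membership (≡-dec _≟ᵠ_ _≟₃_) public using () renaming (_∈_ to _∈ˢ_; _∈?_ to _∈ˢ?_)

  -- The positive roots β for which β - δ₃ is not positive; every positive root is one of them
  -- plus a multiple of δ₃.
  small : List V₃
  small = finite ++ map (λ v → δ₃ ∔ neg v) finite
    where
    finite : List V₃
    finite = (+ 0 , + 1 , + 0) ∷ (+ 0 , + 0 , + 1) ∷ (+ 0 , + 1 , + 1) ∷
             (+ 0 , + 1 , + 2) ∷ (+ 0 , + 1 , + 3) ∷ (+ 0 , + 2 , + 3) ∷ []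

  queues : List Queue
  queues = (0F ∷ 1F ∷ 2F ∷ []) ∷ (1F ∷ 2F ∷ 0F ∷ []) ∷ (2F ∷ 0F ∷ 1F ∷ []) ∷
           (0F ∷ 2F ∷ 1F ∷ []) ∷ (2F ∷ 1F ∷ 0F ∷ []) ∷ (1F ∷ 0F ∷ 2F ∷ []) ∷ []

  -- R absorbs δ, so refuting -(σ - δ) refutes -σ. One subtraction brings the reflection of a small
  -- root, unless it is -αᵢ, back among the small roots; the search thus stays within finitely many
  -- states.
  reduce : V₃ → V₃
  reduce (a , b , c) =
    if ⌊ + 1 ℤ.≤? a ⌋ ∧ (⌊ + 2 ℤ.≤? b ⌋ ∧ ⌊ + 3 ℤ.≤? c ⌋) then (a , b , c) ∔ neg δ₃ else (a , b , c)

  -- Whether the presence of - σ in R at a time with the given queue is refuted by following the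
  -- orbit for the given number of steps: if it is the negative of the simple root to be toggled, it
  -- is made positive for good; otherwise it stays or is reflected, and the reflected root is in R
  -- anyway if the pairing is nonnegative.  The states in B are assumed to be refuted already.
  dead : List (Queue × V₃) → ℕ → Queue → V₃ → Bool
  dead B zero    _       σ = false
  dead B (suc f) []      σ = false
  dead B (suc f) (i ∷ q) σ = ⌊ (i ∷ q , σ) ∈ˢ? B ⌋ ∨ (⌊ σ ≟₃ e i ⌋ ∨
    (dead B f (q ++ i ∷ []) (reduce (s i σ)) ∧ (⌊ + 0 ℤ.≤? pair i σ ⌋ ∨ dead B f (q ++ i ∷ []) σ)))

  fuel : ℕ
  fuel = 8

  -- The root is not reduced along the way, since its height is compared at the end. Both outcomes
  -- of each toggle are followed, and a branch ends early only by being refuted modulo δ.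
  climbs : List (Queue × V₃) → ℕ → ℤ → Queue → V₃ → Bool
  climbs B zero    h _       v = ⌊ h ℤ.<? height v ⌋
  climbs B (suc f) h []      v = false
  climbs B (suc f) h (i ∷ q) v = dead B fuel (i ∷ q) (reduce v) ∨
    (climbs B f h (q ++ i ∷ []) v ∧ climbs B f h (q ++ i ∷ []) (s i v))

  -- One state for each of the two cyclic orders of the labels. An unblocked round sends σ = (0, 1,
  -- 2) to δ - σ and the next round sends it back to σ, so a lasting gain of height cannot be
  -- expected.
  neutralStates : List (Queue × V₃)
  neutralStates = (0F ∷ 2F ∷ 1F ∷ [] , + 0 , + 1 , + 2) ∷ (2F ∷ 0F ∷ 1F ∷ [] , + 0 , + 1 , + 2) ∷ []

  -- The multiple of δ split off from a positive root contributes equally to both heights, so six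
  -- queues and twelve small roots cover all states.
  all-climb : All (λ q → All (λ σ → T (climbs neutralStates 5 (height σ) q σ)) small) queues
  all-climb = from-yes (all? (λ q → all? (λ σ → T? (climbs neutralStates 5 (height σ) q σ)) small) queues)

  data Positive : V₃ → Set where
    positive : ∀ {σ} → σ ∈₃ small → ∀ m → Positive (σ ∔ (+ m) · δ₃)

  SmallImage : V₃ → Fin 3 → Set
  SmallImage σ i = σ ≡ e i ⊎ (s i σ ∈₃ small ⊎ (s i σ ∔ neg δ₃) ∈₃ small)

  -- On small roots other than αᵢ, the reflection raises the multiple of δ by at most one. This
  -- turns the closure of all positive roots under reflections into a finite check.
  small-closed : All (λ σ → ∀ i → SmallImage σ i) small
  small-closed = from-yes (all? (λ σ → Fin.all? λ i → (σ ≟₃ e i) ⊎-dec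
      ((s i σ ∈₃? small) ⊎-dec ((s i σ ∔ neg δ₃) ∈₃? small))) small)

  δ-simple-small : ∀ i → δ₃ ∔ neg (e i) ∈₃ small
  δ-simple-small = from-yes (Fin.all? λ i → (δ₃ ∔ neg (e i)) ∈₃? small)

  simple-small : ∀ i → e i ∈₃ small
  simple-small = from-yes (Fin.all? λ i → e i ∈₃? small)

  small-nonneg : All (λ σ → ∀ j → + 0 ≤ ⟦ σ ⟧ j) small
  small-nonneg = from-yes (all? (λ σ → Fin.all? λ j → + 0 ℤ.≤? ⟦ σ ⟧ j) small)

  rotate-queues : All (λ q → rotate q ∈ᵠ queues) queues
  rotate-queues = from-yes (all? (λ q → rotate q ∈ᵠ? queues) queues)

  distinct-queues : ∀ a b c → (a ≡ b ⊎ (a ≡ c ⊎ b ≡ c)) ⊎ (a ∷ b ∷ c ∷ []) ∈ᵠ queues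
  distinct-queues = from-yes (Fin.all? λ a → Fin.all? λ b → Fin.all? λ c →
    ((a Fin.≟ b) ⊎-dec ((a Fin.≟ c) ⊎-dec (b Fin.≟ c))) ⊎-dec ((a ∷ b ∷ c ∷ []) ∈ᵠ? queues))

  -- Why the toggle i does not increase the height of η: either γ and η have nonnegative pairings
  -- with α i, or i cannot be blocked because - (1 + k) γ′ = - a γ + b α i + d δ₃ would be
  -- nonnegative and γ′ is refuted afterwards.
  data Reason : Set where
    pairings   : Reason
    refutation : (a b d k : ℕ) → V₃ → Reason

  valid : Reason → Fin 3 → Queue → V₃ → V₃ → Bool
  valid pairings                  i q γ η = ⌊ + 0 ℤ.≤? pair i γ ⌋ ∧ ⌊ + 0 ℤ.≤? pair i η ⌋
  valid (refutation a b d k γ′) i q γ η =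
    ⌊ ((+ suc k) · neg γ′) ≟₃ ((+ a) · neg γ ∔ (+ b) · e i ∔ (+ d) · δ₃) ⌋ ∧ dead [] fuel (q ++ i ∷ []) γ′

  -- Both γ and η are reflected at every step, as if no toggle were ever blocked; the reasons show
  -- that a blocked toggle does no harm or cannot occur, so one walk stands for all orbits.
  walk : List Reason → (q : Queue) (γ η : V₃) → (q′ : Queue) (γ′ η′ : V₃) → Bool
  walk []       q       γ η q′ γ′ η′ = ⌊ q ≟ᵠ q′ ⌋ ∧ (⌊ γ ≟₃ γ′ ⌋ ∧ ⌊ η ≟₃ η′ ⌋)
  walk (r ∷ rs) []      γ η q′ γ′ η′ = false
  walk (r ∷ rs) (i ∷ q) γ η q′ γ′ η′ = valid r i q γ η ∧ walk rs (q ++ i ∷ []) (s i γ) (s i η) q′ γ′ η′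

  -- The auxiliary root η = (0, 2, 3) is the highest root of the finite system. Two unblocked rounds
  -- fix σ but send η to η + δ.
  neutral-walk : ∀ {q σ} → (q , σ) ∈ˢ neutralStates →
                 ∃[ r₁ ] ∃[ r₂ ] ∃[ r₃ ] ∃[ r₄ ] ∃[ r₅ ] ∃[ r₆ ] ∃[ η ]
                 T (walk (r₁ ∷ r₂ ∷ r₃ ∷ r₄ ∷ r₅ ∷ r₆ ∷ []) q σ η q σ (η ∔ δ₃))
  neutral-walk (here refl) =
    -- At label 1 the pairing with η is negative, so blocking has to be refuted: -3γ + α₁ + δ = -2α₀
    -- when γ = (1, 1, 1), and -γ + α₁ = -2α₂ when γ = (0, 1, 2). The entries 1 0 0 0 keep γ itself,
    -- which is refuted if it waits there.
    refutation 1 0 0 0 (+ 0 , + 1 , + 2) , pairings , refutation 3 1 1 1 (+ 1 , + 0 , + 0) , pairings ,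
    refutation 1 0 0 0 (+ 0 , + 1 , + 1) , refutation 1 1 0 1 (+ 0 , + 0 , + 1) , (+ 0 , + 2 , + 3) , _
  neutral-walk (there (here refl)) =
    pairings , refutation 1 0 0 0 (+ 0 , + 1 , + 1) , refutation 3 1 1 1 (+ 1 , + 0 , + 0) ,
    refutation 1 0 0 0 (+ 1 , + 1 , + 1) , pairings , refutation 1 1 0 1 (+ 0 , + 0 , + 1) ,
        (+ 0 , + 2 , + 3) , _

-- Soundness of the search and the case of G̃₂

module G2Billiards where

  open IntegerReflections
  open RealRootSpace
  open Orbits
  open LineBilliards using (<-by; no-periodic-descent)
  open G2Vectors
  open G2Search

  open import Data.Bool.Base using (T; true; false; _∧_; _∨_; if_then_else_)
  open import Data.Bool.Properties using (T-∧; T-∨)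
  open import Data.Empty using (⊥; ⊥-elim)
  open import Data.Fin.Base using (Fin)
  open import Data.Fin.Patterns using (0F; 1F; 2F)
  open import Data.Integer.Base as ℤ using (ℤ; +_; _+_; _*_; _-_; -_; _≤_; _<_)
  import Data.Integer.Properties as ℤ
  open import Data.Integer.Tactic.RingSolver using (solve-∀)
  open import Data.List.Base using (List; []; _∷_; _++_; reverse; length; allFin)
  import Data.List.Properties as List
  open import Data.List.Relation.Binary.Permutation.Propositional using (_↭_; ↭-sym; ↭⇒↭ₛ)
  open import Data.List.Relation.Binary.Permutation.Propositional.Properties using (↭-length)
  import Data.List.Relation.Binary.Permutation.Setoid.Properties as Perm
  open import Data.List.Relation.Unary.All using (lookup; []; _∷_)
  open import Data.List.Relation.Unary.Any using (there)
  open import Data.List.Relation.Unary.AllPairs using ([]; _∷_)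
  open import Data.List.Relation.Unary.Unique.Propositional using (Unique)
  open import Data.List.Relation.Unary.Unique.Propositional.Properties using (allFin⁺)
  open import Data.Nat.Base as ℕ using (ℕ; zero; suc)
  import Data.Nat.Properties as ℕ
  import Data.Nat.Tactic.RingSolver as ℕSolver
  open import Data.Product.Base using (_×_; _,_; ∃-syntax)
  open import Data.Sum.Base using (_⊎_; inj₁; inj₂)
  open import Function.Bundles using (module Equivalence)
  open import Relation.Binary.PropositionalEquality hiding ([_])
  open import Relation.Nullary using (¬_; contradiction)
  open import Relation.Nullary.Decidable using (toWitness; ⌊_⌋)
  open import Relation.Unary using (Pred)

  private
    split-∧ : ∀ a {b} → T (a ∧ b) → T a × T b
    split-∧ a = Equivalence.to T-∧

    split-∨ : ∀ a {b} → T (a ∨ b) → T a ⊎ T b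
    split-∨ a = Equivalence.to T-∨

  queue∈queues : ∀ {is : Queue} → is ↭ allFin 3 → is ∈ᵠ queues
  queue∈queues {is} is↭ = go is (↭-length is↭)
    (Perm.Unique-resp-↭ (setoid (Fin 3)) (↭⇒↭ₛ (↭-sym is↭)) (allFin⁺ 3))
    where
    go : ∀ is → length is ≡ 3 → Unique is → is ∈ᵠ queues
    go (a ∷ b ∷ c ∷ []) refl ((a≢b ∷ a≢c ∷ []) ∷ (b≢c ∷ []) ∷ [] ∷ []) with distinct-queues a b c
    ... | inj₂ ∈queues           = ∈queues
    ... | inj₁ (inj₁ a≡b)        = contradiction a≡b a≢b
    ... | inj₁ (inj₂ (inj₁ a≡c)) = contradiction a≡c a≢c
    ... | inj₁ (inj₂ (inj₂ b≡c)) = contradiction b≡c b≢c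

  open CartanMatrix g₂Cartan using (act; act-cong) renaming (e to eᵥ)
  open CoxeterGroup (coxeterMatrix G~₂) using (_~_; ~-trans; ~-reverse-cong; ≡⇒~)

  act-root≗ : ∀ w x i → act w (act x (eᵥ i)) ≗ ⟦ act₃ w (act₃ x (e i)) ⟧
  act-root≗ w x i j = sym (trans (act₃≗ w (act₃ x (e i)) j) (act-cong w (λ k →
    trans (act₃≗ x (e i) k) (act-cong x (e≗ i) k)) j))

  NonNeg-resp : ∀ {v v′ : Fin 3 → ℤ} → v ≗ v′ → NonNeg v → NonNeg v′
  NonNeg-resp v≗v′ 0≤v j = subst (+ 0 ≤_) (v≗v′ j) (0≤v j)

  NonNeg-∔ : ∀ v w → NonNeg ⟦ v ⟧ → NonNeg ⟦ w ⟧ → NonNeg ⟦ v ∔ w ⟧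
  NonNeg-∔ v w 0≤v 0≤w 0F = ℤ.+-mono-≤ (0≤v 0F) (0≤w 0F)
  NonNeg-∔ v w 0≤v 0≤w 1F = ℤ.+-mono-≤ (0≤v 1F) (0≤w 1F)
  NonNeg-∔ v w 0≤v 0≤w 2F = ℤ.+-mono-≤ (0≤v 2F) (0≤w 2F)

  ⟦·⟧ : ∀ k v j → ⟦ k · v ⟧ j ≡ k * ⟦ v ⟧ j
  ⟦·⟧ k v 0F = refl
  ⟦·⟧ k v 1F = refl
  ⟦·⟧ k v 2F = refl

  NonNeg-· : ∀ {k} v → + 0 ≤ k → NonNeg ⟦ v ⟧ → NonNeg ⟦ k · v ⟧
  NonNeg-· {+ k} v _ 0≤v j = subst₂ _≤_ (ℤ.*-zeroʳ (+ k)) (sym (⟦·⟧ (+ k) v j))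
      (ℤ.*-monoˡ-≤-nonNeg (+ k) (0≤v j))

  NonNeg-cancel : ∀ k v → NonNeg ⟦ (+ suc k) · v ⟧ → NonNeg ⟦ v ⟧
  NonNeg-cancel k v 0≤kv j = ℤ.*-cancelˡ-≤-pos (+ 0) (⟦ v ⟧ j) (+ suc k)
    (subst₂ _≤_ (sym (ℤ.*-zeroʳ (+ suc k))) (⟦·⟧ (+ suc k) v j) (0≤kv j))

  NonNeg-δ : NonNeg ⟦ δ₃ ⟧
  NonNeg-δ 0F = ℤ.+≤+ ℕ.z≤n
  NonNeg-δ 1F = ℤ.+≤+ ℕ.z≤n
  NonNeg-δ 2F = ℤ.+≤+ ℕ.z≤n

  Positive⇒NonNeg : ∀ {v} → Positive v → NonNeg ⟦ v ⟧
  Positive⇒NonNeg (positive {σ} σ∈ m) =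
    NonNeg-∔ σ ((+ m) · δ₃) (lookup small-nonneg σ∈) (NonNeg-· {+ m} δ₃ (ℤ.+≤+ ℕ.z≤n) NonNeg-δ)

  neg-e-negative : ∀ i → ¬ NonNeg ⟦ neg (e i) ⟧
  neg-e-negative 0F 0≤ with () ← 0≤ 0F
  neg-e-negative 1F 0≤ with () ← 0≤ 1F
  neg-e-negative 2F 0≤ with () ← 0≤ 2F

  small⇒Positive : ∀ {σ} → σ ∈₃ small → Positive σ
  small⇒Positive {σ@(a , b , c)} σ∈ =
    subst Positive (vec-≡ (ℤ.+-identityʳ a) (ℤ.+-identityʳ b) (ℤ.+-identityʳ c)) (positive σ∈ 0)

  private
    absorb : ∀ v m → v ∔ neg δ₃ ∔ (+ suc m) · δ₃ ≡ v ∔ (+ m) · δ₃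
    absorb (a , b , c) m = vec-≡ (lemma a (+ m) (+ 1)) (lemma b (+ m) (+ 2)) (lemma c (+ m) (+ 3))
      where
      lemma : ∀ x m d → x + - d + (+ 1 + m) * d ≡ x + m * d
      lemma = solve-∀

    absorb-e : ∀ v m → δ₃ ∔ neg v ∔ (+ m) · δ₃ ≡ neg v ∔ (+ suc m) · δ₃
    absorb-e (a , b , c) m = vec-≡ (lemma a (+ m) (+ 1)) (lemma b (+ m) (+ 2)) (lemma c (+ m) (+ 3))
      where
      lemma : ∀ x m d → d + - x + m * d ≡ - x + (+ 1 + m) * d
      lemma = solve-∀

    ∔-0δ : ∀ v → v ∔ (+ 0) · δ₃ ≡ v
    ∔-0δ (a , b , c) = vec-≡ (ℤ.+-identityʳ a) (ℤ.+-identityʳ b) (ℤ.+-identityʳ c)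

  s-positive : ∀ {v} → Positive v → ∀ i → v ≡ e i ⊎ Positive (s i v)
  s-positive (positive {σ} σ∈ m) i = go (lookup small-closed σ∈ i) m
    where
    at-simple : σ ≡ e i → ∀ m → σ ∔ (+ m) · δ₃ ≡ e i ⊎ Positive (s i (σ ∔ (+ m) · δ₃))
    at-simple eq zero    = inj₁ (trans (∔-0δ σ) eq)
    -- Here -αᵢ + (1 + m)δ is regrouped as (δ - αᵢ) + mδ, and δ - αᵢ is small.
    at-simple eq (suc m) = inj₂ (subst Positive
      (trans (absorb-e (e i) m) (trans
          (cong (_∔ (+ suc m) · δ₃) (trans (sym (s-e i)) (cong (s i) (sym eq))))
        (sym (s-shift i σ (+ suc m)))))
      (positive (δ-simple-small i) m))
    go : SmallImage σ i → ∀ m → σ ∔ (+ m) · δ₃ ≡ e i ⊎ Positive (s i (σ ∔ (+ m) · δ₃))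
    go (inj₁ eq)          m = at-simple eq m
    go (inj₂ (inj₁ sσ∈))   m = inj₂ (subst Positive (sym (s-shift i σ (+ m))) (positive sσ∈ m))
    go (inj₂ (inj₂ sσ-δ∈)) m = inj₂
        (subst Positive (trans (absorb (s i σ) m) (sym (s-shift i σ (+ m)))) (positive sσ-δ∈ (suc m)))

  reduce-cases : ∀ v → reduce v ≡ v ⊎ reduce v ≡ v ∔ neg δ₃
  reduce-cases v@(a , b , c) = go (⌊ + 1 ℤ.≤? a ⌋ ∧ (⌊ + 2 ℤ.≤? b ⌋ ∧ ⌊ + 3 ℤ.≤? c ⌋))
    where
    go : ∀ x → (if x then v ∔ neg δ₃ else v) ≡ v ⊎ (if x then v ∔ neg δ₃ else v) ≡ v ∔ neg δ₃
    go true  = inj₂ refl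
    go false = inj₁ refl

  -- A simple reflection changes the sign of a root only at ±αⱼ, so signs can be computed along the
  -- word. Nonnegativity of a root may then be proved by excluding the negative case.
  root-sign : ∀ w i → Positive (act₃ w (e i)) ⊎ Positive (neg (act₃ w (e i)))
  root-sign []      i = inj₁ (small⇒Positive (simple-small i))
  root-sign (j ∷ w) i with root-sign w i
  root-sign (j ∷ w) i | inj₁ pos with s-positive pos j
  ... | inj₂ pos′ = inj₁ pos′
  ... | inj₁ eq   = inj₂ (subst Positive (sym (trans (cong (λ v → neg (s j v)) eq)
    (trans (cong neg (s-e j)) (neg-involutive (e j))))) (small⇒Positive (simple-small j)))
  root-sign (j ∷ w) i | inj₂ pos with s-positive pos j
  ... | inj₂ pos′ = inj₂ (subst Positive (s-neg j (act₃ w (e i))) pos′)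
  ... | inj₁ eq   = inj₁ (subst Positive
      (sym (trans (cong (s j) (trans (sym (neg-involutive (act₃ w (e i)))) (cong neg eq)))
    (trans (s-neg j (e j)) (trans (cong neg (s-e j)) (neg-involutive (e j))))))
        (small⇒Positive (simple-small j)))

  module _ {p′} (𝓛 : Pred (List (Fin 3)) p′) {w₀} (w₀∈𝓛 : 𝓛 w₀) {is u} (ordering : is ↭ allFin 3)
           (orbit : Toggling.Orbit g₂Cartan 𝓛 is u) where
    open Toggling g₂Cartan 𝓛 using (Blocked; module Orbit)
    open Orbit orbit renaming (T to period)

    forward backward : ℕ → V₃ → V₃
    forward  t = act₃ (state t)
    backward t = act₃ (reverse (state t))

    -- For a root v, this says that v, transported back by the element at time t, lies in R(𝓛).
    record P (t : ℕ) (v : V₃) : Set p′ where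
      constructor transported
      field nonneg : ∀ w → 𝓛 w → NonNeg ⟦ act₃ w (backward t v) ⟧
    open P

    Blocked⇒P : ∀ {t i} → Blocked i (state t) → P t (e i)
    Blocked⇒P {t} {i} b .nonneg w w∈ = NonNeg-resp (act-root≗ w (reverse (state t)) i) (b w∈)

    P⇒Blocked : ∀ {t i} → P t (e i) → Blocked i (state t)
    P⇒Blocked {t} {i} pe {w} w∈ = NonNeg-resp (λ j → sym (act-root≗ w (reverse (state t)) i j))
        (nonneg pe w w∈)

    -- Because `P` is stated for all vectors, it is a convex cone containing δ. The combinations
    -- used in refutations, such as -2α₀, leave the root system before they are divided.
    P-∔ : ∀ {t v v′} → P t v → P t v′ → P t (v ∔ v′)
    P-∔ {t} {v} {v′} pv pv′ .nonneg w w∈ = subst (λ x → NonNeg ⟦ x ⟧)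
      (sym (trans (cong (act₃ w) (act₃-∔ (reverse (state t)) v v′)) (act₃-∔ w _ _)))
      (NonNeg-∔ _ _ (nonneg pv w w∈) (nonneg pv′ w w∈))

    private
      transported-· : ∀ t w k v → act₃ w (backward t (k · v)) ≡ k · act₃ w (backward t v)
      transported-· t w k v = trans (cong (act₃ w) (act₃-· (reverse (state t)) k v)) (act₃-· w k _)

    P-· : ∀ {t k v} → + 0 ≤ k → P t v → P t (k · v)
    P-· {t} {k} {v} 0≤k pv .nonneg w w∈ = subst (λ x → NonNeg ⟦ x ⟧) (sym (transported-· t w k v))
        (NonNeg-· _ 0≤k (nonneg pv w w∈))

    P-cancel : ∀ {t} k v → P t ((+ suc k) · v) → P t v
    P-cancel {t} k v pkv .nonneg w w∈ = NonNeg-cancel k _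
        (subst (λ x → NonNeg ⟦ x ⟧) (transported-· t w (+ suc k) v) (nonneg pkv w w∈))

    P-δ : ∀ {t} → P t δ₃
    P-δ {t} .nonneg w w∈ = subst (λ x → NonNeg ⟦ x ⟧)
        (sym (trans (cong (act₃ w) (act₃-δ (reverse (state t)))) (act₃-δ w))) NonNeg-δ

    data Step (t : ℕ) (i : Fin 3) : Set p′ where
      blocked : P t (e i) → (∀ v → forward (suc t) v ≡ forward t v) →
          (∀ v → backward (suc t) v ≡ backward t v) → Step t i
      moved   : ¬ P t (e i) → (∀ v → forward (suc t) v ≡ s i (forward t v)) →
                (∀ v → backward (suc t) (s i v) ≡ backward t v) → Step t i

    step : ∀ t {i q} → queue t ≡ i ∷ q → Step t i
    step t {i} eq with toggle t eq
    ... | inj₁ (b , ~u)   = blocked (Blocked⇒P {t} b) (act₃-~ ~u) (act₃-~ (~-reverse-cong ~u))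
    ... | inj₂ (¬b , ~iu) = moved (λ pe → ¬b (P⇒Blocked {t} pe)) (act₃-~ ~iu) λ v →
      trans (act₃-~ (~-trans (~-reverse-cong ~iu) (≡⇒~ (List.unfold-reverse i (state t)))) (s i v))
        (trans (act₃-++ (reverse (state t)) (i ∷ []) (s i v)) (cong (backward t) (s-involutive i v)))

    P-blocked : ∀ {t v} → (∀ v → backward (suc t) v ≡ backward t v) → P t v → P (suc t) v
    P-blocked {t} {v} eq pv .nonneg w w∈ = subst (λ x → NonNeg ⟦ act₃ w x ⟧) (sym (eq v)) (nonneg pv w w∈)

    P-moved : ∀ {t i v} → (∀ v → backward (suc t) (s i v) ≡ backward t v) → P t v → P (suc t) (s i v)
    P-moved {t} {i} {v} eq pv .nonneg w w∈ = subst (λ x → NonNeg ⟦ act₃ w x ⟧) (sym (eq v)) (nonneg pv w w∈)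

    queue-next : ∀ {t i q} → queue t ≡ i ∷ q → queue (suc t) ≡ q ++ i ∷ []
    queue-next eq = cong rotate eq

    state-periodic : ∀ k t → state (t ℕ.+ k ℕ.* suc period) ~ state t
    state-periodic zero    t = ≡⇒~ (cong state (ℕ.+-identityʳ t))
    state-periodic (suc k) t = ~-trans (≡⇒~ (cong state (lemma t (suc period) (k ℕ.* suc period))))
      (~-trans (periodic (t ℕ.+ k ℕ.* suc period)) (state-periodic k t))
      where
      lemma : ∀ t a b → t ℕ.+ (a ℕ.+ b) ≡ t ℕ.+ b ℕ.+ a
      lemma = ℕSolver.solve-∀

    queue∈ : ∀ t → queue t ∈ᵠ queues
    queue∈ zero    = queue∈queues ordering
    queue∈ (suc t) = lookup rotate-queues (queue∈ t)

    queue-∷ : ∀ t → ∃[ i ] ∃[ q ] queue t ≡ i ∷ q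
    queue-∷ t = go (queue t) (queue∈ t)
      where
      go : ∀ r → r ∈ᵠ queues → ∃[ i ] ∃[ q ] r ≡ i ∷ q
      go (i ∷ q) _ = i , q , refl
      go [] (there (there (there (there (there (there ()))))))

    module _ {v₀} (v₀∈R : ∀ w → 𝓛 w → NonNeg ⟦ act₃ w v₀ ⟧) where
      positive-step : ∀ t → Positive (forward t v₀) → Positive (forward (suc t) v₀)
      positive-step t pos with queue-∷ t
      ... | i , q , eq with step t eq
      ...   | blocked _ fwd _ = subst Positive (sym (fwd v₀)) pos
      ...   | moved ¬pe fwd _ with s-positive pos i
      ...     | inj₂ pos′ = subst Positive (sym (fwd v₀)) pos′
      ...     | inj₁ at-e = ⊥-elim (¬pe (transported λ w w∈ → subst (λ x → NonNeg ⟦ act₃ w x ⟧)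
        (trans (sym (act₃-inverseˡ (state t) v₀)) (cong (backward t) at-e)) (v₀∈R w w∈)))

      positive-steps : ∀ k t → Positive (forward t v₀) → Positive (forward (k ℕ.+ t) v₀)
      positive-steps zero    t pos = pos
      positive-steps (suc k) t pos = positive-step (k ℕ.+ t) (positive-steps k t pos)

    -- If the toggle is blocked, αᵢ and -αᵢ both lie in the cone, so w₀ maps them to opposite
    -- nonnegative vectors and αᵢ would vanish. If it moves, -αᵢ becomes the positive root αᵢ, which
    -- stays positive and cannot return to -αᵢ after a period.
    ¬P-neg-next : ∀ t {i q} → queue t ≡ i ∷ q → ¬ P t (neg (e i))
    ¬P-neg-next t {i} eq p with step t eq
    ... | blocked pe _ _ = neg-e-negative i (subst (λ x → NonNeg ⟦ x ⟧) v≡ NonNeg-0)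
      where
      x₀ : V₃
      x₀ = act₃ w₀ (backward t (neg (e i)))
      opposite : act₃ w₀ (backward t (e i)) ≡ neg x₀
      opposite = trans (cong (λ v → act₃ w₀ (backward t v)) (sym (neg-involutive (e i))))
        (trans (cong (λ v → act₃ w₀ (backward t v)) (neg≡ (neg (e i))))
          (trans (transported-· t w₀ (- + 1) (neg (e i))) (sym (neg≡ x₀))))
      0₃ : V₃
      0₃ = + 0 , + 0 , + 0
      zero-of : ∀ x → NonNeg ⟦ x ⟧ → NonNeg ⟦ neg x ⟧ → x ≡ 0₃
      zero-of (a , b , c) 0≤x 0≤-x = vec-≡ (z a (0≤x 0F) (0≤-x 0F)) (z b (0≤x 1F) (0≤-x 1F))
          (z c (0≤x 2F) (0≤-x 2F))
        where
        z : ∀ a → + 0 ≤ a → + 0 ≤ - a → a ≡ + 0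
        z (+ zero) _ _ = refl
        z (+ suc n) _ ()
      NonNeg-0 : NonNeg ⟦ 0₃ ⟧
      NonNeg-0 0F = ℤ.≤-refl
      NonNeg-0 1F = ℤ.≤-refl
      NonNeg-0 2F = ℤ.≤-refl
      act₃-0 : ∀ w → act₃ w 0₃ ≡ 0₃
      act₃-0 w = act₃-· w (+ 0) 0₃
      v≡ : 0₃ ≡ neg (e i)
      v≡ = sym (begin
        neg (e i)                                        ≡⟨ act₃-inverseʳ (state t) (neg (e i)) ⟨
        forward t (backward t (neg (e i)))               ≡⟨ cong (forward t) (act₃-inverseˡ w₀ _) ⟨
        forward t (act₃ (reverse w₀) x₀)                 ≡⟨ cong (λ x → forward t (act₃ (reverse w₀) x))
                                                              (zero-of x₀ (nonneg p w₀ w₀∈𝓛) (subst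
                                                                  (λ x → NonNeg ⟦ x ⟧) opposite (nonneg
                                                                  pe w₀ w₀∈𝓛))) ⟩
        forward t (act₃ (reverse w₀) 0₃)                 ≡⟨ cong (forward t) (act₃-0 (reverse w₀)) ⟩
        forward t 0₃                                     ≡⟨ act₃-0 (state t) ⟩
        0₃                                               ∎)
        where open ≡-Reasoning
    ... | moved _ fwd _ = neg-e-negative i (subst (λ x → NonNeg ⟦ x ⟧) back (Positive⇒NonNeg
        (positive-steps (nonneg p) period (suc t)
            (subst Positive (sym turned) (small⇒Positive (simple-small i))))))
      where
      v₀ : V₃
      v₀ = backward t (neg (e i))
      at-t : forward t v₀ ≡ neg (e i)
      at-t = act₃-inverseʳ (state t) (neg (e i))
      turned : forward (suc t) v₀ ≡ e i
      turned = trans (fwd v₀) (trans (cong (s i) at-t)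
          (trans (s-neg i (e i)) (trans (cong neg (s-e i)) (neg-involutive (e i)))))
      back : forward (period ℕ.+ suc t) v₀ ≡ neg (e i)
      back = trans (cong (λ r → forward r v₀) (trans (ℕ.+-suc period t) (ℕ.+-comm (suc period) t)))
        (trans (act₃-~ (periodic t) v₀) at-t)

    P-reduce : ∀ {t} v → P t (neg v) → P t (neg (reduce v))
    P-reduce {t} v p with reduce-cases v
    ... | inj₁ eq = subst (P t) (cong neg (sym eq)) p
    ... | inj₂ eq = subst (P t) (trans (lemma₃ v) (cong neg (sym eq))) (P-∔ p P-δ)
      where
      lemma₃ : ∀ v → neg v ∔ δ₃ ≡ neg (v ∔ neg δ₃)
      lemma₃ v = sym (trans (neg-∔ v (neg δ₃)) (cong (neg v ∔_) (neg-involutive δ₃)))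

    private
      P-reflect : ∀ {t} i v → + 0 ≤ pair i v → P t (e i) → P t (neg v) → P t (neg (s i v))
      P-reflect {t} i v 0≤k pe pv = subst (P t) (sym eq) (P-∔ pv (P-· 0≤k pe))
        where
        go : ∀ k v z → neg (v ∔ (- k) · z) ≡ neg v ∔ k · z
        go k (a , b , c) (x , y , z) = vec-≡ (lemma k a x) (lemma k b y) (lemma k c z)
          where
          lemma : ∀ k a x → - (a + - k * x) ≡ - a + k * x
          lemma = solve-∀
        eq : neg (s i v) ≡ neg v ∔ pair i v · e i
        eq = go (pair i v) v (e i)

    module _ {B} (B-sound : ∀ {t q σ} → (q , σ) ∈ˢ B → queue t ≡ q → ¬ P t (neg σ)) where

      -- Applied in two stages to avoid circularity: without assumed states it supports the
      -- refutation of the neutral states, which are then assumed in the climbing search.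
      dead-sound : ∀ f {t q} σ → queue t ≡ q → T (dead B f q σ) → ¬ P t (neg σ)
      dead-sound (suc f) {t} {i ∷ q} σ eq ok p with split-∨ ⌊ (i ∷ q , σ) ∈ˢ? B ⌋ ok
      ... | inj₁ ∈B = B-sound (toWitness {a? = (i ∷ q , σ) ∈ˢ? B} ∈B) eq p
      ... | inj₂ ok′ with split-∨ ⌊ σ ≟₃ e i ⌋ ok′
      ...   | inj₁ ≡e = ¬P-neg-next t eq (subst (λ v → P t (neg v)) (toWitness {a? = σ ≟₃ e i} ≡e) p)
      ...   | inj₂ ok″ with split-∧ (dead B f (q ++ i ∷ []) (reduce (s i σ))) ok″
      ...     | deadˢ , deadᵇ = go (step t eq)
        where
        next : queue (suc t) ≡ q ++ i ∷ []
        next = queue-next {t} eq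
        dead-s : ¬ P (suc t) (neg (s i σ))
        dead-s p′ = dead-sound f (reduce (s i σ)) next deadˢ (P-reduce (s i σ) p′)
        go : Step t i → ⊥
        go (moved _ _ bwd) = dead-s (subst (P (suc t)) (s-neg i σ) (P-moved {t} {i} bwd p))
        go (blocked pe _ bwd) with split-∨ ⌊ + 0 ℤ.≤? pair i σ ⌋ deadᵇ
        ... | inj₁ 0≤pair = dead-s (P-blocked bwd
            (P-reflect i σ (toWitness {a? = + 0 ℤ.≤? pair i σ} 0≤pair) pe p))
        ... | inj₂ deadᵇ′ = dead-sound f σ next deadᵇ′ (P-blocked bwd p)

    dead-[]-sound : ∀ {t q} σ → queue t ≡ q → T (dead [] fuel q σ) → ¬ P t (neg σ)
    dead-[]-sound = dead-sound {[]} (λ ()) fuel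

    h : ℕ → V₃ → ℤ
    h t v = height (act₃ w₀ (backward t v))

    h-∔ : ∀ t v v′ → h t (v ∔ v′) ≡ h t v + h t v′
    h-∔ t v v′ = trans (cong height
        (trans (cong (act₃ w₀) (act₃-∔ (reverse (state t)) v v′)) (act₃-∔ w₀ _ _)))
        (height-∔ (act₃ w₀ (backward t v)) (act₃ w₀ (backward t v′)))

    h-· : ∀ t k v → h t (k · v) ≡ k * h t v
    h-· t k v = trans (cong height (transported-· t w₀ k v)) (height-· k _)

    h-δ : ∀ t → h t δ₃ ≡ + 6
    h-δ t = cong height (trans (cong (act₃ w₀) (act₃-δ (reverse (state t)))) (act₃-δ w₀))

    private
      multiples : ∀ {t} a b d {γ} i → P t (neg γ) → P t (e i) → P t
          ((+ a) · neg γ ∔ (+ b) · e i ∔ (+ d) · δ₃)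
      multiples {t} a b d {γ} i pγ pe =
        P-∔ {_} {(+ a) · neg γ ∔ (+ b) · e i}
            (P-∔ {_} {(+ a) · neg γ} (P-· {k = + a} (ℤ.+≤+ ℕ.z≤n) pγ) (P-· {k = + b} (ℤ.+≤+ ℕ.z≤n) pe))
          (P-· {k = + d} (ℤ.+≤+ ℕ.z≤n) P-δ)

      h-reflect : ∀ {t} i η → + 0 ≤ pair i η → P t (e i) → h t (s i η) ≤ h t η
      h-reflect {t} i η 0≤k pe = ℤ.≤-trans (ℤ.≤-reflexive eq) (sub (h t η)
          (subst (_≤ pair i η * h t (e i)) (ℤ.*-zeroʳ (pair i η)) (mono (pair i η) 0≤k)))
        where
        sub : ∀ x {y} → + 0 ≤ y → x - y ≤ x
        sub x {+ y} _ = ℤ.i-j≤i x (+ y)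
        mono : ∀ k → + 0 ≤ k → k * + 0 ≤ k * h t (e i)
        mono (+ k) _ = ℤ.*-monoˡ-≤-nonNeg (+ k)
            (height-nonneg {act₃ w₀ (backward t (e i))} (nonneg pe w₀ w₀∈𝓛))
        eq : h t (s i η) ≡ h t η - pair i η * h t (e i)
        eq = trans (h-∔ t η ((- pair i η) · e i)) (cong (_+_ (h t η)) (trans (h-· t (- pair i η) (e i))
          (sym (ℤ.neg-distribˡ-* (pair i η) (h t (e i))))))

    -- A toggle that moves leaves the vectors transported back unchanged. A blocked one puts αᵢ into
    -- the cone: with nonnegative pairings, reflecting adds a multiple of αᵢ to -γ and subtracts one
    -- from η; in the remaining case the combination contradicts `dead`.
    walk-step : ∀ r {t i q} γ η → queue t ≡ i ∷ q → T (valid r i q γ η) → P t (neg γ) →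
                P (suc t) (neg (s i γ)) × h (suc t) (s i η) ≤ h t η
    walk-step r {t} {i} {q} γ η eq ok p = go r ok (step t eq)
      where
      h-suc : (∀ v → backward (suc t) v ≡ backward t v) → ∀ v → h (suc t) v ≡ h t v
      h-suc bwd v = cong (λ x → height (act₃ w₀ x)) (bwd v)
      go : ∀ r → T (valid r i q γ η) → Step t i → P (suc t) (neg (s i γ)) × h (suc t) (s i η) ≤ h t η
      go _ _ (moved _ _ bwd) = subst (P (suc t)) (s-neg i γ) (P-moved {t} {i} bwd p) ,
        ℤ.≤-reflexive (cong (λ x → height (act₃ w₀ x)) (bwd η))
      go pairings ok (blocked pe _ bwd) with split-∧ ⌊ + 0 ℤ.≤? pair i γ ⌋ ok
      ... | okγ , okη = P-blocked bwd (P-reflect i γ (toWitness {a? = + 0 ℤ.≤? pair i γ} okγ) pe p) ,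
        subst (_≤ h t η) (sym (h-suc bwd (s i η)))
            (h-reflect i η (toWitness {a? = + 0 ℤ.≤? pair i η} okη) pe)
      go (refutation a b d k γ′) ok (blocked pe _ bwd)
        with split-∧ ⌊ ((+ suc k) · neg γ′) ≟₃ ((+ a) · neg γ ∔ (+ b) · e i ∔ (+ d) · δ₃) ⌋ ok
      ... | combination , refuted = ⊥-elim (dead-[]-sound γ′ (queue-next {t} eq) refuted
        (P-blocked bwd (P-cancel k (neg γ′)
            (subst (P t) (sym (toWitness {a? = ((+ suc k) · neg γ′) ≟₃
            ((+ a) · neg γ ∔ (+ b) · e i ∔ (+ d) · δ₃)} combination)) (multiples a b d i p pe)))))

    walk-sound : ∀ rs {t q γ η q′ γ′ η′} → queue t ≡ q → T (walk rs q γ η q′ γ′ η′) → P t (neg γ) →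
                 queue (length rs ℕ.+ t) ≡ q′ × P (length rs ℕ.+ t) (neg γ′) × h (length rs ℕ.+ t) η′ ≤
                     h t η
    walk-sound [] {t} {q} {γ} {η} {q′} {γ′} {η′} eq ok p with split-∧ ⌊ q ≟ᵠ q′ ⌋ ok
    ... | q≡ , ok′ with split-∧ ⌊ γ ≟₃ γ′ ⌋ ok′
    ...   | γ≡ , η≡ = trans eq (toWitness {a? = q ≟ᵠ q′} q≡) , subst (λ v → P t (neg v))
        (toWitness {a? = γ ≟₃ γ′} γ≡) p ,
      ℤ.≤-reflexive (cong (h t) (sym (toWitness {a? = η ≟₃ η′} η≡)))
    walk-sound (r ∷ rs) {t} {i ∷ q} {γ} {η} {q′} {γ′} {η′} eq ok p with split-∧ (valid r i q γ η) ok
    ... | okᵣ , ok′ with walk-step r γ η eq okᵣ p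
    ...   | p₁ , h₁ with walk-sound rs (queue-next {t} eq) ok′ p₁
    ...     | eq₂ , p₂ , h₂ rewrite ℕ.+-suc (length rs) t = eq₂ , p₂ , ℤ.≤-trans h₂ h₁

    private
      -- When every `k`th state is sampled, `suc period` samples span exactly `k` periods, so the
      -- samples are periodic too.
      blocks-periodic : ∀ k j t → state ((j ℕ.+ suc period) ℕ.* k ℕ.+ t) ~ state (j ℕ.* k ℕ.+ t)
      blocks-periodic k j t = ~-trans (≡⇒~ (cong state (lemma j (suc period) k t)))
          (state-periodic k (j ℕ.* k ℕ.+ t))
        where
        lemma : ∀ j a k t → (j ℕ.+ a) ℕ.* k ℕ.+ t ≡ j ℕ.* k ℕ.+ t ℕ.+ k ℕ.* a
        lemma = ℕSolver.solve-∀

    -- Six steps are two rounds: they restore the queue and σ and turn η into η + δ. As the height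
    -- along the walk does not increase and δ accounts for 6 of it, the value at η itself drops by
    -- at least 6, although it is periodic in the number of turns.
    neutral-sound : ∀ {t q σ} → (q , σ) ∈ˢ neutralStates → queue t ≡ q → ¬ P t (neg σ)
    neutral-sound {t} {q} {σ} ∈neutral eq p with neutral-walk ∈neutral
    ... | r₁ , r₂ , r₃ , r₄ , r₅ , r₆ , η , ok =
      no-periodic-descent Descends b period b-periodic (λ { {j} (_ , _ , refl) → ℤ.≤-refl {b j} })
          (λ {j} → turn {j}) {0} (eq , p , refl)
      where
      rs : List Reason
      rs = r₁ ∷ r₂ ∷ r₃ ∷ r₄ ∷ r₅ ∷ r₆ ∷ []
      b : ℕ → ℤ
      b j = h (j ℕ.* 6 ℕ.+ t) η
      Descends : ℕ → ℤ → Set p′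
      Descends j x = queue (j ℕ.* 6 ℕ.+ t) ≡ q × P (j ℕ.* 6 ℕ.+ t) (neg σ) × x ≡ b j
      b-periodic : ∀ j → b (j ℕ.+ suc period) ≡ b j
      b-periodic j = cong (λ v → height (act₃ w₀ v)) (act₃-~ (~-reverse-cong (blocks-periodic 6 j t)) η)
      turn : ∀ {j x} → Descends j x → ∃[ y ] Descends (suc j) y × y < x
      turn {j} (eqⱼ , pⱼ , refl) with walk-sound rs eqⱼ ok pⱼ
      ... | eq′ , p′ , drop = b (suc j) , (eq′ , p′ , refl) ,
        ℤ.<-≤-trans (<-by 5 (sym (trans (h-∔ (suc j ℕ.* 6 ℕ.+ t) η δ₃)
            (cong (_+_ (b (suc j))) (h-δ (suc j ℕ.* 6 ℕ.+ t)))))) drop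

    module _ {v₀} (v₀∈R : ∀ w → 𝓛 w → NonNeg ⟦ act₃ w v₀ ⟧) (negative : Positive (neg (forward 0 v₀))) where
      γ : ℕ → V₃
      γ t = neg (forward t v₀)

      P-γ : ∀ t → P t (neg (γ t))
      P-γ t .nonneg w w∈ = subst (λ x → NonNeg ⟦ act₃ w x ⟧)
        (sym (trans (cong (backward t) (neg-involutive (forward t v₀))) (act₃-inverseˡ (state t) v₀)))
            (v₀∈R w w∈)

      γ-moved : ∀ {t i} → (∀ v → forward (suc t) v ≡ s i (forward t v)) → γ (suc t) ≡ s i (γ t)
      γ-moved {t} {i} fwd = trans (cong neg (fwd v₀)) (sym (s-neg i (forward t v₀)))

      γ-positive : ∀ t → Positive (γ t)
      γ-positive zero    = negative
      γ-positive (suc t) with queue-∷ t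
      ... | i , q , eq with step t eq
      ...   | blocked _ fwd _ = subst Positive (cong neg (sym (fwd v₀))) (γ-positive t)
      ...   | moved _ fwd _ with s-positive (γ-positive t) i
      ...     | inj₂ pos = subst Positive (sym (γ-moved {t} {i} fwd)) pos
      ...     | inj₁ ≡e  = ⊥-elim (¬P-neg-next t eq (subst (λ v → P t (neg v)) ≡e (P-γ t)))

      -- Reflections fix δ, so `m` never changes and only `v` is followed. When `v` is refuted, the
      -- multiple of δ is removed by adding it to the negative root inside the cone.
      climbs-sound : ∀ f {t q x} v m → queue t ≡ q → γ t ≡ v ∔ (+ m) · δ₃ → T
          (climbs neutralStates f x q v) →
                     x + + m * + 6 < height (γ (f ℕ.+ t))
      climbs-sound zero {t} {x = x} v m _ γ≡ ok = subst (x + + m * + 6 <_)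
        (sym (trans (cong height γ≡) (trans (height-∔ v ((+ m) · δ₃))
            (cong (_+_ (height v)) (height-· (+ m) δ₃)))))
        (ℤ.+-monoˡ-< (+ m * + 6) (toWitness {a? = x ℤ.<? height v} ok))
      climbs-sound (suc f) {t} {i ∷ q} {x} v m eq γ≡ ok with split-∨
          (dead neutralStates fuel (i ∷ q) (reduce v)) ok
      ... | inj₁ refuted = ⊥-elim (dead-sound neutral-sound fuel (reduce v) eq refuted (P-reduce v
        (subst (P t) (cancel v m) (P-∔ {_} {neg (v ∔ (+ m) · δ₃)} {(+ m) · δ₃}
            (subst (λ g → P t (neg g)) γ≡ (P-γ t))
          (P-· {k = + m} (ℤ.+≤+ ℕ.z≤n) P-δ)))))
        where
        cancel : ∀ v m → neg (v ∔ (+ m) · δ₃) ∔ (+ m) · δ₃ ≡ neg v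
        cancel (a , b , c) m = vec-≡ (lemma a (+ m * + 1)) (lemma b (+ m * + 2)) (lemma c (+ m * + 3))
          where
          lemma : ∀ a d → - (a + d) + d ≡ - a
          lemma = solve-∀
      ... | inj₂ ok′ with split-∧ (climbs neutralStates f x (q ++ i ∷ []) v) ok′
      ...   | okᵇ , okˢ = subst (λ r → x + + m * + 6 < height (γ r)) (ℕ.+-suc f t) (go (step t eq))
        where
        go : Step t i → x + + m * + 6 < height (γ (f ℕ.+ suc t))
        go (blocked _ fwd _) = climbs-sound f v m (queue-next {t} eq) (trans (cong neg (fwd v₀)) γ≡) okᵇ
        go (moved _ fwd _)   = climbs-sound f (s i v) m (queue-next {t} eq)
          (trans (γ-moved {t} {i} fwd) (trans (cong (s i) γ≡) (s-shift i v (+ m)))) okˢ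

      climb : ∀ t → height (γ t) < height (γ (5 ℕ.+ t))
      climb t = go (γ-positive t) refl
        where
        go : ∀ {v} → Positive v → γ t ≡ v → height (γ t) < height (γ (5 ℕ.+ t))
        go (positive {σ} σ∈ m) γ≡ = subst (_< height (γ (5 ℕ.+ t)))
          (sym (trans (cong height γ≡) (trans (height-∔ σ ((+ m) · δ₃))
              (cong (_+_ (height σ)) (height-· (+ m) δ₃)))))
          (climbs-sound 5 σ m refl γ≡ (lookup (lookup all-climb (queue∈ t)) σ∈))

      no-negative : ⊥
      no-negative = no-periodic-descent (λ j x → x ≡ b j) b period b-periodic (λ { refl → ℤ.≤-refl })
        (λ { {j} refl → b (suc j) , refl , ℤ.neg-mono-< (climb (j ℕ.* 5 ℕ.+ 0)) }) {0} refl
        where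
        b : ℕ → ℤ
        b j = - height (γ (j ℕ.* 5 ℕ.+ 0))
        b-periodic : ∀ j → b (j ℕ.+ suc period) ≡ b j
        b-periodic j = cong (λ v → - height (neg v)) (act₃-~ (blocks-periodic 5 j 0) v₀)

  g₂-futuristic : ∀ p → IntegrallyFuturistic g₂Cartan p
  g₂-futuristic p 𝓛 (w₀ , w₀∈𝓛) is ordering u orbit x k inR =
    subst (λ u → NonNeg (act u (act x (eᵥ k)))) (Toggling.Orbit.state-0 orbit)
      (NonNeg-resp (λ j → sym (act-root≗ u₀ x k j)) (go (root-sign (u₀ ++ x) k)))
    where
    u₀ : List (Fin 3)
    u₀ = Toggling.Orbit.state orbit 0
    go : Positive (act₃ (u₀ ++ x) (e k)) ⊎ Positive (neg (act₃ (u₀ ++ x) (e k))) → NonNeg ⟦ act₃ u₀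
        (act₃ x (e k)) ⟧
    go (inj₁ pos) = Positive⇒NonNeg (subst Positive (act₃-++ u₀ x (e k)) pos)
    go (inj₂ pos) = ⊥-elim (no-negative 𝓛 w₀∈𝓛 ordering orbit
        (λ w w∈ → NonNeg-resp (act-root≗ w x k) (inR w∈))
      (subst (λ v → Positive (neg v)) (act₃-++ u₀ x (e k)) pos))

-- Assembly of the affine types

open Reduction
open LineBilliards
open AffineLines
open G2Vectors
open G2Billiards

theorem1p15 : ∀ {c ℓ₁ ℓ₂ ℓ₃ a p n} (ℝ : Reals c ℓ₁ ℓ₂ ℓ₃) (X : Type n) → Futuristic ℝ (coxeterMatrix X) a p
theorem1p15 ℝ A~₁    = FromReals.integral ℝ Segment.segmentCartan (line-futuristic Segment.segmentLine _)
theorem1p15 ℝ (A~ k) = FromReals.integral ℝ (Cyclic.cycleCartan k) (line-futuristic (Cyclic.cycleLine k) _)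
theorem1p15 ℝ (C~ k) = FromReals.integral ℝ (Path.pathCartan k) (line-futuristic (Path.pathLine k) _)
theorem1p15 ℝ G~₂    = FromReals.integral ℝ g₂Cartan (g₂-futuristic _)
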